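{- Let $L\subset L_m$ be a partial staircase. With respect to a certain term order, the monomial basis constructed from $\mathbf m^{(nc)}_L$ is the basis of standard monomials. That is, let $S=\mathbb C[y_I: I\in 2^{\mathbf m}_L]$ be a polynomial ring, let $\phi:S\to\mathbb C[x_{ij}:1\le i,j\le m]$ be the $\mathbb C$-algebra homomorphism with $\phi(y_I)=x_I$, and let $K=\ker\phi$. Then there is a term order on $S$ such that the standard monomials, i.e. the monomials of $S$ not lying in the initial ideal $\mathrm{in}(K)$, are exactly the monomials $\prod_{I\in T} y_I$ where $T$ runs over all finite multisets of elements of $2^{\mathbf m}_L$ whose set of distinct elements is a face of $\mathbf m^{(nc)}_L$.
   Context: Shapes. Let $m\ge1$, $[m]=\{1,\dots,m\}$. The source is $(0,0)$; the sinks of the staircase $L_m$ are the points $(m-k,k)$, $0\le k\le m$. A partial staircase $L\subset L_m$ is given by a nonempty set of selected sinks (the sinks of $L$) together with all nodes of $\mathbb Z_{\ge 0}^2$ weakly south and west of some selected sink. For $I\subseteq[m]$, $p(I)$ is the lattice path from $(0,0)$ of length $m$ whose $t$-th step is north if $t\in I$ and east otherwise. $2^{\mathbf m}_L$ is the set of $I\subseteq[m]$ such that $p(I)$ is contained in $L$ (equivalently, $(m-|I|,|I|)$ is a sink of $L$). Minors. $X=(x_{ij})$ is an $m\times m$ matrix of indeterminates (rows numbered from the bottom), and $x_I$ is the minor of $X$ with column set $I$ and row set $\{1,\dots,|I|\}$. The Plücker algebra is generated by the $x_I$; for a partial staircase $L$ one takes the subalgebra generated by the $x_I$ with $I\in 2^{\mathbf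 m}_L$. The monomial basis constructed from $\mathbf m^{(nc)}_L$ consists of the products $\prod_{I\in T}x_I$ over finite multisets $T$ whose set of distinct elements is a face of $\mathbf m^{(nc)}_L$. Non-crossing rule. Two pairs $\{u<v\}$, $\{x<y\}$ of elements of $\mathbb Z\cup\{\infty\}$ are non-crossing if neither $x<u<y<v$ nor $u<x<v<y$ holds. Let $I=\{i_1<\dots<i_k\}$, $J=\{j_1<\dots<j_l\}$ be subsets of $[m]$ with $k\le l$. For every $s$ with $i_s=j_s$ remove $i_s$ from $I$ and $j_s$ from $J$, obtaining $I'=\{i'_1<\dots<i'_{k'}\}$ and $J'=\{j'_1<\dots<j'_{l'}\}$. $I$ and $J$ are non-crossing if (1) for all $1\le s\le k'-1$ the pairs $\{i'_s,i'_{s+1}\}$, $\{j'_s,j'_{s+1}\}$ are non-crossing, and (2) if $k'<l'$, the pairs $\{i'_{k'},\infty\}$, $\{j'_{k'},j'_{k'+1}\}$ are non-crossing (vacuous if $k'=0$). $\mathbf m^{(nc)}_L$ is the simplicial complex on vertex set $2^{\mathbf m}_L$ whose faces are the sets of pairwise non-crossing elements.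
   Formalization: The multisets T are additionally required not to contain the empty set: if the sink (m,0) is selected, then x_∅ = 1, so y_∅ − 1 lies in K and y_∅ is never standard although {∅} is a face; otherwise this condition is vacuous. -}

module Defs where

open import Algebra.Bundles using (CommutativeRing)
open import Data.Bool.Base using (true; false)
import Data.Bool.Properties as Bool
open import Data.Fin.Base using (Fin; zero; suc; toℕ; inject≤; punchIn; _<_)
import Data.Fin.Properties as Fin
open import Data.Fin.Subset using (Subset; inside; outside; Nonempty; ∣_∣) renaming (_∈_ to _∈ˢ_)
open import Data.Fin.Subset.Properties using (∣p∣≤n)
open import Data.List.Base using (List; []; _∷_; _++_; map; foldr; concatMap; tabulate)
import Data.List.Membership.DecPropositional as DecMembership
open import Data.List.Membership.Propositional using (_∈_)
open import Data.List.Membership.Propositional.Properties using (∈-∃++)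
open import Data.List.Relation.Binary.Permutation.Propositional
  using (_↭_; ↭-refl; ↭-sym; ↭-trans; prep)
open import Data.List.Relation.Binary.Permutation.Propositional.Properties
  using (shift; drop-∷; ∈-resp-↭; ¬x∷xs↭[])
open import Data.List.Relation.Unary.All using (All)
open import Data.List.Relation.Unary.Any using (here)
open import Data.Nat.Base as ℕ using (ℕ; zero; suc; _∸_; _⊔_)
import Data.Nat.Properties as ℕ
open import Data.Product.Base using (∃; _×_; _,_)
open import Data.Product.Properties using (≡-dec)
open import Data.Rational.Base as ℚ using (ℚ; 0ℚ; 1ℚ; ½)
import Data.Rational.Properties as ℚ
open import Data.Rational.Solver using (module +-*-Solver)
open import Data.Refinement using (Refinement-syntax; value)
import Data.Refinement as Refinement
open import Data.Unit.Base using (⊤)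
open import Data.Vec.Base as Vec using (Vec; []; _∷_; lookup; toList)
import Data.Vec.Properties as Vec
open import Level using (0ℓ)
open import Relation.Binary.Construct.Add.Supremum.Strict using (_<⁺_)
open import Relation.Binary.Core using (Rel)
open import Relation.Binary.Definitions using (DecidableEquality)
open import Relation.Binary.PropositionalEquality
  using (_≡_; refl; sym; trans; cong; subst)
open import Relation.Binary.Structures using (IsStrictTotalOrder)
open import Relation.Nullary using (¬_; Dec; yes; no; does)
open import Relation.Nullary.Construct.Add.Supremum using (_⁺; [_]; ⊤⁺)
open import Relation.Unary using (Pred)

-- Reals are Cauchy sequences of rationals, identified when their difference
-- tends to 0. 

IsCauchy : (ℕ → ℚ) → Set
IsCauchy x = ∀ ε → 0ℚ ℚ.< ε →
  ∃ λ N → ∀ m n → N ℕ.≤ m → N ℕ.≤ n → ℚ.∣ x m ℚ.- x n ∣ ℚ.< ε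

record ℝ : Set where
  constructor real
  field
    seq    : ℕ → ℚ
    cauchy : IsCauchy seq
open ℝ public

infix 4 _≈ᴿ_
_≈ᴿ_ : ℝ → ℝ → Set
x ≈ᴿ y = ∀ ε → 0ℚ ℚ.< ε →
  ∃ λ N → ∀ n → N ℕ.≤ n → ℚ.∣ seq x n ℚ.- seq y n ∣ ℚ.< ε

private
  open +-*-Solver using (solve; con; _:=_; _:+_; _:*_; _:-_; :-_)

  0<½ε : ∀ {ε} → 0ℚ ℚ.< ε → 0ℚ ℚ.< ½ ℚ.* ε
  0<½ε {ε} 0<ε = subst (ℚ._< ½ ℚ.* ε) (ℚ.*-zeroʳ ½) (ℚ.*-monoʳ-<-pos ½ 0<ε)

  ½ε+½ε : ∀ ε → ½ ℚ.* ε ℚ.+ ½ ℚ.* ε ≡ ε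
  ½ε+½ε ε = trans (sym (ℚ.*-distribʳ-+ ε ½ ½)) (ℚ.*-identityˡ ε)

  ∣+∣<ε : ∀ {ε} a b → ℚ.∣ a ∣ ℚ.< ½ ℚ.* ε → ℚ.∣ b ∣ ℚ.< ½ ℚ.* ε → ℚ.∣ a ℚ.+ b ∣ ℚ.< ε
  ∣+∣<ε {ε} a b p q = ℚ.≤-<-trans (ℚ.∣p+q∣≤∣p∣+∣q∣ a b)
    (subst (ℚ.∣ a ∣ ℚ.+ ℚ.∣ b ∣ ℚ.<_) (½ε+½ε ε) (ℚ.+-mono-< p q))

  EventuallyBounded : (ℕ → ℚ) → Set
  EventuallyBounded x = ∃ λ B → 0ℚ ℚ.< B × ∃ λ N → ∀ n → N ℕ.≤ n → ℚ.∣ x n ∣ ℚ.≤ B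

  bounded : (x : ℝ) → EventuallyBounded (seq x)
  bounded (real x c) with c 1ℚ (ℚ.positive⁻¹ 1ℚ)
  ... | N , h = ℚ.∣ x N ∣ ℚ.+ 1ℚ
              , ℚ.+-mono-≤-< (ℚ.0≤∣p∣ (x N)) (ℚ.positive⁻¹ 1ℚ)
              , N , λ n N≤n →
    subst (λ z → ℚ.∣ z ∣ ℚ.≤ ℚ.∣ x N ∣ ℚ.+ 1ℚ)
      (solve 2 (λ a b → a :+ (b :- a) := b) refl (x N) (x n))
      (ℚ.≤-trans (ℚ.∣p+q∣≤∣p∣+∣q∣ (x N) (x n ℚ.- x N))
        (ℚ.+-monoʳ-≤ ℚ.∣ x N ∣ (ℚ.<⇒≤ (h n N N≤n ℕ.≤-refl))))

  scale : ∀ {B ε} → 0ℚ ℚ.< B → 0ℚ ℚ.< ε → ∃ λ δ → 0ℚ ℚ.< δ ×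
    (∀ a d → ℚ.∣ a ∣ ℚ.≤ B → ℚ.∣ d ∣ ℚ.< δ → ℚ.∣ a ℚ.* d ∣ ℚ.< ε)
  scale {B} {ε} 0<B 0<ε = δ , 0<δ , λ a d a≤B d<δ →
      subst (ℚ._< ε) (sym (ℚ.∣p*q∣≡∣p∣*∣q∣ a d))
        (ℚ.≤-<-trans
          (ℚ.*-monoʳ-≤-nonNeg ℚ.∣ d ∣ {{ℚ.nonNegative (ℚ.0≤∣p∣ d)}} a≤B)
          (subst (B ℚ.* ℚ.∣ d ∣ ℚ.<_) Bδ (ℚ.*-monoʳ-<-pos B d<δ)))
    where
    instance
      B⁺ : ℚ.Positive B
      B⁺ = ℚ.positive 0<B
      B≢0 : ℚ.NonZero B
      B≢0 = ℚ.pos⇒nonZero B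
      B⁻¹⁺ : ℚ.Positive (ℚ.1/ B)
      B⁻¹⁺ = ℚ.1/pos⇒pos B
    δ : ℚ
    δ = ℚ.1/ B ℚ.* ε
    0<δ : 0ℚ ℚ.< δ
    0<δ = subst (ℚ._< δ) (ℚ.*-zeroʳ (ℚ.1/ B)) (ℚ.*-monoʳ-<-pos (ℚ.1/ B) 0<ε)
    Bδ : B ℚ.* δ ≡ ε
    Bδ = trans (sym (ℚ.*-assoc B (ℚ.1/ B) ε))
           (trans (cong (ℚ._* ε) (ℚ.*-inverseʳ B)) (ℚ.*-identityˡ ε))

  ⊔ˡ : ∀ {a b n} → a ⊔ b ℕ.≤ n → a ℕ.≤ n
  ⊔ˡ {a} {b} = ℕ.m⊔n≤o⇒m≤o a b

  ⊔ʳ : ∀ {a b n} → a ⊔ b ℕ.≤ n → b ℕ.≤ n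
  ⊔ʳ {a} {b} = ℕ.m⊔n≤o⇒n≤o a b

  +-diff : ∀ a b c d → (a ℚ.- c) ℚ.+ (b ℚ.- d) ≡ (a ℚ.+ b) ℚ.- (c ℚ.+ d)
  +-diff = solve 4 (λ a b c d → (a :- c) :+ (b :- d) := (a :+ b) :- (c :+ d)) refl

  *-diff : ∀ a b c d → a ℚ.* (b ℚ.- d) ℚ.+ d ℚ.* (a ℚ.- c) ≡ a ℚ.* b ℚ.- c ℚ.* d
  *-diff = solve 4 (λ a b c d → a :* (b :- d) :+ d :* (a :- c) := a :* b :- c :* d) refl

  neg-diff : ∀ a b → ℚ.- (a ℚ.- b) ≡ (ℚ.- a) ℚ.- (ℚ.- b)
  neg-diff = solve 2 (λ a b → :- (a :- b) := (:- a) :- (:- b)) refl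

  ∣neg-diff∣ : ∀ a b → ℚ.∣ a ℚ.- b ∣ ≡ ℚ.∣ (ℚ.- a) ℚ.- (ℚ.- b) ∣
  ∣neg-diff∣ a b = trans (sym (ℚ.∣-p∣≡∣p∣ (a ℚ.- b))) (cong ℚ.∣_∣ (neg-diff a b))

infixl 6 _+ᴿ_
infixl 7 _*ᴿ_
infix  8 -ᴿ_

_+ᴿ_ : ℝ → ℝ → ℝ
real x cx +ᴿ real y cy = real (λ n → x n ℚ.+ y n) λ ε 0<ε →
  let (N₁ , h₁) = cx (½ ℚ.* ε) (0<½ε 0<ε)
      (N₂ , h₂) = cy (½ ℚ.* ε) (0<½ε 0<ε)
  in N₁ ⊔ N₂ , λ m n p q →
    subst (λ z → ℚ.∣ z ∣ ℚ.< ε) (+-diff (x m) (y m) (x n) (y n))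
      (∣+∣<ε (x m ℚ.- x n) (y m ℚ.- y n)
        (h₁ m n (⊔ˡ p) (⊔ˡ q)) (h₂ m n (⊔ʳ {N₁} p) (⊔ʳ {N₁} q)))

-ᴿ_ : ℝ → ℝ
-ᴿ real x cx = real (λ n → ℚ.- x n) λ ε 0<ε →
  let (N , h) = cx ε 0<ε
  in N , λ m n p q → subst (ℚ._< ε) (∣neg-diff∣ (x m) (x n)) (h m n p q)

_*ᴿ_ : ℝ → ℝ → ℝ
real x cx *ᴿ real y cy = real (λ n → x n ℚ.* y n) λ ε 0<ε →
  let (A , 0<A , M₁ , a)  = bounded (real x cx)
      (B , 0<B , M₂ , b)  = bounded (real y cy)
      (δ₁ , 0<δ₁ , s₁)    = scale 0<A (0<½ε 0<ε)
      (δ₂ , 0<δ₂ , s₂)    = scale 0<B (0<½ε 0<ε)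
      (N₁ , h₁)           = cy δ₁ 0<δ₁
      (N₂ , h₂)           = cx δ₂ 0<δ₂
  in (M₁ ⊔ M₂) ⊔ (N₁ ⊔ N₂) , λ m n p q →
    subst (λ z → ℚ.∣ z ∣ ℚ.< ε) (*-diff (x m) (y m) (x n) (y n))
      (∣+∣<ε (x m ℚ.* (y m ℚ.- y n)) (y n ℚ.* (x m ℚ.- x n))
        (s₁ (x m) (y m ℚ.- y n) (a m (⊔ˡ {M₁} (⊔ˡ p)))
          (h₁ m n (⊔ˡ {N₁} (⊔ʳ {M₁ ⊔ M₂} p)) (⊔ˡ {N₁} (⊔ʳ {M₁ ⊔ M₂} q))))
        (s₂ (y n) (x m ℚ.- x n) (b n (⊔ʳ {M₁} (⊔ˡ q)))
          (h₂ m n (⊔ʳ {N₁} (⊔ʳ {M₁ ⊔ M₂} p)) (⊔ʳ {N₁} (⊔ʳ {M₁ ⊔ M₂} q)))))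

private
  pointwise : ∀ x y → (∀ n → seq x n ≡ seq y n) → x ≈ᴿ y
  pointwise x y e ε 0<ε = 0 , λ n _ →
    subst (λ z → ℚ.∣ z ∣ ℚ.< ε)
      (sym (trans (cong (ℚ._- seq y n) (e n)) (ℚ.+-inverseʳ (seq y n)))) 0<ε

fromℚ : ℚ → ℝ
fromℚ q = real (λ _ → q) λ ε 0<ε → 0 , λ _ _ _ _ →
  subst (λ z → ℚ.∣ z ∣ ℚ.< ε) (sym (ℚ.+-inverseʳ q)) 0<ε

private
  symᴿ : ∀ {x y} → x ≈ᴿ y → y ≈ᴿ x
  symᴿ {x} {y} e ε 0<ε with e ε 0<ε
  ... | N , h = N , λ n p → subst (ℚ._< ε)
    (trans (sym (ℚ.∣-p∣≡∣p∣ (seq x n ℚ.- seq y n)))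
      (cong ℚ.∣_∣ (solve 2 (λ a b → :- (a :- b) := b :- a) refl (seq x n) (seq y n))))
    (h n p)

  transᴿ : ∀ {x y z} → x ≈ᴿ y → y ≈ᴿ z → x ≈ᴿ z
  transᴿ {x} {y} {z} e f ε 0<ε with e (½ ℚ.* ε) (0<½ε 0<ε) | f (½ ℚ.* ε) (0<½ε 0<ε)
  ... | N₁ , h₁ | N₂ , h₂ = N₁ ⊔ N₂ , λ n p →
    subst (λ w → ℚ.∣ w ∣ ℚ.< ε)
      (solve 3 (λ a b c → (a :- b) :+ (b :- c) := a :- c) refl (seq x n) (seq y n) (seq z n))
      (∣+∣<ε (seq x n ℚ.- seq y n) (seq y n ℚ.- seq z n) (h₁ n (⊔ˡ p)) (h₂ n (⊔ʳ {N₁} p)))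

  +ᴿ-cong : ∀ {x y u v} → x ≈ᴿ y → u ≈ᴿ v → x +ᴿ u ≈ᴿ y +ᴿ v
  +ᴿ-cong {x} {y} {u} {v} e f ε 0<ε with e (½ ℚ.* ε) (0<½ε 0<ε) | f (½ ℚ.* ε) (0<½ε 0<ε)
  ... | N₁ , h₁ | N₂ , h₂ = N₁ ⊔ N₂ , λ n p →
    subst (λ w → ℚ.∣ w ∣ ℚ.< ε) (+-diff (seq x n) (seq u n) (seq y n) (seq v n))
      (∣+∣<ε (seq x n ℚ.- seq y n) (seq u n ℚ.- seq v n) (h₁ n (⊔ˡ p)) (h₂ n (⊔ʳ {N₁} p)))

  -ᴿ-cong : ∀ {x y} → x ≈ᴿ y → -ᴿ x ≈ᴿ -ᴿ y
  -ᴿ-cong {x} {y} e ε 0<ε with e ε 0<ε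
  ... | N , h = N , λ n p → subst (ℚ._< ε) (∣neg-diff∣ (seq x n) (seq y n)) (h n p)

  *ᴿ-cong : ∀ {x y u v} → x ≈ᴿ y → u ≈ᴿ v → x *ᴿ u ≈ᴿ y *ᴿ v
  *ᴿ-cong {x} {y} {u} {v} e f ε 0<ε =
    let (A , 0<A , M₁ , a)  = bounded x
        (B , 0<B , M₂ , b)  = bounded v
        (δ₁ , 0<δ₁ , s₁)    = scale 0<A (0<½ε 0<ε)
        (δ₂ , 0<δ₂ , s₂)    = scale 0<B (0<½ε 0<ε)
        (N₁ , h₁)           = f δ₁ 0<δ₁
        (N₂ , h₂)           = e δ₂ 0<δ₂
    in (M₁ ⊔ M₂) ⊔ (N₁ ⊔ N₂) , λ n p →
      subst (λ z → ℚ.∣ z ∣ ℚ.< ε) (*-diff (seq x n) (seq u n) (seq y n) (seq v n))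
        (∣+∣<ε (seq x n ℚ.* (seq u n ℚ.- seq v n)) (seq v n ℚ.* (seq x n ℚ.- seq y n))
          (s₁ (seq x n) (seq u n ℚ.- seq v n) (a n (⊔ˡ {M₁} (⊔ˡ p)))
            (h₁ n (⊔ˡ {N₁} (⊔ʳ {M₁ ⊔ M₂} p))))
          (s₂ (seq v n) (seq x n ℚ.- seq y n) (b n (⊔ʳ {M₁} (⊔ˡ p)))
            (h₂ n (⊔ʳ {N₁} (⊔ʳ {M₁ ⊔ M₂} p)))))

record ℂ : Set where
  constructor _+i_
  field
    re im : ℝ
open ℂ public

infix 4 _≈ᶜ_
_≈ᶜ_ : ℂ → ℂ → Set
z ≈ᶜ w = re z ≈ᴿ re w × im z ≈ᴿ im w

ℂ-commutativeRing : CommutativeRing 0ℓ 0ℓ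
ℂ-commutativeRing = record
  { Carrier = ℂ
  ; _≈_ = _≈ᶜ_
  ; _+_ = _⊕_
  ; _*_ = _⊛_
  ; -_  = ⊖_
  ; 0#  = 0ᶜ
  ; 1#  = 1ᶜ
  ; isCommutativeRing = record
    { isRing = record
      { +-isAbelianGroup = record
        { isGroup = record
          { isMonoid = record
            { isSemigroup = record
              { isMagma = record
                { isEquivalence = record
                  { refl  = λ {z} → pw z z (λ _ → refl) (λ _ → refl)
                  ; sym   = λ {z} {w} (p , q) → symᴿ {re z} {re w} p , symᴿ {im z} {im w} q
                  ; trans = λ {u} {v} {w} (p , q) (p′ , q′) →
                      transᴿ {re u} {re v} {re w} p p′ , transᴿ {im u} {im v} {im w} q q′
                  }
                ; ∙-cong = λ {x} {y} {u} {v} (p , q) (p′ , q′) →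
                    +ᴿ-cong {re x} {re y} {re u} {re v} p p′
                  , +ᴿ-cong {im x} {im y} {im u} {im v} q q′
                }
              ; assoc = λ x y z → pw ((x ⊕ y) ⊕ z) (x ⊕ (y ⊕ z))
                  (λ n → ℚ.+-assoc (r x n) (r y n) (r z n))
                  (λ n → ℚ.+-assoc (i x n) (i y n) (i z n))
              }
            ; identity =
                (λ x → pw (0ᶜ ⊕ x) x (λ n → ℚ.+-identityˡ (r x n)) (λ n → ℚ.+-identityˡ (i x n)))
              , (λ x → pw (x ⊕ 0ᶜ) x (λ n → ℚ.+-identityʳ (r x n)) (λ n → ℚ.+-identityʳ (i x n)))
            }
          ; inverse =
              (λ x → pw ((⊖ x) ⊕ x) 0ᶜ (λ n → ℚ.+-inverseˡ (r x n)) (λ n → ℚ.+-inverseˡ (i x n)))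
            , (λ x → pw (x ⊕ (⊖ x)) 0ᶜ (λ n → ℚ.+-inverseʳ (r x n)) (λ n → ℚ.+-inverseʳ (i x n)))
          ; ⁻¹-cong = λ {x} {y} (p , q) → -ᴿ-cong {re x} {re y} p , -ᴿ-cong {im x} {im y} q
          }
        ; comm = λ x y → pw (x ⊕ y) (y ⊕ x)
            (λ n → ℚ.+-comm (r x n) (r y n)) (λ n → ℚ.+-comm (i x n) (i y n))
        }
      ; *-cong = λ {x} {y} {u} {v} (p , q) (p′ , q′) →
          +ᴿ-cong {re x *ᴿ re u} {re y *ᴿ re v} { -ᴿ (im x *ᴿ im u)} { -ᴿ (im y *ᴿ im v)}
            (*ᴿ-cong {re x} {re y} {re u} {re v} p p′)
            (-ᴿ-cong {im x *ᴿ im u} {im y *ᴿ im v} (*ᴿ-cong {im x} {im y} {im u} {im v} q q′))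
        , +ᴿ-cong {re x *ᴿ im u} {re y *ᴿ im v} {im x *ᴿ re u} {im y *ᴿ re v}
            (*ᴿ-cong {re x} {re y} {im u} {im v} p q′)
            (*ᴿ-cong {im x} {im y} {re u} {re v} q p′)
      ; *-assoc = λ x y z → pw ((x ⊛ y) ⊛ z) (x ⊛ (y ⊛ z))
          (λ n → solve 6 (λ a b c d e f →
               (a :* c :+ :- (b :* d)) :* e :+ :- ((a :* d :+ b :* c) :* f)
            := a :* (c :* e :+ :- (d :* f)) :+ :- (b :* (c :* f :+ d :* e)))
            refl (r x n) (i x n) (r y n) (i y n) (r z n) (i z n))
          (λ n → solve 6 (λ a b c d e f →
               (a :* c :+ :- (b :* d)) :* f :+ (a :* d :+ b :* c) :* e
            := a :* (c :* f :+ d :* e) :+ b :* (c :* e :+ :- (d :* f)))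
            refl (r x n) (i x n) (r y n) (i y n) (r z n) (i z n))
      ; *-identity =
          (λ x → pw (1ᶜ ⊛ x) x
            (λ n → solve 2 (λ a b → con 1ℚ :* a :+ :- (con 0ℚ :* b) := a) refl (r x n) (i x n))
            (λ n → solve 2 (λ a b → con 1ℚ :* b :+ con 0ℚ :* a := b) refl (r x n) (i x n)))
        , (λ x → pw (x ⊛ 1ᶜ) x
            (λ n → solve 2 (λ a b → a :* con 1ℚ :+ :- (b :* con 0ℚ) := a) refl (r x n) (i x n))
            (λ n → solve 2 (λ a b → a :* con 0ℚ :+ b :* con 1ℚ := b) refl (r x n) (i x n)))
      ; distrib =
          (λ x y z → pw (x ⊛ (y ⊕ z)) ((x ⊛ y) ⊕ (x ⊛ z))
            (λ n → solve 6 (λ a b c d e f →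
                 a :* (c :+ e) :+ :- (b :* (d :+ f))
              := (a :* c :+ :- (b :* d)) :+ (a :* e :+ :- (b :* f)))
              refl (r x n) (i x n) (r y n) (i y n) (r z n) (i z n))
            (λ n → solve 6 (λ a b c d e f →
                 a :* (d :+ f) :+ b :* (c :+ e)
              := (a :* d :+ b :* c) :+ (a :* f :+ b :* e))
              refl (r x n) (i x n) (r y n) (i y n) (r z n) (i z n)))
        , (λ x y z → pw ((y ⊕ z) ⊛ x) ((y ⊛ x) ⊕ (z ⊛ x))
            (λ n → solve 6 (λ a b c d e f →
                 (c :+ e) :* a :+ :- ((d :+ f) :* b)
              := (c :* a :+ :- (d :* b)) :+ (e :* a :+ :- (f :* b)))
              refl (r x n) (i x n) (r y n) (i y n) (r z n) (i z n))
            (λ n → solve 6 (λ a b c d e f →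
                 (c :+ e) :* b :+ (d :+ f) :* a
              := (c :* b :+ d :* a) :+ (e :* b :+ f :* a))
              refl (r x n) (i x n) (r y n) (i y n) (r z n) (i z n)))
      }
    ; *-comm = λ x y → pw (x ⊛ y) (y ⊛ x)
        (λ n → solve 4 (λ a b c d →
             a :* c :+ :- (b :* d) := c :* a :+ :- (d :* b))
          refl (r x n) (i x n) (r y n) (i y n))
        (λ n → solve 4 (λ a b c d →
             a :* d :+ b :* c := c :* b :+ d :* a)
          refl (r x n) (i x n) (r y n) (i y n))
    }
  }
  where
  infixl 6 _⊕_
  infixl 7 _⊛_
  infix  8 ⊖_

  _⊕_ _⊛_ : ℂ → ℂ → ℂ
  (a +i b) ⊕ (c +i d) = (a +ᴿ c) +i (b +ᴿ d)
  (a +i b) ⊛ (c +i d) = (a *ᴿ c +ᴿ -ᴿ (b *ᴿ d)) +i (a *ᴿ d +ᴿ b *ᴿ c)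

  ⊖_ : ℂ → ℂ
  ⊖ (a +i b) = (-ᴿ a) +i (-ᴿ b)

  0ᶜ 1ᶜ : ℂ
  0ᶜ = fromℚ 0ℚ +i fromℚ 0ℚ
  1ᶜ = fromℚ 1ℚ +i fromℚ 0ℚ

  r i : ℂ → ℕ → ℚ
  r z = seq (re z)
  i z = seq (im z)

  pw : ∀ z w → (∀ n → r z n ≡ r w n) → (∀ n → i z n ≡ i w n) → z ≈ᶜ w
  pw z w p q = pointwise (re z) (re w) p , pointwise (im z) (im w) q

-- A monomial in the variables V is a finite multiset of variables: a list up
-- to _↭_, with product _++_ and unit [].

Monomial : Set → Set
Monomial V = List V

module _ {V : Set} (_≟_ : DecidableEquality V) where
  open DecMembership _≟_ using (_∈?_)

  decide-↭ : (M N : Monomial V) → Dec (M ↭ N)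
  decide-↭ []      []      = yes ↭-refl
  decide-↭ []      (x ∷ N) = no λ p → ¬x∷xs↭[] (↭-sym p)
  decide-↭ (x ∷ M) N with x ∈? N
  ... | no x∉N = no λ p → x∉N (∈-resp-↭ p (here refl))
  ... | yes x∈N with ∈-∃++ x∈N
  ...   | N₁ , N₂ , refl with decide-↭ M (N₁ ++ N₂)
  ...     | yes p = yes (↭-trans (prep x p) (↭-sym (shift x N₁ N₂)))
  ...     | no ¬p = no λ p → ¬p (drop-∷ (↭-trans p (shift x N₁ N₂)))

record TermOrder (V : Set) : Set₁ where
  infix 4 _≺_
  field
    _≺_                : Rel (Monomial V) 0ℓ
    isStrictTotalOrder : IsStrictTotalOrder _↭_ _≺_
    ++-monoˡ-≺         : ∀ P {M N} → M ≺ N → P ++ M ≺ P ++ N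
    []-minimum         : ∀ M → ¬ (M ≺ [])

-- A polynomial is a formal finite sum of terms; two are equal (_≋_) when every
-- monomial has the same total coefficient in both.

module Polynomial {V : Set} (_≟_ : DecidableEquality V) where
  open CommutativeRing ℂ-commutativeRing using (_≈_; _+_; _*_; -_; 0#; 1#)

  Poly : Set
  Poly = List (ℂ × Monomial V)

  coeff : Poly → Monomial V → ℂ
  coeff []            N = 0#
  coeff ((c , M) ∷ f) N with does (decide-↭ _≟_ M N)
  ... | true  = c + coeff f N
  ... | false = coeff f N

  infix 4 _≋_
  _≋_ : Poly → Poly → Set
  f ≋ g = ∀ N → coeff f N ≈ coeff g N

  const : ℂ → Poly
  const c = (c , []) ∷ []

  monomial : Monomial V → Poly
  monomial M = (1# , M) ∷ []

  var : V → Poly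
  var v = monomial (v ∷ [])

  0ₚ 1ₚ : Poly
  0ₚ = []
  1ₚ = monomial []

  infixl 6 _+ₚ_
  infixl 7 _*ₚ_
  infix  8 -ₚ_

  _+ₚ_ _*ₚ_ : Poly → Poly → Poly
  f +ₚ g = f ++ g
  f *ₚ g = concatMap (λ (c , M) → map (λ (d , N) → c * d , M ++ N) g) f

  -ₚ_ : Poly → Poly
  -ₚ f = map (λ (c , M) → - c , M) f

  sumₚ productₚ : List Poly → Poly
  sumₚ     = foldr _+ₚ_ 0ₚ
  productₚ = foldr _*ₚ_ 1ₚ

  sign : ℕ → Poly
  sign zero    = 1ₚ
  sign (suc n) = -ₚ sign n

  -- Laplace expansion along the first row.
  det : ∀ {n} → (Fin n → Fin n → Poly) → Poly
  det {zero}  A = 1ₚ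
  det {suc n} A = sumₚ (tabulate λ j →
    sign (toℕ j) *ₚ A zero j *ₚ det (λ a b → A (suc a) (punchIn j b)))

  data ⟨_⟩ (G : Pred Poly 0ℓ) : Pred Poly 0ℓ where
    gen  : ∀ {f} → G f → ⟨ G ⟩ f
    null : ⟨ G ⟩ 0ₚ
    add  : ∀ {f g} → ⟨ G ⟩ f → ⟨ G ⟩ g → ⟨ G ⟩ (f +ₚ g)
    mul  : ∀ h {f} → ⟨ G ⟩ f → ⟨ G ⟩ (h *ₚ f)
    resp : ∀ {f g} → f ≋ g → ⟨ G ⟩ f → ⟨ G ⟩ g

  module _ (O : TermOrder V) where
    open TermOrder O

    IsInitialMonomial : Poly → Monomial V → Set
    IsInitialMonomial f M = ¬ (coeff f M ≈ 0#) × (∀ N → M ≺ N → coeff f N ≈ 0#)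

    -- Generating by initial monomials rather than initial terms is harmless,
    -- as ℂ is a field.
    initialIdeal : Pred Poly 0ℓ → Pred Poly 0ℓ
    initialIdeal K =
      ⟨ (λ g → ∃ λ f → K f × ∃ λ M → IsInitialMonomial f M × g ≡ monomial M) ⟩

    IsStandard : Pred Poly 0ℓ → Pred (Monomial V) 0ℓ
    IsStandard K M = ¬ initialIdeal K (monomial M)

module Hom {V W : Set} (_≟ⱽ_ : DecidableEquality V) (_≟ᵂ_ : DecidableEquality W) where
  private
    module S = Polynomial _≟ⱽ_
    module T = Polynomial _≟ᵂ_

  hom : (V → T.Poly) → S.Poly → T.Poly
  hom h f = T.sumₚ (map (λ (c , M) → T.const c T.*ₚ T.productₚ (map h M)) f)

  kernel : (V → T.Poly) → Pred S.Poly 0ℓ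
  kernel h f = hom h f T.≋ T.0ₚ

-- k ∈ sinks means that the sink (m - k , k) is selected.
record PartialStaircase (m : ℕ) : Set where
  field
    sinks    : Subset (suc m)
    nonempty : Nonempty sinks
open PartialStaircase public

Node : Set
Node = ℕ × ℕ

_∈ᴸ_ : ∀ {m} → Node → PartialStaircase m → Set
_∈ᴸ_ {m} (a , b) L = ∃ λ k → k ∈ˢ sinks L × a ℕ.≤ m ∸ toℕ k × b ℕ.≤ toℕ k

pathFrom : ∀ {n} → Node → Subset n → List Node
pathFrom (a , b) []            = (a , b) ∷ []
pathFrom (a , b) (inside  ∷ I) = (a , b) ∷ pathFrom (a , suc b) I
pathFrom (a , b) (outside ∷ I) = (a , b) ∷ pathFrom (suc a , b) I

path : ∀ {m} → Subset m → List Node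
path = pathFrom (0 , 0)

-- Throughout, the element t of [m] is represented by t - 1 : Fin m.
2^[_] : ∀ {m} → PartialStaircase m → Set
2^[_] {m} L = [ I ∈ Subset m ∣ All (_∈ᴸ L) (path I) ]

≟-2^[_] : ∀ {m} (L : PartialStaircase m) → DecidableEquality 2^[ L ]
≟-2^[ L ] = Refinement._≟_ (Vec.≡-dec Bool._≟_)

-- In increasing order.
elements : ∀ {m} (I : Subset m) → Vec (Fin m) ∣ I ∣
elements []            = []
elements (inside  ∷ I) = zero ∷ Vec.map suc (elements I)
elements (outside ∷ I) = Vec.map suc (elements I)

module _ {m : ℕ} where

  infix 4 _<∞_
  _<∞_ : Rel (Fin m ⁺) 0ℓ
  _<∞_ = _<⁺_ _<_

  NonCrossingPairs : (u v x y : Fin m ⁺) → Set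
  NonCrossingPairs u v x y =
    ¬ (x <∞ u × u <∞ y × y <∞ v) × ¬ (u <∞ x × x <∞ v × v <∞ y)

  removeCommon : List (Fin m) → List (Fin m) → List (Fin m) × List (Fin m)
  removeCommon (i ∷ is) (j ∷ js) with does (i Fin.≟ j) | removeCommon is js
  ... | true  | is′ , js′ = is′ , js′
  ... | false | is′ , js′ = i ∷ is′ , j ∷ js′
  removeCommon is js = is , js

  -- For lists with length is ≤ length js.
  NonCrossingLists : List (Fin m) → List (Fin m) → Set
  NonCrossingLists (i ∷ i′ ∷ is) (j ∷ j′ ∷ js) =
    NonCrossingPairs [ i ] [ i′ ] [ j ] [ j′ ] × NonCrossingLists (i′ ∷ is) (j′ ∷ js)
  NonCrossingLists (i ∷ []) (j ∷ j′ ∷ js) = NonCrossingPairs [ i ] ⊤⁺ [ j ] [ j′ ]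
  NonCrossingLists _ _ = ⊤

  NonCrossing≤ : Subset m → Subset m → Set
  NonCrossing≤ I J =
    let (I′ , J′) = removeCommon (toList (elements I)) (toList (elements J))
    in NonCrossingLists I′ J′

  NonCrossing : Subset m → Subset m → Set
  NonCrossing I J with ∣ I ∣ ℕ.≤? ∣ J ∣
  ... | yes _ = NonCrossing≤ I J
  ... | no  _ = NonCrossing≤ J I

-- Every subset is non-crossing with itself, so I and J need not be distinct.
IsFace : ∀ {m} (L : PartialStaircase m) → Pred (Pred 2^[ L ] 0ℓ) 0ℓ
IsFace L F = ∀ {I J} → F I → F J → NonCrossing (value I) (value J)

support : ∀ {V : Set} → Monomial V → Pred V 0ℓ
support T = _∈ T

-- (i , j) stands for x_ij; row index first.
Entry : ℕ → Set
Entry m = Fin m × Fin m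

_≟ᴱ_ : ∀ {m} → DecidableEquality (Entry m)
_≟ᴱ_ = ≡-dec Fin._≟_ Fin._≟_

-- Rows are listed in increasing order of their index.  Drawing row 1 at the
-- bottom of the matrix would multiply x_I by a sign depending only on ∣ I ∣.
minor : ∀ {m} → Subset m → Polynomial.Poly (_≟ᴱ_ {m})
minor I = det λ a b → var (inject≤ a (∣p∣≤n I) , lookup (elements I) b)
  where open Polynomial _≟ᴱ_

K[_] : ∀ {m} (L : PartialStaircase m) → Pred (Polynomial.Poly ≟-2^[ L ]) 0ℓ
K[ L ] = Hom.kernel ≟-2^[ L ] _≟ᴱ_ (λ I → minor (value I))

IsStandardMonomial : ∀ {m} (L : PartialStaircase m) → TermOrder 2^[ L ] → Pred (Monomial 2^[ L ]) 0ℓ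
IsStandardMonomial L O = Polynomial.IsStandard ≟-2^[ L ] O K[ L ]

-- x_∅ is the empty minor 1, so y_∅ - 1 lies in K whenever ∅ ∈ 2^[ L ] (that is,
-- whenever the sink (m , 0) is selected) and y_∅ is then never standard.  Since
-- factors x_∅ do not affect a product of minors, the elements of the monomial
-- basis are indexed without repetition by the multisets T avoiding ∅.
AvoidsEmpty : ∀ {m} (L : PartialStaircase m) → Pred (Monomial 2^[ L ]) 0ℓ
AvoidsEmpty L T = All (λ I → Nonempty (value I)) T

-- In the term order used here, monomials are first compared by the leading terms of their images,
-- where the leading term of the minor x_I is its diagonal; ties are broken by the sums of i_s i_{s+d},
-- for d = 1, 2, … in turn.  Exchanging the tails of a crossing pair keeps the product of the diagonals
-- and makes the monomial smaller.  As a non-crossing multiset can be recovered from its product of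
-- diagonals row by row, it is the smallest monomial with that leading term, hence standard.
--
-- Conversely, for a crossing pair the difference of the two products of minors is subducted: multiples
-- of products x_A x_B are subtracted from the top until no product of two diagonals occurs any more.
-- The remainder vanishes, since it is bialternating: a combination of products of two minors is
-- determined by its coefficients at semistandard monomials, because an exchange identity in a pair of
-- consecutive rows expresses any other coefficient through those with larger entries in lower rows.

module Submission where

open import Algebra.Bundles using (CommutativeRing)
import Algebra.Properties.CommutativeSemigroup
import Algebra.Properties.Ring
import Algebra.Solver.CommutativeMonoid
import Data.Bool.Properties as Bool
open import Data.Empty using (⊥-elim)
open import Data.Fin.Base as Fin using (Fin; zero; suc; toℕ; inject≤; punchIn)
import Data.Fin.Properties as Fin
open import Data.Fin.Subset using (Subset; inside; outside; Nonempty; ∣_∣; ∁)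
open import Data.Fin.Subset.Properties using (nonempty?; ∣∁p∣≡n∸∣p∣; ∣p∣≤n)
import Data.Integer.Base as ℤ
import Data.Irrelevant as Irrelevant
import Data.Refinement as Refinement
open import Data.List.Base
  using (List; []; _∷_; _++_; map; length; concatMap; replicate; filter; foldr; tabulate;
         cartesianProduct; applyUpTo; allFin)
import Data.List.Properties as List
open import Data.List.Membership.Propositional using (_∈_)
open import Data.List.Membership.Propositional.Properties
  using (∈-∃++; ∈-map⁺; ∈-map⁻; ∈-++⁺ˡ; ∈-++⁺ʳ; ∈-allFin; ∈-filter⁺; ∈-filter⁻;
         ∈-cartesianProduct⁺; ∈-cartesianProduct⁻)
open import Data.List.Relation.Binary.Permutation.Propositional as ↭
  using (_↭_; ↭-refl; ↭-reflexive; ↭-sym; ↭-trans; ↭-isEquivalence; prep; swap)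
open import Data.List.Relation.Binary.Permutation.Propositional.Properties
  using (shift; map⁺; ++⁺; ++⁺ˡ; ++⁺ʳ; ++-comm; drop-∷; filter-↭; ∈-resp-↭; All-resp-↭; ↭-length;
         ↭-empty-inv; ↭-singleton-inv; ↭-map-inv; ¬x∷xs↭[])
open import Data.List.Relation.Unary.All using (All; []; _∷_)
import Data.List.Relation.Unary.All as All
import Data.List.Relation.Unary.All.Properties as All
open import Data.List.Relation.Unary.AllPairs using (AllPairs; []; _∷_)
open import Data.List.Relation.Unary.Any using (Any; here; there; any?)
open import Data.Nat.Base as ℕ using (ℕ; zero; suc; z≤n; s≤s; NonZero)
open import Data.Nat.Induction using (<-wellFounded)
open import Data.Nat.ListAction using (sum)
open import Data.Nat.ListAction.Properties using (sum-↭; sum-++)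
import Data.Nat.Properties as ℕ
open import Data.Nat.Tactic.RingSolver using (solve-∀)
open import Data.Product.Base using (Σ; _×_; _,_; proj₁; proj₂; ∃)
import Data.Rational.Base as ℚ
import Data.Rational.Properties as ℚ
open import Data.Refinement using (value; proof; value-injective)
open import Data.Sum.Base using (_⊎_; inj₁; inj₂)
open import Data.Unit.Base using (⊤; tt)
open import Data.Vec.Base as Vec using (Vec; []; _∷_; here; there; lookup; removeAt; toList)
import Data.Vec.Properties as Vec
open import Defs
open import Function.Base using (_∘_; id; flip)
open import Function.Bundles using (_⇔_; mk⇔)
open import Induction.WellFounded using (WellFounded; Acc; acc)
open import Level using (0ℓ)
open import Relation.Binary.Construct.Add.Supremum.Strict using ([_]; [_]<⊤⁺)
open import Relation.Binary.Definitions using (DecidableEquality; Tri; tri<; tri≈; tri>)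
open import Relation.Binary.PropositionalEquality as ≡ using (_≡_; _≢_)
import Relation.Binary.Reasoning.Setoid
open import Relation.Nullary using (¬_; Dec; yes; no; ¬?; _×-dec_; _⊎-dec_)
open import Relation.Nullary.Construct.Add.Supremum using (⊤⁺) renaming ([_] to ⟦_⟧)
open import Relation.Nullary.Decidable using (map′)

-- Crossings are tested after the removal of common entries, so entries that become consecutive may
-- lie at any distance d in the original columns. Hence a sequence of tie weights: the one for d is
-- the first to notice an exchange across d - 1 common entries, and there the rearrangement
-- inequality makes it drop. Entries past the end of a column count as m, so that crossings with ∞
-- obey the same inequality. Neither direction counts dimensions. A good monomial is compared with
-- single leading terms, and for a bad one an explicit element of the kernel of degree at most two
-- is produced. The latter requires division by 2 and 3: an exchange identity has up to three terms,
-- and some of them coincide when entries are equal. Formal sums are never normalised. A polynomial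
-- f enters only through the values `∑ f φ` of a linear functional, and determinants are functionals
-- as well, so that coefficients, products and interchanges of sums all reduce to linearity.

module Combinatorics where

  open import Data.Nat.Base using (_+_; _*_; _∸_; _<_; _≤_)
  open ≡ using (refl; sym; trans; cong; cong₂; subst; subst₂)


  -- Monomial orders defined by weights.

  module _ {V : Set} where

    weight : (V → ℕ) → Monomial V → ℕ
    weight w M = sum (map w M)

    weight-++ : ∀ w M N → weight w (M ++ N) ≡ weight w M + weight w N
    weight-++ w M N = trans (cong sum (List.map-++ w M N)) (sum-++ (map w M) (map w N))

    weight-↭ : ∀ w {M N} → M ↭ N → weight w M ≡ weight w N
    weight-↭ w p = sum-↭ (map⁺ w p)

    data Less : List (V → ℕ) → Monomial V → Monomial V → Set where
      now   : ∀ {w ws M N} → weight w M < weight w N → Less (w ∷ ws) M N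
      later : ∀ {w ws M N} → weight w M ≡ weight w N → Less ws M N → Less (w ∷ ws) M N

    Equal : List (V → ℕ) → Monomial V → Monomial V → Set
    Equal ws M N = All (λ w → weight w M ≡ weight w N) ws

    Equal-sym : ∀ {ws M N} → Equal ws M N → Equal ws N M
    Equal-sym = All.map sym

    ↭⇒Equal : ∀ ws {M N} → M ↭ N → Equal ws M N
    ↭⇒Equal ws p = All.universal (λ w → weight-↭ w p) ws

    Less-irrefl : ∀ ws {M N} → Equal ws M N → ¬ Less ws M N
    Less-irrefl (w ∷ ws) (e ∷ es) (now l)       = ℕ.<-irrefl e l
    Less-irrefl (w ∷ ws) (e ∷ es) (later _ l) = Less-irrefl ws es l

    Less-trans : ∀ ws {M N P} → Less ws M N → Less ws N P → Less ws M P
    Less-trans (w ∷ ws) (now l)       (now l′)        = now (ℕ.<-trans l l′)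
    Less-trans (w ∷ ws) (now l)       (later e _)   = now (subst (_ <_) e l)
    Less-trans (w ∷ ws) (later e _) (now l′)        = now (subst (_< _) (sym e) l′)
    Less-trans (w ∷ ws) (later e l) (later e′ l′) = later (trans e e′) (Less-trans ws l l′)

    Less-respʳ : ∀ ws {M N P} → Equal ws N P → Less ws M N → Less ws M P
    Less-respʳ (w ∷ ws) (e ∷ es) (now l)        = now (subst (_ <_) e l)
    Less-respʳ (w ∷ ws) (e ∷ es) (later e′ l) = later (trans e′ e) (Less-respʳ ws es l)

    Less-respˡ : ∀ ws {M N P} → Equal ws N P → Less ws N M → Less ws P M
    Less-respˡ (w ∷ ws) (e ∷ es) (now l)        = now (subst (_< _) e l)
    Less-respˡ (w ∷ ws) (e ∷ es) (later e′ l) = later (trans (sym e) e′) (Less-respˡ ws es l)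

    Less-asym : ∀ ws {M N} → Less ws M N → ¬ Less ws N M
    Less-asym ws {M} l l′ = Less-irrefl ws (↭⇒Equal ws (↭-refl {x = M})) (Less-trans ws l l′)

    compareBy : ∀ ws M N → Less ws M N ⊎ Equal ws M N ⊎ Less ws N M
    compareBy []       M N = inj₂ (inj₁ [])
    compareBy (w ∷ ws) M N with ℕ.<-cmp (weight w M) (weight w N) | compareBy ws M N
    ... | tri< l _ _ | _              = inj₁ (now l)
    ... | tri> _ _ l | _              = inj₂ (inj₂ (now l))
    ... | tri≈ _ e _ | inj₁ l         = inj₁ (later e l)
    ... | tri≈ _ e _ | inj₂ (inj₁ es) = inj₂ (inj₁ (e ∷ es))
    ... | tri≈ _ e _ | inj₂ (inj₂ l)  = inj₂ (inj₂ (later (sym e) l))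

    Less-++ˡ : ∀ ws P {M N} → Less ws M N → Less ws (P ++ M) (P ++ N)
    Less-++ˡ (w ∷ ws) P {M} {N} (now l) =
      now (subst₂ _<_ (sym (weight-++ w P M)) (sym (weight-++ w P N)) (ℕ.+-monoʳ-< (weight w P) l))
    Less-++ˡ (w ∷ ws) P {M} {N} (later e l) =
      later (trans (weight-++ w P M) (trans (cong (weight w P +_) e) (sym (weight-++ w P N))))
            (Less-++ˡ ws P l)

    Less-[] : ∀ ws {M} → ¬ Less ws M []
    Less-[] (w ∷ ws) (later _ l) = Less-[] ws l

    -- Lexicographic induction: the outer accessibility belongs to the first weight, and the inner
    -- one, for the remaining weights, restarts whenever the first weight drops. `good-minimal`
    -- descends along this order.
    Less-wellFounded : ∀ ws → WellFounded (Less ws)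
    Less-wellFounded []       M = acc λ ()
    Less-wellFounded (w ∷ ws) M =
      go (<-wellFounded (weight w M)) refl (Less-wellFounded ws M)
      where
      go : ∀ {k M} → Acc _<_ k → weight w M ≡ k → Acc (Less ws) M → Acc (Less (w ∷ ws)) M
      below : ∀ {k M N} → Acc _<_ k → weight w M ≡ k → Acc (Less ws) M →
              Less (w ∷ ws) N M → Acc (Less (w ∷ ws)) N
      go a e b = acc (below a e b)
      below {N = N} (acc a) refl b       (now l)      = go (a l) refl (Less-wellFounded ws N)
      below         a       e    (acc b) (later e′ l) = go a (trans e′ e) (b l)

    Less-++⁺ˡ : ∀ ws {ws′ M N} → Less ws M N → Less (ws ++ ws′) M N
    Less-++⁺ˡ (w ∷ ws) (now l)       = now l
    Less-++⁺ˡ (w ∷ ws) (later e l) = later e (Less-++⁺ˡ ws l)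

    Less-++⁺ʳ : ∀ {ws ws′ M N} → Equal ws M N → Less ws′ M N → Less (ws ++ ws′) M N
    Less-++⁺ʳ []       l = l
    Less-++⁺ʳ (e ∷ es) l = later e (Less-++⁺ʳ es l)

    Less-++⁻ : ∀ ws {ws′ M N} → Less (ws ++ ws′) M N → Less ws M N ⊎ Equal ws M N
    Less-++⁻ []       l        = inj₂ []
    Less-++⁻ (w ∷ ws) (now l)  = inj₁ (now l)
    Less-++⁻ (w ∷ ws) (later e l) with Less-++⁻ ws l
    ... | inj₁ l′ = inj₁ (later e l′)
    ... | inj₂ es = inj₂ (e ∷ es)

    Less-applyUpTo : ∀ (f : ℕ → V → ℕ) {n d M N} → d < n →
      (∀ {e} → e < d → weight (f e) M ≡ weight (f e) N) →
      weight (f d) M < weight (f d) N → Less (applyUpTo f n) M N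
    Less-applyUpTo f {suc n} {zero}  _         _ l = now l
    Less-applyUpTo f {suc n} {suc d} (s≤s d<n) e l =
      later (e (s≤s z≤n)) (Less-applyUpTo (f ∘ suc) d<n (λ {e′} l′ → e (s≤s l′)) l)

    module _ {K : Set} (_≟_ : DecidableEquality K) (key : V → K)
             (key-injective : ∀ {v v′} → key v ≡ key v′ → v ≡ v′) where

      -- The keys may range over more than the values of `key`: for `2^[ L ]` they are all subsets
      -- of [m], so that the vertices themselves are not enumerated.
      indicator : K → V → ℕ
      indicator k v with key v ≟ k
      ... | yes _ = 1
      ... | no  _ = 0

      indicator-here : ∀ v M → 0 < weight (indicator (key v)) (v ∷ M)
      indicator-here v M with key v ≟ key v
      ... | yes _ = s≤s z≤n
      ... | no  ¬e = ⊥-elim (¬e refl)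

      indicator-∈ : ∀ v M → 0 < weight (indicator (key v)) M → v ∈ M
      indicator-∈ v (x ∷ M) l with key x ≟ key v
      ... | yes e = here (key-injective (sym e))
      ... | no  _ = there (indicator-∈ v M l)

      module _ {ks : List K} (complete : ∀ k → k ∈ ks) where

        indicators-separate : ∀ M N → Equal (map indicator ks) M N → M ↭ N
        indicators-separate [] []      es = ↭-refl
        indicators-separate [] (v ∷ N) es =
          ⊥-elim (ℕ.n≮0 (subst (0 <_)
            (sym (All.lookup es (∈-map⁺ indicator (complete (key v))))) (indicator-here v N)))
        indicators-separate (v ∷ M) N  es with ∈-∃++ (indicator-∈ v N (subst (0 <_)
          (All.lookup es (∈-map⁺ indicator (complete (key v)))) (indicator-here v M)))
        ... | N₁ , N₂ , refl = ↭-trans (prep v (indicators-separate M (N₁ ++ N₂)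
                (All.map (λ {w} e → ℕ.+-cancelˡ-≡ (w v) _ _
                   (trans e (weight-↭ w (shift v N₁ N₂)))) es)))
                (↭-sym (shift v N₁ N₂))

    weightOrder : (ws : List (V → ℕ)) → (∀ {M N} → Equal ws M N → M ↭ N) → TermOrder V
    weightOrder ws separates = record
      { _≺_                = Less ws
      ; isStrictTotalOrder = record
        { isStrictPartialOrder = record
          { isEquivalence = ↭-isEquivalence
          ; irrefl        = λ p → Less-irrefl ws (↭⇒Equal ws p)
          ; trans         = Less-trans ws
          ; <-resp-≈      = (λ p → Less-respʳ ws (↭⇒Equal ws p))
                          , (λ p → Less-respˡ ws (↭⇒Equal ws p))
          }
        ; compare = cmp
        }
      ; ++-monoˡ-≺ = Less-++ˡ ws
      ; []-minimum = λ M → Less-[] ws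
      }
      where
      cmp : ∀ M N → Tri (Less ws M N) (M ↭ N) (Less ws N M)
      cmp M N with compareBy ws M N
      ... | inj₁ l         = tri< l (λ p → Less-irrefl ws (↭⇒Equal ws p) l) (Less-asym ws l)
      ... | inj₂ (inj₁ es) = tri≈ (Less-irrefl ws es) (separates es) (Less-irrefl ws (Equal-sym {ws} {M} {N} es))
      ... | inj₂ (inj₂ l)  = tri> (Less-asym ws l)
                               (λ p → Less-irrefl ws (↭⇒Equal ws (↭-sym p)) l) l

  module _ {V X : Set} (d : V → Monomial X) where

    -- Pulls a weight back along `d`, so that comparing products of diagonals is itself a comparison
    -- by weights.
    lift : (X → ℕ) → V → ℕ
    lift w v = weight w (d v)

    weight-lift : ∀ w T → weight (lift w) T ≡ weight w (concatMap d T)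
    weight-lift w []      = refl
    weight-lift w (v ∷ T) = trans (cong (lift w v +_) (weight-lift w T))
                              (sym (weight-++ w (d v) (concatMap d T)))

    Less-lift⁺ : ∀ ws {M N} → Less ws (concatMap d M) (concatMap d N) → Less (map lift ws) M N
    Less-lift⁺ (w ∷ ws) {M} {N} (now l) =
      now (subst₂ _<_ (sym (weight-lift w M)) (sym (weight-lift w N)) l)
    Less-lift⁺ (w ∷ ws) {M} {N} (later e l) =
      later (trans (weight-lift w M) (trans e (sym (weight-lift w N)))) (Less-lift⁺ ws l)

    Less-lift⁻ : ∀ ws {M N} → Less (map lift ws) M N → Less ws (concatMap d M) (concatMap d N)
    Less-lift⁻ (w ∷ ws) {M} {N} (now l) = now (subst₂ _<_ (weight-lift w M) (weight-lift w N) l)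
    Less-lift⁻ (w ∷ ws) {M} {N} (later e l) =
      later (trans (sym (weight-lift w M)) (trans e (weight-lift w N))) (Less-lift⁻ ws l)

    Equal-lift⁺ : ∀ {ws M N} → Equal ws (concatMap d M) (concatMap d N) → Equal (map lift ws) M N
    Equal-lift⁺ {[]}             []       = []
    Equal-lift⁺ {w ∷ ws} {M} {N} (e ∷ es) =
      trans (weight-lift w M) (trans e (sym (weight-lift w N))) ∷ Equal-lift⁺ {ws} {M} {N} es

    Equal-lift⁻ : ∀ {ws M N} → Equal (map lift ws) M N → Equal ws (concatMap d M) (concatMap d N)
    Equal-lift⁻ {[]}             []       = []
    Equal-lift⁻ {w ∷ ws} {M} {N} (e ∷ es) =
      trans (sym (weight-lift w M)) (trans e (weight-lift w N)) ∷ Equal-lift⁻ {ws} {M} {N} es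

  -- Crossings of columns.

  cols : ∀ {m} → Subset m → List (Fin m)
  cols I = toList (elements I)

  length-cols : ∀ {m} (I : Subset m) → length (cols I) ≡ ∣ I ∣
  length-cols I = Vec.length-toList (elements I)

  -- The bound is a natural number, so that the successor of the largest element of `Fin m` is still
  -- a bound.
  data Inc {m} : ℕ → List (Fin m) → Set where
    []  : ∀ {b} → Inc b []
    _∷_ : ∀ {b x xs} → b ≤ toℕ x → Inc (suc (toℕ x)) xs → Inc b (x ∷ xs)

  Inc-map-suc : ∀ {m b} {xs : List (Fin m)} → Inc b xs → Inc (suc b) (map Fin.suc xs)
  Inc-map-suc []       = []
  Inc-map-suc (l ∷ ls) = s≤s l ∷ Inc-map-suc ls

  Inc-weaken : ∀ {m a b} {xs : List (Fin m)} → a ≤ b → Inc b xs → Inc a xs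
  Inc-weaken a≤b []       = []
  Inc-weaken a≤b (l ∷ ls) = ℕ.≤-trans a≤b l ∷ ls

  Inc-length : ∀ {m b} {xs : List (Fin m)} → Inc b xs → b ≤ m → length xs + b ≤ m
  Inc-length []                         b≤m = b≤m
  Inc-length {b = b} {x ∷ xs} (l ∷ ls) b≤m = ℕ.≤-trans
    (subst (_≤ length xs + suc (toℕ x)) (ℕ.+-suc (length xs) b) (ℕ.+-monoʳ-≤ (length xs) (s≤s l)))
    (Inc-length ls (Fin.toℕ<n x))

  cols-outside : ∀ {m} (I : Subset m) → cols (outside Vec.∷ I) ≡ map Fin.suc (cols I)
  cols-outside I = Vec.toList-map Fin.suc (elements I)

  cols-inside : ∀ {m} (I : Subset m) → cols (inside Vec.∷ I) ≡ zero ∷ map Fin.suc (cols I)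
  cols-inside I = cong (zero ∷_) (cols-outside I)

  cols-increasing : ∀ {m} (I : Subset m) → Inc 0 (cols I)
  cols-increasing Vec.[]            = []
  cols-increasing (inside  Vec.∷ I) = subst (Inc 0) (sym (cols-inside I))
    (z≤n ∷ Inc-map-suc (cols-increasing I))
  cols-increasing (outside Vec.∷ I) = subst (Inc 0) (sym (cols-outside I))
    (Inc-weaken z≤n (Inc-map-suc (cols-increasing I)))

  cols-injective : ∀ {m} (I J : Subset m) → cols I ≡ cols J → I ≡ J
  cols-injective Vec.[] Vec.[] e = refl
  cols-injective (inside Vec.∷ I) (inside Vec.∷ J) e = cong (inside Vec.∷_)
    (cols-injective I J (List.map-injective Fin.suc-injective
      (List.∷-injectiveʳ (trans (sym (cols-inside I)) (trans e (cols-inside J))))))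
  cols-injective (outside Vec.∷ I) (outside Vec.∷ J) e = cong (outside Vec.∷_)
    (cols-injective I J (List.map-injective Fin.suc-injective
      (trans (sym (cols-outside I)) (trans e (cols-outside J)))))
  cols-injective (inside Vec.∷ I) (outside Vec.∷ J) e
    with cols J | trans (sym (cols-inside I)) (trans e (cols-outside J))
  ... | []    | ()
  ... | _ ∷ _ | ()
  cols-injective (outside Vec.∷ I) (inside Vec.∷ J) e
    with cols I | trans (sym (cols-outside I)) (trans e (cols-inside J))
  ... | []    | ()
  ... | _ ∷ _ | ()

  Inc-pred : ∀ {m b} (xs : List (Fin (suc m))) → Inc (suc b) xs →
             ∃ λ ys → xs ≡ map Fin.suc ys × Inc b ys
  Inc-pred []           []           = [] , refl , []
  Inc-pred (suc x ∷ xs) (s≤s l ∷ ls) with Inc-pred xs ls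
  ... | ys , refl , ls′ = x ∷ ys , refl , l ∷ ls′

  cols-surjective : ∀ {m} (xs : List (Fin m)) → Inc 0 xs → ∃ λ I → cols I ≡ xs
  cols-surjective {zero}  []            []        = Vec.[] , refl
  cols-surjective {suc m} []            []        with cols-surjective {m} [] []
  ... | I , e = outside Vec.∷ I , trans (cols-outside I) (cong (map Fin.suc) e)
  cols-surjective {suc m} (zero ∷ xs)   (_ ∷ ls)  with Inc-pred xs ls
  ... | ys , refl , ls′ with cols-surjective ys ls′
  ...   | I , refl = inside Vec.∷ I , cols-inside I
  cols-surjective {suc m} (suc x ∷ xs)  (_ ∷ ls)  with Inc-pred xs ls
  ... | ys , refl , ls′ with cols-surjective (x ∷ ys) (z≤n ∷ ls′)
  ...   | I , e = outside Vec.∷ I , trans (cols-outside I) (cong (map Fin.suc) e)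

  module _ {m : ℕ} where

    private
      C : Set
      C = Fin m

    -- Columns beyond the last row are dropped.
    mono : ∀ {k} → (Fin k → Fin m) → List C → Monomial (Entry m)
    mono {zero}  ρ xs       = []
    mono {suc k} ρ []       = []
    mono {suc k} ρ (x ∷ xs) = (ρ zero , x) ∷ mono (ρ ∘ suc) xs

    diagonal : List (List (Fin m)) → Monomial (Entry m)
    diagonal = concatMap (mono id)

    -- Among the terms of a minor, ω is largest at the diagonal.
    ω : Entry m → ℕ
    ω (r , c) = toℕ r * toℕ c

    -- m stands for ∞.
    nth : ℕ → List C → ℕ
    nth e       []       = m
    nth zero    (x ∷ xs) = toℕ x
    nth (suc e) (x ∷ xs) = nth e xs

    -- Crossing of the pairs {p, a} and {q, b}. On natural numbers, so that a missing a or b can be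
    -- m and the products in `tie` can be compared.
    Cross : (p q a b : ℕ) → Set
    Cross p q a b = (p < q × q < a × a < b) ⊎ (q < p × p < b × b < a)

    Cross-sym : ∀ {p q a b} → Cross p q a b → Cross q p b a
    Cross-sym (inj₁ x) = inj₂ x
    Cross-sym (inj₂ x) = inj₁ x

    -- Swap e p q is js is′ js′: below entries p and q, after e common entries, the columns is and js
    -- have entries crossing p and q, and exchanging everything from there on gives is′ and js′.
    data Swap : ℕ → C → C → (is js is′ js′ : List C) → Set where
      here   : ∀ {p q is js} → Cross (toℕ p) (toℕ q) (nth 0 is) (nth 0 js) → Swap 0 p q is js js is
      common : ∀ {e p q is js is′ js′} c → Swap e p q is js is′ js′ →
               Swap (suc e) p q (c ∷ is) (c ∷ js) (c ∷ is′) (c ∷ js′)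

    -- `start` stands at the pair p, q, and `next` skips what precedes it. The e entries between p,
    -- q and the exchanged tails are common to both columns and vanish under `removeCommon`; so p
    -- and the first entry of its tail are consecutive after the removal.
    data Uncross : ℕ → (is js is′ js′ : List C) → Set where
      start : ∀ {e is js is′ js′} p q → Swap e p q is js is′ js′ →
              Uncross e (p ∷ is) (q ∷ js) (p ∷ is′) (q ∷ js′)
      next  : ∀ {e is js is′ js′} a b → Uncross e is js is′ js′ →
              Uncross e (a ∷ is) (b ∷ js) (a ∷ is′) (b ∷ js′)

    Swap-sym : ∀ {e p q is js is′ js′} → Swap e p q is js is′ js′ → Swap e q p js is js′ is′
    Swap-sym (here c)     = here (Cross-sym c)
    Swap-sym (common c s) = common c (Swap-sym s)

    Uncross-sym : ∀ {e is js is′ js′} → Uncross e is js is′ js′ → Uncross e js is js′ is′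
    Uncross-sym (start p q s) = start q p (Swap-sym s)
    Uncross-sym (next a b u)  = next b a (Uncross-sym u)

    Swap-length : ∀ {e p q is js is′ js′} → Swap e p q is js is′ js′ →
                  length is′ ≡ length js × length js′ ≡ length is
    Swap-length (here c)     = refl , refl
    Swap-length (common c s) with Swap-length s
    ... | x , y = cong suc x , cong suc y

    Uncross-length : ∀ {e is js is′ js′} → Uncross e is js is′ js′ →
                     length is′ ≡ length js × length js′ ≡ length is
    Uncross-length (start p q s) with Swap-length s
    ... | x , y = cong suc x , cong suc y
    Uncross-length (next a b u) with Uncross-length u
    ... | x , y = cong suc x , cong suc y

    Inc-nth : ∀ {a b xs} → a ≤ nth 0 xs → Inc b xs → Inc a xs
    Inc-nth l []       = []
    Inc-nth l (_ ∷ ls) = l ∷ ls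

    Swap-Inc-≡ : ∀ {e p q is js is′ js′ b} → Swap e p q is js is′ js′ →
                 Inc b is → Inc b js → Inc b is′ × Inc b js′
    Swap-Inc-≡ (here c)     x       y       = y , x
    Swap-Inc-≡ (common c s) (l ∷ x) (_ ∷ y) with Swap-Inc-≡ s x y
    ... | x′ , y′ = l ∷ x′ , l ∷ y′

    -- The middle inequality of a crossing: in p < q < a < b the tail from a still fits below q, and
    -- the tail from b fits below p all the more. After a common entry both tails have the same
    -- bound.
    Swap-Inc : ∀ {e p q is js is′ js′} → Swap e p q is js is′ js′ →
               Inc (suc (toℕ p)) is → Inc (suc (toℕ q)) js →
               Inc (suc (toℕ p)) is′ × Inc (suc (toℕ q)) js′
    Swap-Inc (here (inj₁ (p<q , q<a , a<b))) x y =
      Inc-nth (ℕ.<-trans p<q (ℕ.<-trans q<a a<b)) y , Inc-nth q<a x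
    Swap-Inc (here (inj₂ (q<p , p<b , b<a))) x y =
      Inc-nth p<b y , Inc-nth (ℕ.<-trans q<p (ℕ.<-trans p<b b<a)) x
    Swap-Inc (common c s) (l ∷ x) (l′ ∷ y) with Swap-Inc-≡ s x y
    ... | x′ , y′ = l ∷ x′ , l′ ∷ y′

    Uncross-Inc : ∀ {e is js is′ js′ b b′} → Uncross e is js is′ js′ →
                  Inc b is → Inc b′ js → Inc b is′ × Inc b′ js′
    Uncross-Inc (start p q s) (l ∷ x) (l′ ∷ y) with Swap-Inc s x y
    ... | x′ , y′ = l ∷ x′ , l′ ∷ y′
    Uncross-Inc (next a b u)  (l ∷ x) (l′ ∷ y) with Uncross-Inc u x y
    ... | x′ , y′ = l ∷ x′ , l′ ∷ y′

    private
      prep₂ : ∀ {A : Set} (a b : A) (M N : List A) {M′ N′} → M ++ N ↭ M′ ++ N′ →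
              (a ∷ M) ++ (b ∷ N) ↭ (a ∷ M′) ++ (b ∷ N′)
      prep₂ a b M N {M′} {N′} p = prep a (↭-trans (shift b M N)
        (↭-trans (prep b p) (↭-sym (shift b M′ N′))))

    Swap-mono : ∀ {e p q is js is′ js′ k} (ρ : Fin k → Fin m) → Swap e p q is js is′ js′ →
                mono ρ is′ ++ mono ρ js′ ↭ mono ρ is ++ mono ρ js
    Swap-mono {is = is} {js} ρ (here c) = ++-comm (mono ρ js) (mono ρ is)
    Swap-mono {k = zero}  ρ (common c s) = ↭-refl
    Swap-mono {k = suc k} ρ (common {is′ = is′} {js′} c s) =
      prep₂ _ _ (mono _ is′) (mono _ js′) (Swap-mono (ρ ∘ suc) s)

    Uncross-mono : ∀ {e is js is′ js′ k} (ρ : Fin k → Fin m) → Uncross e is js is′ js′ →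
                   mono ρ is′ ++ mono ρ js′ ↭ mono ρ is ++ mono ρ js
    Uncross-mono {k = zero}  ρ u = ↭-refl
    Uncross-mono {k = suc k} ρ (start {is′ = is′} {js′} p q s) =
      prep₂ _ _ (mono _ is′) (mono _ js′) (Swap-mono (ρ ∘ suc) s)
    Uncross-mono {k = suc k} ρ (next {is′ = is′} {js′} a b u) =
      prep₂ _ _ (mono _ is′) (mono _ js′) (Uncross-mono (ρ ∘ suc) u)

    -- The index e is one less than the distance: the products are those of i_s and i_{s+e+1}, with
    -- m in place of an entry past the end.
    tie : ℕ → List C → ℕ
    tie e []       = 0
    tie e (x ∷ xs) = toℕ x * nth e xs + tie e xs

    Swap-≤ : ∀ {e p q is js is′ js′} → Swap e p q is js is′ js′ → e ≤ length is
    Swap-≤ (here c)     = z≤n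
    Swap-≤ (common c s) = s≤s (Swap-≤ s)

    Uncross-< : ∀ {e is js is′ js′} → Uncross e is js is′ js′ → e < length is
    Uncross-< (start p q s) = s≤s (Swap-≤ s)
    Uncross-< (next a b u)  = ℕ.m<n⇒m<1+n (Uncross-< u)

    nth-Swap : ∀ {e p q is js is′ js′} e′ → e′ < e → Swap e p q is js is′ js′ →
               nth e′ is ≡ nth e′ is′ × nth e′ js ≡ nth e′ js′ × nth e′ is ≡ nth e′ js
    nth-Swap zero     l       (common c s) = refl , refl , refl
    nth-Swap (suc e′) (s≤s l) (common c s) = nth-Swap e′ l s

    nth-Swap-cross : ∀ {e p q is js is′ js′} → Swap e p q is js is′ js′ →
      nth e is ≡ nth e js′ × nth e js ≡ nth e is′ × Cross (toℕ p) (toℕ q) (nth e is) (nth e js)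
    nth-Swap-cross (here c)     = refl , refl , c
    nth-Swap-cross (common c s) = nth-Swap-cross s

    nth-Uncross : ∀ {e is js is′ js′} e′ → e′ ≤ e → Uncross e is js is′ js′ →
                  nth e′ is ≡ nth e′ is′ × nth e′ js ≡ nth e′ js′
    nth-Uncross zero     l (start p q s) = refl , refl
    nth-Uncross zero     l (next a b u)  = refl , refl
    nth-Uncross (suc e′) l (start p q s) with nth-Swap e′ l s
    ... | x , y , _ = x , y
    nth-Uncross (suc e′) l (next a b u)  = nth-Uncross e′ (ℕ.<⇒≤ l) u

    private
      regroup : ∀ p x s q y t → (p * x + s) + (q * y + t) ≡ (p * x + q * y) + (s + t)
      regroup = solve-∀

    -- Holds at every distance: the tails are exchanged whole and the entries before them are
    -- common, so at each common entry the partners in the two columns are at most interchanged.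
    tie-Swap : ∀ {e p q is js is′ js′} e′ → Swap e p q is js is′ js′ →
               tie e′ is′ + tie e′ js′ ≡ tie e′ is + tie e′ js
    tie-Swap {is = is} {js} e′ (here c) = ℕ.+-comm (tie e′ js) (tie e′ is)
    tie-Swap {e = suc e} e′ (common {is = is} {js} {is′} {js′} c s) =
      trans (regroup x (nth e′ is′) (tie e′ is′) x (nth e′ js′) (tie e′ js′))
        (trans (cong₂ _+_ same (tie-Swap e′ s))
          (sym (regroup x (nth e′ is) (tie e′ is) x (nth e′ js) (tie e′ js))))
      where
      x = toℕ c
      nths : ∀ {e p q is js is′ js′} e′ → Swap e p q is js is′ js′ →
             nth e′ is′ + nth e′ js′ ≡ nth e′ is + nth e′ js
      nths {is = is} {js} e′       (here c)     = ℕ.+-comm (nth e′ js) (nth e′ is)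
      nths                zero     (common c s) = refl
      nths                (suc e′) (common c s) = nths e′ s
      same : x * nth e′ is′ + x * nth e′ js′ ≡ x * nth e′ is + x * nth e′ js
      same = trans (sym (ℕ.*-distribˡ-+ x _ _)) (trans (cong (x *_) (nths e′ s)) (ℕ.*-distribˡ-+ x _ _))

    -- The rearrangement inequality, in the form (q - p)(b - a) > 0.
    rearrange : ∀ {p q a b} → Cross p q a b → p * b + q * a < p * a + q * b
    rearrange {p} {q} {a} {b} (inj₁ (p<q , _ , a<b))
      with ℕ.m≤n⇒∃[o]m+o≡n p<q | ℕ.m≤n⇒∃[o]m+o≡n a<b
    -- With q = 1 + p + d and b = 1 + a + f, the gap (q - p)(b - a) is 1 + (d + f + d f).
    ... | d , refl | f , refl = subst (p * b + q * a <_) (identity p a d f) (ℕ.m<m+n _ (s≤s z≤n))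
      where
      identity : ∀ p a d f → (p * (suc a + f) + (suc p + d) * a) + suc (d + f + d * f) ≡
                 p * a + (suc p + d) * (suc a + f)
      identity = solve-∀
    rearrange {p} {q} {a} {b} (inj₂ (q<p , _ , b<a))
      with ℕ.m≤n⇒∃[o]m+o≡n q<p | ℕ.m≤n⇒∃[o]m+o≡n b<a
    ... | d , refl | f , refl = subst (p * b + q * a <_) (identity q b d f) (ℕ.m<m+n _ (s≤s z≤n))
      where
      identity : ∀ q b d f → ((suc q + d) * b + q * (suc b + f)) + suc (d + f + d * f) ≡
                 (suc q + d) * (suc b + f) + q * b
      identity = solve-∀

    -- At distance at most e, no product that starts at or before p and q reaches the exchanged
    -- tails; those that start later are covered by `tie-Swap`.
    tie-Uncross-≡ : ∀ {e is js is′ js′} e′ → e′ < e → Uncross e is js is′ js′ →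
                    tie e′ is′ + tie e′ js′ ≡ tie e′ is + tie e′ js
    tie-Uncross-≡ e′ l (start {is = is} {js} {is′} {js′} p q s) with nth-Swap e′ l s
    ... | x , y , _ = trans
      (regroup (toℕ p) (nth e′ is′) (tie e′ is′) (toℕ q) (nth e′ js′) (tie e′ js′))
      (trans (cong₂ _+_ (cong₂ (λ a b → toℕ p * a + toℕ q * b) (sym x) (sym y)) (tie-Swap e′ s))
        (sym (regroup (toℕ p) (nth e′ is) (tie e′ is) (toℕ q) (nth e′ js) (tie e′ js))))
    tie-Uncross-≡ e′ l (next {is = is} {js} {is′} {js′} p q u)
      with nth-Uncross e′ (ℕ.<⇒≤ l) u
    ... | x , y = trans
      (regroup (toℕ p) (nth e′ is′) (tie e′ is′) (toℕ q) (nth e′ js′) (tie e′ js′))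
      (trans (cong₂ _+_ (cong₂ (λ a b → toℕ p * a + toℕ q * b) (sym x) (sym y)) (tie-Uncross-≡ e′ l u))
        (sym (regroup (toℕ p) (nth e′ is) (tie e′ is) (toℕ q) (nth e′ js) (tie e′ js))))

    -- Of the entries up to p and q, only these two reach the exchanged tails at distance e + 1.
    -- They meet exactly the crossing entries there, and `rearrange` gives the drop.
    tie-Uncross-< : ∀ {e is js is′ js′} → Uncross e is js is′ js′ →
                    tie e is′ + tie e js′ < tie e is + tie e js
    tie-Uncross-< {e} (start {is = is} {js} {is′} {js′} p q s) with nth-Swap-cross s
    ... | x , y , c = subst₂ _<_
      (sym (regroup (toℕ p) (nth e is′) (tie e is′) (toℕ q) (nth e js′) (tie e js′)))
      (sym (regroup (toℕ p) (nth e is) (tie e is) (toℕ q) (nth e js) (tie e js)))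
      (ℕ.+-mono-<-≤
        (subst (_< toℕ p * nth e is + toℕ q * nth e js)
          (cong₂ (λ a b → toℕ p * a + toℕ q * b) y x) (rearrange c))
        (ℕ.≤-reflexive (tie-Swap e s)))
    tie-Uncross-< {e} (next {is = is} {js} {is′} {js′} p q u) with nth-Uncross e ℕ.≤-refl u
    ... | x , y = subst₂ _<_
      (sym (regroup (toℕ p) (nth e is′) (tie e is′) (toℕ q) (nth e js′) (tie e js′)))
      (sym (regroup (toℕ p) (nth e is) (tie e is) (toℕ q) (nth e js) (tie e js)))
      (ℕ.+-mono-≤-<
        (ℕ.≤-reflexive (cong₂ (λ a b → toℕ p * a + toℕ q * b) (sym x) (sym y)))
        (tie-Uncross-< u))

    -- Here i and j are the last entries that the removal has kept. They stay pending while common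
    -- entries are dropped, because the next kept pair is tested against them.
    NonCrossingAfter : C → C → List C → List C → Set
    NonCrossingAfter i j is js =
      NonCrossingLists (i ∷ proj₁ (removeCommon is js)) (j ∷ proj₂ (removeCommon is js))

    NonCrossingRemoved : List C → List C → Set
    NonCrossingRemoved is js = NonCrossingLists (proj₁ (removeCommon is js)) (proj₂ (removeCommon is js))

    pairs? : ∀ (i a j b : C) → NonCrossingPairs ⟦ i ⟧ ⟦ a ⟧ ⟦ j ⟧ ⟦ b ⟧ ⊎ Cross (toℕ i) (toℕ j) (toℕ a) (toℕ b)
    pairs? i a j b with Fin.<-cmp i j
    pairs? i a j b | tri≈ i≮j _ j≮i = inj₁ ((λ { ([ l ] , _) → j≮i l }) , (λ { ([ l ] , _) → i≮j l }))
    pairs? i a j b | tri< i<j _ j≮i with j Fin.<? a | a Fin.<? b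
    ... | yes j<a | yes a<b = inj₂ (inj₁ (i<j , j<a , a<b))
    ... | no j≮a  | _       = inj₁ ((λ { ([ l ] , _) → j≮i l }) , (λ { (_ , [ l ] , _) → j≮a l }))
    ... | _       | no a≮b  = inj₁ ((λ { ([ l ] , _) → j≮i l }) , (λ { (_ , _ , [ l ]) → a≮b l }))
    pairs? i a j b | tri> i≮j _ j<i with i Fin.<? b | b Fin.<? a
    ... | yes i<b | yes b<a = inj₂ (inj₂ (j<i , i<b , b<a))
    ... | no i≮b  | _       = inj₁ ((λ { (_ , [ l ] , _) → i≮b l }) , (λ { ([ l ] , _) → i≮j l }))
    ... | _       | no b≮a  = inj₁ ((λ { (_ , _ , [ l ]) → b≮a l }) , (λ { ([ l ] , _) → i≮j l }))

    pairs∞? : ∀ (i j b : C) → NonCrossingPairs ⟦ i ⟧ ⊤⁺ ⟦ j ⟧ ⟦ b ⟧ ⊎ Cross (toℕ i) (toℕ j) m (toℕ b)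
    pairs∞? i j b with j Fin.<? i | i Fin.<? b
    ... | yes j<i | yes i<b = inj₂ (inj₂ (j<i , i<b , Fin.toℕ<n b))
    ... | no j≮i  | _       = inj₁ ((λ { ([ l ] , _) → j≮i l }) , λ { (_ , _ , ()) })
    ... | _       | no i≮b  = inj₁ ((λ { (_ , [ l ] , _) → i≮b l }) , λ { (_ , _ , ()) })

    ¬pairs : ∀ {i a j b : C} → Cross (toℕ i) (toℕ j) (toℕ a) (toℕ b) → ¬ NonCrossingPairs ⟦ i ⟧ ⟦ a ⟧ ⟦ j ⟧ ⟦ b ⟧
    ¬pairs (inj₁ (x , y , z)) (_ , n) = n ([ x ] , [ y ] , [ z ])
    ¬pairs (inj₂ (x , y , z)) (n , _) = n ([ x ] , [ y ] , [ z ])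

    ¬pairs∞ : ∀ {i j b : C} → Cross (toℕ i) (toℕ j) m (toℕ b) → ¬ NonCrossingPairs ⟦ i ⟧ ⊤⁺ ⟦ j ⟧ ⟦ b ⟧
    ¬pairs∞ {b = b} (inj₁ (_ , _ , z)) _ = ℕ.<-asym z (Fin.toℕ<n b)
    ¬pairs∞ {b = b} (inj₂ (x , y , _)) (n , _) = n ([ x ] , [ y ] , [ b ]<⊤⁺)

    -- A crossing with the pending pair is a `Swap`, which grows by each common entry passed; a
    -- crossing that lies wholly in the rest is an `Uncross`.
    scanAfter : ∀ i j is js → length is ≤ length js →
      NonCrossingAfter i j is js ⊎
      (∃ λ e → ∃ λ is′ → ∃ λ js′ → Swap e i j is js is′ js′ ⊎ Uncross e is js is′ js′)
    scanAfter i j []       []       l = inj₁ _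
    scanAfter i j []       (b ∷ js) l with pairs∞? i j b
    ... | inj₁ n = inj₁ n
    ... | inj₂ c = inj₂ (_ , _ , _ , inj₁ (here c))
    scanAfter i j (a ∷ is) (b ∷ js) (s≤s l) with a Fin.≟ b
    scanAfter i j (a ∷ is) (b ∷ js) (s≤s l) | yes refl with scanAfter i j is js l
    ... | inj₁ n                      = inj₁ n
    ... | inj₂ (_ , _ , _ , inj₁ s)   = inj₂ (_ , _ , _ , inj₁ (common a s))
    ... | inj₂ (_ , _ , _ , inj₂ u)   = inj₂ (_ , _ , _ , inj₂ (next a a u))
    scanAfter i j (a ∷ is) (b ∷ js) (s≤s l) | no _ with pairs? i a j b | scanAfter a b is js l
    ... | inj₂ c | _                         = inj₂ (_ , _ , _ , inj₁ (here c))
    ... | inj₁ n | inj₁ n′                   = inj₁ (n , n′)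
    ... | inj₁ n | inj₂ (_ , _ , _ , inj₁ s) = inj₂ (_ , _ , _ , inj₂ (start a b s))
    ... | inj₁ n | inj₂ (_ , _ , _ , inj₂ u) = inj₂ (_ , _ , _ , inj₂ (next a b u))

    scan : ∀ is js → length is ≤ length js →
      NonCrossingRemoved is js ⊎ (∃ λ e → ∃ λ is′ → ∃ λ js′ → Uncross e is js is′ js′)
    scan []       js       l = inj₁ _
    scan (a ∷ is) (b ∷ js) (s≤s l) with a Fin.≟ b
    scan (a ∷ is) (b ∷ js) (s≤s l) | yes _ with scan is js l
    ... | inj₁ n               = inj₁ n
    ... | inj₂ (_ , _ , _ , u) = inj₂ (_ , _ , _ , next a b u)
    scan (a ∷ is) (b ∷ js) (s≤s l) | no _ with scanAfter a b is js l
    ... | inj₁ n                    = inj₁ n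
    ... | inj₂ (_ , _ , _ , inj₁ s) = inj₂ (_ , _ , _ , start a b s)
    ... | inj₂ (_ , _ , _ , inj₂ u) = inj₂ (_ , _ , _ , next a b u)

    after⇒removed : ∀ i j is js → length is ≤ length js →
                    NonCrossingAfter i j is js → NonCrossingRemoved is js
    after⇒removed i j []       js       l n = _
    after⇒removed i j (a ∷ is) (b ∷ js) (s≤s l) n with a Fin.≟ b
    ... | yes _ = after⇒removed i j is js l n
    ... | no  _ = proj₂ n

    Cross-≢ : ∀ {p q a b} → Cross p q a b → p ≢ q × a ≢ b
    Cross-≢ (inj₁ (x , y , z)) = ℕ.<⇒≢ x , ℕ.<⇒≢ z
    Cross-≢ (inj₂ (x , y , z)) = ℕ.>⇒≢ x , ℕ.>⇒≢ z

    Swap-≢ : ∀ {e p q is js is′ js′} → Swap e p q is js is′ js′ → p ≢ q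
    Swap-≢ (here c) refl = proj₁ (Cross-≢ c) refl
    Swap-≢ (common c s)  = Swap-≢ s

    Swap⇒¬after : ∀ {e i j is js is′ js′} → Swap e i j is js is′ js′ → length is ≤ length js →
                  ¬ NonCrossingAfter i j is js
    Swap⇒¬after (here {is = []} {[]} c) l n = proj₂ (Cross-≢ c) refl
    Swap⇒¬after (here {is = []} {b ∷ js} c) l n = ¬pairs∞ c n
    Swap⇒¬after (here {is = a ∷ is} {b ∷ js} c) l n with a Fin.≟ b
    ... | yes refl = proj₂ (Cross-≢ c) refl
    ... | no  _    = ¬pairs c (proj₁ n)
    Swap⇒¬after (common c s) (s≤s l) n with c Fin.≟ c
    ... | yes _  = Swap⇒¬after s l n
    ... | no c≢c = c≢c refl

    Uncross⇒¬removed : ∀ {e is js is′ js′} → Uncross e is js is′ js′ → length is ≤ length js →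
                       ¬ NonCrossingRemoved is js
    Uncross⇒¬removed (start p q s) (s≤s l) n with p Fin.≟ q
    ... | yes e = Swap-≢ s e
    ... | no  _ = Swap⇒¬after s l n
    Uncross⇒¬removed (next {is = is} {js} a b u) (s≤s l) n with a Fin.≟ b
    ... | yes _ = Uncross⇒¬removed u l n
    ... | no  _ = Uncross⇒¬removed u l (after⇒removed a b is js l n)

    private
      lengths : ∀ (I J : Subset m) → ∣ I ∣ ≤ ∣ J ∣ → length (cols I) ≤ length (cols J)
      lengths I J = subst₂ _≤_ (sym (length-cols I)) (sym (length-cols J))

    nonCrossing? : ∀ I J → NonCrossing I J ⊎
      (∃ λ e → ∃ λ is′ → ∃ λ js′ → Uncross e (cols I) (cols J) is′ js′)
    nonCrossing? I J with ∣ I ∣ ℕ.≤? ∣ J ∣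
    ... | yes l = scan (cols I) (cols J) (lengths I J l)
    ... | no ¬l with scan (cols J) (cols I) (lengths J I (ℕ.≰⇒≥ ¬l))
    ...   | inj₁ n               = inj₁ n
    ...   | inj₂ (_ , _ , _ , u) = inj₂ (_ , _ , _ , Uncross-sym u)

    NonCrossing⇒¬Uncross : ∀ I J {e is′ js′} → NonCrossing I J → ¬ Uncross e (cols I) (cols J) is′ js′
    NonCrossing⇒¬Uncross I J n u with ∣ I ∣ ℕ.≤? ∣ J ∣
    ... | yes l = Uncross⇒¬removed u (lengths I J l) n
    ... | no ¬l = Uncross⇒¬removed (Uncross-sym u) (lengths J I (ℕ.≰⇒≥ ¬l)) n

  -- Uniqueness of non-crossing multisets of columns.

  extract : ∀ {A : Set} {x : A} {X} → x ∈ X → ∃ λ X′ → X ↭ x ∷ X′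
  extract x∈ with ∈-∃++ x∈
  ... | X₁ , X₂ , refl = X₁ ++ X₂ , shift _ X₁ X₂

  module _ {m : ℕ} where

    infix 4 _⊏_
    -- Lexicographic, with an ended column counting as ∞ as in `nth`; so the empty list is the
    -- largest.
    data _⊏_ : List (Fin m) → List (Fin m) → Set where
      end  : ∀ {a is} → a ∷ is ⊏ []
      head : ∀ {a b is js} → a Fin.< b → a ∷ is ⊏ b ∷ js
      tail : ∀ {c is js} → is ⊏ js → c ∷ is ⊏ c ∷ js

    ⊏-irrefl : ∀ {is} → ¬ is ⊏ is
    ⊏-irrefl (head l) = ℕ.<-irrefl refl l
    ⊏-irrefl (tail l) = ⊏-irrefl l

    ⊏-trans : ∀ {is js ks} → is ⊏ js → js ⊏ ks → is ⊏ ks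
    ⊏-trans (head l) end       = end
    ⊏-trans (tail l) end       = end
    ⊏-trans (head l) (head l′) = head (ℕ.<-trans l l′)
    ⊏-trans (head l) (tail l′) = head l
    ⊏-trans (tail l) (head l′) = head l′
    ⊏-trans (tail l) (tail l′) = tail (⊏-trans l l′)

    ⊏-compare : ∀ is js → is ⊏ js ⊎ is ≡ js ⊎ js ⊏ is
    ⊏-compare []       []       = inj₂ (inj₁ refl)
    ⊏-compare []       (x ∷ js) = inj₂ (inj₂ end)
    ⊏-compare (x ∷ is) []       = inj₁ end
    ⊏-compare (x ∷ is) (y ∷ js) with Fin.<-cmp x y | ⊏-compare is js
    ... | tri< l _ _    | _                = inj₁ (head l)
    ... | tri> _ _ l    | _                = inj₂ (inj₂ (head l))
    ... | tri≈ _ refl _ | inj₁ l           = inj₁ (tail l)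
    ... | tri≈ _ refl _ | inj₂ (inj₁ refl) = inj₂ (inj₁ refl)
    ... | tri≈ _ refl _ | inj₂ (inj₂ l)    = inj₂ (inj₂ (tail l))

    ⊏-≮ : ∀ {is js} → is ≡ js ⊎ js ⊏ is → ¬ is ⊏ js
    ⊏-≮ (inj₁ refl) l = ⊏-irrefl l
    ⊏-≮ (inj₂ l′)   l = ⊏-irrefl (⊏-trans l l′)

    -- At the first difference the smaller entry a stands on the side of p, so that p < q < a < b;
    -- monotonicity carries q < a past the common entries.
    ⊏⇒Swap : ∀ {p q b is js} → p Fin.< q → toℕ q < nth 0 is → Inc b is → is ⊏ js →
             ∃ λ e → ∃ λ is′ → ∃ λ js′ → Swap e p q is js is′ js′
    ⊏⇒Swap p<q q<a _ (end {a})  = _ , _ , _ , here (inj₁ (p<q , q<a , Fin.toℕ<n a))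
    ⊏⇒Swap p<q q<a _ (head a<b) = _ , _ , _ , here (inj₁ (p<q , q<a , a<b))
    ⊏⇒Swap {is = c ∷ a ∷ _} p<q q<c (_ ∷ ls@(c<a ∷ _)) (tail l)
      with ⊏⇒Swap p<q (ℕ.<-trans q<c c<a) ls l
    ... | _ , _ , _ , s = _ , _ , _ , common c s

    Column : Set
    Column = Fin m × List (Fin m)

    cons : Column → List (Fin m)
    cons (x , xs) = x ∷ xs

    Increasing NonCrossings : List Column → Set
    Increasing X = ∀ {x : Column} → x ∈ X → Inc 0 (cons x)
    NonCrossings X = ∀ {x y e is′ js′} → x ∈ X → y ∈ X → ¬ Uncross e (cons x) (cons y) is′ js′

    -- Largest head and, among those, least tail: the greedy choice by which the matching of heads
    -- with tails is recovered.
    Best : List Column → Column → Set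
    Best X y = ∀ {z} → z ∈ X → proj₁ z Fin.≤ proj₁ y × (proj₁ z ≡ proj₁ y → ¬ proj₂ z ⊏ proj₂ y)

    best : ∀ x X → ∃ λ y → y ∈ x ∷ X × Best (x ∷ X) y
    best x [] = x , here refl , λ { (here refl) → ℕ.≤-refl , λ _ → ⊏-irrefl }
    best x (x′ ∷ X) with best x′ X
    ... | y , y∈ , b with Fin.<-cmp (proj₁ x) (proj₁ y)
    ...   | tri< l ¬e _ = y , there y∈ , λ where
      (here refl) → ℕ.<⇒≤ l , λ e → ⊥-elim (¬e e)
      (there z∈)  → b z∈
    ...   | tri> _ _ l = x , here refl , λ where
      (here refl) → ℕ.≤-refl , λ _ → ⊏-irrefl
      (there z∈)  → ℕ.≤-trans (proj₁ (b z∈)) (ℕ.<⇒≤ l)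
                  , λ e → ⊥-elim (ℕ.<⇒≱ l (subst (Fin._≤ proj₁ y) e (proj₁ (b z∈))))
    ...   | tri≈ _ e _ with ⊏-compare (proj₂ x) (proj₂ y)
    ...     | inj₁ l = x , here refl , λ where
      (here refl) → ℕ.≤-refl , λ _ → ⊏-irrefl
      (there z∈)  → subst (_ ≤_) (cong toℕ (sym e)) (proj₁ (b z∈))
                  , λ e′ l′ → proj₂ (b z∈) (trans e′ e) (⊏-trans l′ l)
    ...     | inj₂ ¬l = y , there y∈ , λ where
      (here refl) → ℕ.≤-reflexive (cong toℕ e) , λ _ → ⊏-≮ ¬l
      (there z∈)  → b z∈

    Increasing-< : ∀ {X x} → Increasing X → x ∈ X → toℕ (proj₁ x) < nth 0 (proj₂ x)
    Increasing-< {x = x , []}    inc x∈ = Fin.toℕ<n x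
    Increasing-< {x = x , _ ∷ _} inc x∈ with inc x∈
    ... | _ ∷ (l ∷ _) = l

    -- Among the tails that fit below the head of y, that of y is least. A smaller one cannot hang
    -- below an equal head, by the choice of y; below a smaller head its column would cross y, by
    -- `⊏⇒Swap`.
    Best-tail : ∀ {X y z} → Increasing X → NonCrossings X → Best X y → y ∈ X → z ∈ X →
                toℕ (proj₁ y) < nth 0 (proj₂ z) → ¬ proj₂ z ⊏ proj₂ y
    Best-tail {y = y} {z} inc nc b y∈ z∈ q<τ l with Fin.<-cmp (proj₁ z) (proj₁ y) | inc z∈
    ... | tri> _ _ y<z | _ = ℕ.<⇒≱ y<z (proj₁ (b z∈))
    ... | tri≈ _ e _   | _ = proj₂ (b z∈) e l
    ... | tri< z<y _ _ | _ ∷ ls with ⊏⇒Swap z<y q<τ ls l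
    ...   | _ , _ , _ , s = nc z∈ y∈ (start (proj₁ z) (proj₁ y) s)

    private
      ∈-map-proj₁ : ∀ {A B : Set} {X Y : List (A × B)} {x} → map proj₁ X ↭ map proj₁ Y → x ∈ X →
                    ∃ λ y → y ∈ Y × proj₁ x ≡ proj₁ y
      ∈-map-proj₁ p x∈ = ∈-map⁻ proj₁ (∈-resp-↭ p (∈-map⁺ proj₁ x∈))

      ∈-map-proj₂ : ∀ {A B : Set} {X Y : List (A × B)} {x} → map proj₂ X ↭ map proj₂ Y → x ∈ X →
                    ∃ λ y → y ∈ Y × proj₂ x ≡ proj₂ y
      ∈-map-proj₂ p x∈ = ∈-map⁻ proj₂ (∈-resp-↭ p (∈-map⁺ proj₂ x∈))

      restrict : ∀ {A : Set} {x y : A} {X X′} → X ↭ x ∷ X′ → y ∈ X′ → y ∈ X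
      restrict p y∈ = ∈-resp-↭ (↭-sym p) (there y∈)

    -- The largest heads agree because the multisets of heads do. The tail of x occurs somewhere in
    -- Y and fits below this head, so `Best-tail` keeps it from being smaller than the tail of y;
    -- the same holds with x and y interchanged.
    Best-unique : ∀ {X Y x y} → map proj₁ X ↭ map proj₁ Y → map proj₂ X ↭ map proj₂ Y →
      Increasing X → Increasing Y → NonCrossings X → NonCrossings Y →
      Best X x → Best Y y → x ∈ X → y ∈ Y → x ≡ y
    Best-unique {X} {Y} {x} {y} p q inc inc′ nc nc′ b b′ x∈ y∈ = cong₂ _,_ heads tails
      where
      heads : proj₁ x ≡ proj₁ y
      heads with ∈-map-proj₁ p x∈ | ∈-map-proj₁ (↭-sym p) y∈
      ... | z , z∈ , e | w , w∈ , e′ = Fin.≤-antisym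
        (subst (Fin._≤ proj₁ y) (sym e) (proj₁ (b′ z∈)))
        (subst (Fin._≤ proj₁ x) (sym e′) (proj₁ (b w∈)))
      x≮y : ¬ proj₂ x ⊏ proj₂ y
      x≮y with ∈-map-proj₂ q x∈
      ... | (z , .(proj₂ x)) , z∈ , refl = Best-tail inc′ nc′ b′ y∈ z∈
        (subst (λ h → toℕ h < nth 0 (proj₂ x)) heads (Increasing-< inc x∈))
      y≮x : ¬ proj₂ y ⊏ proj₂ x
      y≮x with ∈-map-proj₂ (↭-sym q) y∈
      ... | (z , .(proj₂ y)) , z∈ , refl = Best-tail inc nc b x∈ z∈
        (subst (λ h → toℕ h < nth 0 (proj₂ y)) (sym heads) (Increasing-< inc′ y∈))
      tails : proj₂ x ≡ proj₂ y
      tails with ⊏-compare (proj₂ x) (proj₂ y)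
      ... | inj₁ l        = ⊥-elim (x≮y l)
      ... | inj₂ (inj₁ e) = e
      ... | inj₂ (inj₂ l) = ⊥-elim (y≮x l)

    matching-unique : ∀ n {X Y} → length X ≤ n → map proj₁ X ↭ map proj₁ Y → map proj₂ X ↭ map proj₂ Y →
      Increasing X → Increasing Y → NonCrossings X → NonCrossings Y → X ↭ Y
    matching-unique n {[]} {[]}         l p q inc inc′ nc nc′ = ↭-refl
    matching-unique n {[]} {y ∷ Y}      l p q inc inc′ nc nc′ with ↭-empty-inv (↭-sym p)
    ... | ()
    matching-unique n {x ∷ X} {[]}      l p q inc inc′ nc nc′ with ↭-empty-inv p
    ... | ()
    matching-unique (suc n) {x₀ ∷ X₀} {y₀ ∷ Y₀} (s≤s l) p q inc inc′ nc nc′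
      with best x₀ X₀ | best y₀ Y₀
    ... | x , x∈ , b | y , y∈ , b′ with Best-unique p q inc inc′ nc nc′ b b′ x∈ y∈ | extract x∈ | extract y∈
    ...   | refl | X₁ , pX | Y₁ , pY = ↭-trans pX (↭-trans (prep x rest) (↭-sym pY))
      where
      rest : X₁ ↭ Y₁
      rest = matching-unique n
        (subst (_≤ n) (ℕ.suc-injective (↭-length pX)) l)
        (drop-∷ (↭-trans (map⁺ proj₁ (↭-sym pX)) (↭-trans p (map⁺ proj₁ pY))))
        (drop-∷ (↭-trans (map⁺ proj₂ (↭-sym pX)) (↭-trans q (map⁺ proj₂ pY))))
        (λ i → inc (restrict pX i)) (λ i → inc′ (restrict pY i))
        (λ i j → nc (restrict pX i) (restrict pX j)) (λ i j → nc′ (restrict pY i) (restrict pY j))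

    -- Empty tails leave no trace in the monomial; they are set apart and later recovered by
    -- counting.
    nonempties : List (List (Fin m)) → List Column
    nonempties []            = []
    nonempties ([] ∷ T)      = nonempties T
    nonempties ((x ∷ t) ∷ T) = (x , t) ∷ nonempties T

    empties : List (List (Fin m)) → ℕ
    empties []            = 0
    empties ([] ∷ T)      = suc (empties T)
    empties ((x ∷ t) ∷ T) = empties T

    length-nonempties : ∀ T → length T ≡ empties T + length (nonempties T)
    length-nonempties []            = refl
    length-nonempties ([] ∷ T)      = cong suc (length-nonempties T)
    length-nonempties ((x ∷ t) ∷ T) = trans (cong suc (length-nonempties T)) (sym (ℕ.+-suc _ _))

    nonempties-↭ : ∀ T → T ↭ replicate (empties T) [] ++ map cons (nonempties T)
    nonempties-↭ []            = ↭-refl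
    nonempties-↭ ([] ∷ T)      = prep [] (nonempties-↭ T)
    nonempties-↭ ((x ∷ t) ∷ T) = ↭-trans (prep (x ∷ t) (nonempties-↭ T))
      (↭-sym (shift (x ∷ t) (replicate (empties T) []) (map cons (nonempties T))))

    ∈-nonempties : ∀ T {y} → y ∈ nonempties T → cons y ∈ T
    ∈-nonempties ([] ∷ T)      y∈          = there (∈-nonempties T y∈)
    ∈-nonempties ((x ∷ t) ∷ T) (here refl) = here refl
    ∈-nonempties ((x ∷ t) ∷ T) (there y∈)  = there (∈-nonempties T y∈)

    mono-[] : ∀ {k} (ρ : Fin k → Fin m) → mono ρ [] ≡ []
    mono-[] {zero}  ρ = refl
    mono-[] {suc k} ρ = refl

    concatMap-nonempties : ∀ {k} (ρ : Fin k → Fin m) T →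
      concatMap (mono ρ) T ≡ concatMap (mono ρ ∘ cons) (nonempties T)
    concatMap-nonempties ρ []            = refl
    concatMap-nonempties ρ ([] ∷ T)      = trans (cong (_++ concatMap (mono ρ) T) (mono-[] ρ)) (concatMap-nonempties ρ T)
    concatMap-nonempties ρ ((x ∷ t) ∷ T) = cong (mono ρ (x ∷ t) ++_) (concatMap-nonempties ρ T)

    Distinct : ∀ {k} → (Fin k → Fin m) → Set
    Distinct ρ = ∀ {i j} → ρ i ≡ ρ j → i ≡ j

    inRow? : (r : Fin m) (e : Entry m) → Dec (proj₁ e ≡ r)
    inRow? r e = proj₁ e Fin.≟ r

    mono-avoids : ∀ {k} (r : Fin m) (ρ : Fin k → Fin m) xs → (∀ i → ρ i ≢ r) →
                  All (λ e → proj₁ e ≢ r) (mono ρ xs)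
    mono-avoids {zero}  r ρ xs       a = []
    mono-avoids {suc k} r ρ []       a = []
    mono-avoids {suc k} r ρ (x ∷ xs) a = a zero ∷ mono-avoids r (ρ ∘ suc) xs (a ∘ suc)

    firstRow : ∀ {k} (ρ : Fin (suc k) → Fin m) → Distinct ρ → ∀ X →
      filter (inRow? (ρ zero)) (concatMap (mono ρ ∘ cons) X) ≡ map (λ x → ρ zero , proj₁ x) X
    firstRow ρ d []      = refl
    firstRow ρ d ((x , t) ∷ X) = trans (List.filter-accept (inRow? (ρ zero)) refl) (cong (_ ∷_)
      (trans (List.filter-++ (inRow? (ρ zero)) (mono (ρ ∘ suc) t) _)
        (cong₂ _++_ (List.filter-none (inRow? (ρ zero))
            (mono-avoids (ρ zero) (ρ ∘ suc) t λ i e → Fin.0≢1+n (sym (d e))))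
          (firstRow ρ d X))))

    otherRows : ∀ {k} (ρ : Fin (suc k) → Fin m) → Distinct ρ → ∀ X →
      filter (¬? ∘ inRow? (ρ zero)) (concatMap (mono ρ ∘ cons) X) ≡ concatMap (mono (ρ ∘ suc)) (map proj₂ X)
    otherRows ρ d []            = refl
    otherRows ρ d ((x , t) ∷ X) = trans (List.filter-reject (¬? ∘ inRow? (ρ zero)) (λ n → n refl))
      (trans (List.filter-++ (¬? ∘ inRow? (ρ zero)) (mono (ρ ∘ suc) t) _)
        (cong₂ _++_ (List.filter-all (¬? ∘ inRow? (ρ zero))
            (mono-avoids (ρ zero) (ρ ∘ suc) t λ i e → Fin.0≢1+n (sym (d e))))
          (otherRows ρ d X)))

    -- Induction on the rows. The first row gives the multiset of heads, and the other rows give, by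
    -- induction, that of the nonempty tails; `matching-unique` joins them. A crossing of two tails
    -- is one of the whole columns, so the tails are non-crossing again.
    nonCrossing-unique : ∀ {k} (ρ : Fin k → Fin m) → Distinct ρ → ∀ {X Y} →
      (∀ {x} → x ∈ X → length (cons x) ≤ k) → (∀ {y} → y ∈ Y → length (cons y) ≤ k) →
      Increasing X → Increasing Y → NonCrossings X → NonCrossings Y →
      concatMap (mono ρ ∘ cons) X ↭ concatMap (mono ρ ∘ cons) Y → X ↭ Y
    nonCrossing-unique {zero} ρ d {[]}    {[]}    l l′ inc inc′ nc nc′ p = ↭-refl
    nonCrossing-unique {zero} ρ d {x ∷ X} {Y}     l l′ inc inc′ nc nc′ p with l (here refl)
    ... | ()
    nonCrossing-unique {zero} ρ d {[]}    {y ∷ Y} l l′ inc inc′ nc nc′ p with l′ (here refl)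
    ... | ()
    nonCrossing-unique {suc k} ρ d {X} {Y} l l′ inc inc′ nc nc′ p =
      matching-unique (length X) ℕ.≤-refl heads tails inc inc′ nc nc′
      where
      heads : map proj₁ X ↭ map proj₁ Y
      heads = ↭-trans (↭-reflexive (List.map-∘ X)) (↭-trans (map⁺ proj₂
        (↭-trans (↭-reflexive (sym (firstRow ρ d X))) (↭-trans (filter-↭ (inRow? (ρ zero)) p)
          (↭-reflexive (firstRow ρ d Y))))) (↭-reflexive (sym (List.map-∘ Y))))
      lower : concatMap (mono (ρ ∘ suc)) (map proj₂ X) ↭ concatMap (mono (ρ ∘ suc)) (map proj₂ Y)
      lower = ↭-trans (↭-reflexive (sym (otherRows ρ d X)))
        (↭-trans (filter-↭ (¬? ∘ inRow? (ρ zero)) p) (↭-reflexive (otherRows ρ d Y)))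
      origin : ∀ Z {y} → y ∈ nonempties (map proj₂ Z) → ∃ λ x → x ∈ Z × cons y ≡ proj₂ x
      origin Z y∈ = ∈-map⁻ proj₂ (∈-nonempties (map proj₂ Z) y∈)
      short : ∀ Z → (∀ {x} → x ∈ Z → length (cons x) ≤ suc k) →
              ∀ {y} → y ∈ nonempties (map proj₂ Z) → length (cons y) ≤ k
      short Z l y∈ with origin Z y∈
      ... | x , x∈ , e = subst (λ t → length t ≤ k) (sym e) (ℕ.s≤s⁻¹ (l x∈))
      increasing : ∀ Z → Increasing Z → Increasing (nonempties (map proj₂ Z))
      increasing Z inc y∈ with origin Z y∈
      ... | x , x∈ , e with inc x∈
      ...   | _ ∷ ls = subst (Inc 0) (sym e) (Inc-weaken z≤n ls)
      nonCrossings : ∀ Z → NonCrossings Z → NonCrossings (nonempties (map proj₂ Z))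
      nonCrossings Z nc {e = i} {is′} {js′} y∈ y′∈ u with origin Z y∈ | origin Z y′∈
      ... | x , x∈ , e | x′ , x′∈ , e′ =
        nc x∈ x′∈ (next (proj₁ x) (proj₁ x′) (subst₂ (λ t t′ → Uncross i t t′ is′ js′) e e′ u))
      upper : nonempties (map proj₂ X) ↭ nonempties (map proj₂ Y)
      upper = nonCrossing-unique (ρ ∘ suc) (Fin.suc-injective ∘ d)
        (short X l) (short Y l′) (increasing X inc) (increasing Y inc′)
        (nonCrossings X nc) (nonCrossings Y nc′)
        (subst₂ _↭_ (concatMap-nonempties (ρ ∘ suc) (map proj₂ X))
          (concatMap-nonempties (ρ ∘ suc) (map proj₂ Y)) lower)
      -- Each column has one tail, so equally many heads mean equally many tails, and hence equally
      -- many empty ones.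
      total : length (map proj₂ X) ≡ length (map proj₂ Y)
      total = trans (List.length-map proj₂ X) (trans (sym (List.length-map proj₁ X))
        (trans (↭-length heads) (trans (List.length-map proj₁ Y) (sym (List.length-map proj₂ Y)))))
      same-empties : empties (map proj₂ X) ≡ empties (map proj₂ Y)
      same-empties = ℕ.+-cancelʳ-≡ (length (nonempties (map proj₂ X))) _ _
        (trans (sym (length-nonempties (map proj₂ X))) (trans total
          (trans (length-nonempties (map proj₂ Y)) (cong (empties (map proj₂ Y) +_) (sym (↭-length upper))))))
      tails : map proj₂ X ↭ map proj₂ Y
      tails = ↭-trans (nonempties-↭ (map proj₂ X)) (↭-trans
        (↭-trans (++⁺ˡ (replicate (empties (map proj₂ X)) []) (map⁺ cons upper))
          (↭-reflexive (cong (λ n → replicate n [] ++ map cons (nonempties (map proj₂ Y))) same-empties)))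
        (↭-sym (nonempties-↭ (map proj₂ Y))))

  -- The term order.

  subsets : ∀ n → List (Subset n)
  subsets zero    = [] ∷ []
  subsets (suc n) = map (inside ∷_) (subsets n) ++ map (outside ∷_) (subsets n)

  ∈-subsets : ∀ {n} (S : Subset n) → S ∈ subsets n
  ∈-subsets []            = here refl
  ∈-subsets (inside  ∷ S) = ∈-++⁺ˡ (∈-map⁺ (inside ∷_) (∈-subsets S))
  ∈-subsets (outside ∷ S) = ∈-++⁺ʳ _ (∈-map⁺ (outside ∷_) (∈-subsets S))

  ≟-subset : ∀ {n} → DecidableEquality (Subset n)
  ≟-subset = Vec.≡-dec Bool._≟_

  cols-empty : ∀ {m} (S : Subset m) → ¬ Nonempty S → cols S ≡ []
  cols-empty []            ¬ne = refl
  cols-empty (inside  ∷ S) ¬ne = ⊥-elim (¬ne (zero , here))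
  cols-empty (outside ∷ S) ¬ne =
    trans (cols-outside S) (cong (map Fin.suc) (cols-empty S λ { (i , i∈) → ¬ne (suc i , there i∈) }))

  cols-nonempty : ∀ {m} (S : Subset m) → Nonempty S → cols S ≢ []
  cols-nonempty (inside  ∷ S) ne                   e with () ← trans (sym (cols-inside S)) e
  cols-nonempty (outside ∷ S) (suc i , there i∈) e =
    cols-nonempty S (i , i∈) (map-[] (cols S) (trans (sym (cols-outside S)) e))
    where
    map-[] : ∀ {m} (xs : List (Fin m)) → map Fin.suc xs ≡ [] → xs ≡ []
    map-[] [] _ = refl

  Uncross-irrefl : ∀ {m e} {is is′ js′ : List (Fin m)} → ¬ Uncross e is is is′ js′
  Uncross-irrefl (start p .p s) = Swap-≢ s refl
  Uncross-irrefl (next a .a u)  = Uncross-irrefl u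

  lastNode : ∀ {n} → Node → Subset n → Node
  lastNode (a , b) S = a + ∣ ∁ S ∣ , b + ∣ S ∣

  lastNode-∈ : ∀ {n} a b (S : Subset n) → lastNode (a , b) S ∈ pathFrom (a , b) S
  lastNode-∈ a b []            = here (cong₂ _,_ (ℕ.+-identityʳ a) (ℕ.+-identityʳ b))
  lastNode-∈ a b (inside  ∷ S) = there (subst (_∈ pathFrom (a , suc b) S)
    (cong (a + ∣ ∁ S ∣ ,_) (sym (ℕ.+-suc b ∣ S ∣))) (lastNode-∈ a (suc b) S))
  lastNode-∈ a b (outside ∷ S) = there (subst (_∈ pathFrom (suc a , b) S)
    (cong (_, b + ∣ S ∣) (sym (ℕ.+-suc a ∣ ∁ S ∣))) (lastNode-∈ (suc a) b S))

  path-bounded : ∀ {n} a b (S : Subset n) →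
    All (λ (x , y) → x ≤ a + ∣ ∁ S ∣ × y ≤ b + ∣ S ∣) (pathFrom (a , b) S)
  path-bounded a b []            = (ℕ.m≤m+n a 0 , ℕ.m≤m+n b 0) ∷ []
  path-bounded a b (inside  ∷ S) = (ℕ.m≤m+n a _ , ℕ.m≤m+n b _) ∷
    All.map (λ (p , q) → p , ℕ.≤-trans q (ℕ.≤-reflexive (sym (ℕ.+-suc b ∣ S ∣)))) (path-bounded a (suc b) S)
  path-bounded a b (outside ∷ S) = (ℕ.m≤m+n a _ , ℕ.m≤m+n b _) ∷
    All.map (λ (p , q) → ℕ.≤-trans p (ℕ.≤-reflexive (sym (ℕ.+-suc a ∣ ∁ S ∣))) , q) (path-bounded (suc a) b S)

  module _ {m : ℕ} (L : PartialStaircase m) where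

    private
      V : Set
      V = 2^[ L ]

    -- The path ends at (m - ∣ S ∣ , ∣ S ∣) and stays weakly south and west of that node, where L is
    -- closed. So only the size of a set decides whether it is a vertex, and exchanges that keep the
    -- sizes stay inside `2^[ L ]`.
    path-∈ᴸ : ∀ (S S′ : Subset m) → ∣ S′ ∣ ≡ ∣ S ∣ → All (_∈ᴸ L) (path S) → All (_∈ᴸ L) (path S′)
    path-∈ᴸ S S′ e inL with All.lookup inL (lastNode-∈ 0 0 S)
    ... | k , k∈ , p , q = All.map (λ (x≤ , y≤) → k , k∈
        , ℕ.≤-trans x≤ (ℕ.≤-trans (ℕ.≤-reflexive complement) p)
        , ℕ.≤-trans y≤ (ℕ.≤-trans (ℕ.≤-reflexive e) q)) (path-bounded 0 0 S′)
      where
      complement : ∣ ∁ S′ ∣ ≡ ∣ ∁ S ∣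
      complement = trans (∣∁p∣≡n∸∣p∣ S′) (trans (cong (m ∸_) e) (sym (∣∁p∣≡n∸∣p∣ S)))

    resize : (I : V) (S : Subset m) → ∣ S ∣ ≡ ∣ value I ∣ → V
    resize I S e = S Refinement., Irrelevant.map (path-∈ᴸ (value I) S e) (proof I)

    columnsOf : V → List (Fin m)
    columnsOf I = cols (value I)

    columnsOf-injective : ∀ {I J : V} → columnsOf I ≡ columnsOf J → I ≡ J
    columnsOf-injective {I} {J} e = value-injective (cols-injective (value I) (value J) e)

    columnsOf-increasing : ∀ I → Inc 0 (columnsOf I)
    columnsOf-increasing I = cols-increasing (value I)

    fromColumns : ∀ (I : V) xs → Inc 0 xs → length xs ≡ length (columnsOf I) → ∃ λ J → columnsOf J ≡ xs
    fromColumns I xs inc e with cols-surjective xs inc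
    ... | S , refl = resize I S (trans (sym (length-cols S)) (trans e (length-cols (value I)))) , refl

    diagonalOf : V → Monomial (Entry m)
    diagonalOf I = mono id (columnsOf I)

    diagonals : Monomial V → Monomial (Entry m)
    diagonals = concatMap diagonalOf

    diagonals-↭ : ∀ {M N} → M ↭ N → diagonals M ↭ diagonals N
    diagonals-↭ ↭.refl = ↭-refl
    diagonals-↭ (↭.prep I p) = ++⁺ (↭-refl {x = diagonalOf I}) (diagonals-↭ p)
    diagonals-↭ (↭.swap I J p) = ↭-trans
      (↭-reflexive (sym (List.++-assoc (diagonalOf I) (diagonalOf J) _)))
      (↭-trans (++⁺ (++-comm (diagonalOf I) (diagonalOf J)) (diagonals-↭ p))
        (↭-reflexive (List.++-assoc (diagonalOf J) (diagonalOf I) _)))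
    diagonals-↭ (↭.trans p q) = ↭-trans (diagonals-↭ p) (diagonals-↭ q)

    -- ω alone singles out the diagonal of a minor; the multiplicities of the entries refine it, so
    -- that monomials of equal weights are equal.
    entryIndicators entryWeights : List (Entry m → ℕ)
    entryIndicators = map (indicator _≟ᴱ_ id id) (cartesianProduct (allFin m) (allFin m))
    entryWeights    = ω ∷ entryIndicators

    entryWeights-separate : ∀ {M N} → Equal entryWeights M N → M ↭ N
    entryWeights-separate (_ ∷ es) = indicators-separate _≟ᴱ_ id id
      (λ (i , j) → ∈-cartesianProduct⁺ (∈-allFin i) (∈-allFin j)) _ _ es

    _≺ₑ_ : Monomial (Entry m) → Monomial (Entry m) → Set
    _≺ₑ_ = Less entryWeights

    tieOf : ℕ → V → ℕ
    tieOf e I = tie e (columnsOf I)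

    -- By `Uncross-<` the number e of common entries is below the length of a column, so the first m
    -- ties see every exchange. The indicators make the order total.
    tieWeights vertexIndicators vertexWeights : List (V → ℕ)
    tieWeights       = applyUpTo tieOf m
    vertexIndicators = map (indicator ≟-subset value value-injective) (subsets m)
    vertexWeights    = map (lift diagonalOf) entryWeights ++ tieWeights ++ vertexIndicators

    vertexWeights-separate : ∀ {M N} → Equal vertexWeights M N → M ↭ N
    vertexWeights-separate {M} {N} es = indicators-separate ≟-subset value value-injective ∈-subsets M N
      (All.++⁻ʳ tieWeights (All.++⁻ʳ (map (lift diagonalOf) entryWeights) es))

    order : TermOrder V
    order = weightOrder vertexWeights vertexWeights-separate

    open TermOrder order using (_≺_; ++-monoˡ-≺)

    ≺-trans : ∀ {M N P} → M ≺ N → N ≺ P → M ≺ P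
    ≺-trans = Less-trans vertexWeights

    ≺-irrefl : ∀ {M N} → M ↭ N → ¬ M ≺ N
    ≺-irrefl p = Less-irrefl vertexWeights (↭⇒Equal vertexWeights p)

    ≺-respʳ : ∀ {M N P} → N ↭ P → M ≺ N → M ≺ P
    ≺-respʳ p = Less-respʳ vertexWeights (↭⇒Equal vertexWeights p)

    ≺-respˡ : ∀ {M N P} → N ↭ P → N ≺ M → P ≺ M
    ≺-respˡ p = Less-respˡ vertexWeights (↭⇒Equal vertexWeights p)

    ≺-compare : ∀ M N → M ≺ N ⊎ M ↭ N ⊎ N ≺ M
    ≺-compare M N with compareBy vertexWeights M N
    ... | inj₁ l         = inj₁ l
    ... | inj₂ (inj₁ es) = inj₂ (inj₁ (vertexWeights-separate es))
    ... | inj₂ (inj₂ l)  = inj₂ (inj₂ l)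

    ≺-from-diagonals : ∀ {M N} → diagonals M ≺ₑ diagonals N → M ≺ N
    ≺-from-diagonals l = Less-++⁺ˡ (map (lift diagonalOf) entryWeights) (Less-lift⁺ diagonalOf entryWeights l)

    ≺-diagonals : ∀ {M N} → M ≺ N → diagonals M ≺ₑ diagonals N ⊎ diagonals M ↭ diagonals N
    ≺-diagonals {M} {N} l with Less-++⁻ (map (lift diagonalOf) entryWeights) l
    ... | inj₁ l′ = inj₁ (Less-lift⁻ diagonalOf entryWeights l′)
    ... | inj₂ es = inj₂ (entryWeights-separate (Equal-lift⁻ diagonalOf {entryWeights} {M} {N} es))

    ≺-from-ties : ∀ {M N} → diagonals M ↭ diagonals N → Less tieWeights M N → M ≺ N
    ≺-from-ties {M} {N} p l = Less-++⁺ʳ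
      (Equal-lift⁺ diagonalOf {entryWeights} {M} {N} (↭⇒Equal entryWeights p)) (Less-++⁺ˡ tieWeights l)

    Uncrossing : V → V → Set
    Uncrossing I J = ∃ λ e → ∃ λ is′ → ∃ λ js′ → Uncross e (columnsOf I) (columnsOf J) is′ js′

    -- The order of I′ and J′ is such that their sizes are those of I and J.
    uncrossed : ∀ I J → Uncrossing I J → ∃ λ I′ → ∃ λ J′ →
      (length (columnsOf I′) ≡ length (columnsOf I) × length (columnsOf J′) ≡ length (columnsOf J)) ×
      diagonals (I′ ∷ J′ ∷ []) ↭ diagonals (I ∷ J ∷ []) × (I′ ∷ J′ ∷ [] ≺ I ∷ J ∷ [])
    uncrossed I J (e , is′ , js′ , u)
      with Uncross-length u | Uncross-Inc u (columnsOf-increasing I) (columnsOf-increasing J)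
    ... | li , lj | inc , inc′ with fromColumns I js′ inc′ lj | fromColumns J is′ inc li
    ...   | I′ , refl | J′ , refl = I′ , J′ , (lj , li) , diag , ≺-from-ties {I′ ∷ J′ ∷ []} {I ∷ J ∷ []} diag
              (Less-applyUpTo tieOf {m} {e} {I′ ∷ J′ ∷ []} {I ∷ J ∷ []} e<m
                (λ {e′} l → sums e′ _≡_ (tie-Uncross-≡ e′ l u))
                (sums e _<_ (tie-Uncross-< u)))
      where
      diag : diagonals (I′ ∷ J′ ∷ []) ↭ diagonals (I ∷ J ∷ [])
      diag = ↭-trans (↭-reflexive (cong (diagonalOf I′ ++_) (List.++-identityʳ _)))
        (↭-trans (++-comm (diagonalOf I′) (diagonalOf J′))
          (↭-trans (Uncross-mono id u) (↭-reflexive (cong (diagonalOf I ++_) (sym (List.++-identityʳ _))))))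
      e<m : e < m
      e<m = ℕ.<-≤-trans (Uncross-< u) (subst (_≤ m) (ℕ.+-identityʳ _) (Inc-length (columnsOf-increasing I) z≤n))
      sums : ∀ e (_~_ : ℕ → ℕ → Set) → (tieOf e J′ + tieOf e I′) ~ (tieOf e I + tieOf e J) →
             weight (tieOf e) (I′ ∷ J′ ∷ []) ~ weight (tieOf e) (I ∷ J ∷ [])
      sums e _~_ = subst₂ _~_
        (trans (ℕ.+-comm (tieOf e J′) (tieOf e I′)) (cong (tieOf e I′ +_) (sym (ℕ.+-identityʳ _))))
        (cong (tieOf e I +_) (sym (ℕ.+-identityʳ _)))

    Good : Monomial V → Set
    Good T = IsFace L (support T) × AvoidsEmpty L T

    HasEmpty HasCrossing : Monomial V → Set
    HasEmpty T = ∃ λ I → ∃ λ P → T ↭ I ∷ P × columnsOf I ≡ []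
    HasCrossing T = ∃ λ I → ∃ λ J → ∃ λ P → T ↭ I ∷ J ∷ P × Uncrossing I J

    private
      against : ∀ (I : V) ys → (∀ {J} → J ∈ ys → NonCrossing (value I) (value J)) ⊎
                (∃ λ J → J ∈ ys × Uncrossing I J)
      against I []       = inj₁ λ ()
      against I (J ∷ ys) with nonCrossing? (value I) (value J) | against I ys
      ... | inj₂ u | _                  = inj₂ (J , here refl , u)
      ... | inj₁ n | inj₂ (K , K∈ , u)  = inj₂ (K , there K∈ , u)
      ... | inj₁ n | inj₁ ns            = inj₁ λ { (here refl) → n ; (there J∈) → ns J∈ }

      allAgainst : ∀ xs ys → (∀ {I J} → I ∈ xs → J ∈ ys → NonCrossing (value I) (value J)) ⊎
                   (∃ λ I → ∃ λ J → I ∈ xs × J ∈ ys × Uncrossing I J)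
      allAgainst []       ys = inj₁ λ ()
      allAgainst (I ∷ xs) ys with against I ys | allAgainst xs ys
      ... | inj₂ (J , J∈ , u) | _ = inj₂ (I , J , here refl , J∈ , u)
      ... | inj₁ ns | inj₂ (K , J , K∈ , J∈ , u) = inj₂ (K , J , there K∈ , J∈ , u)
      ... | inj₁ ns | inj₁ ns′ = inj₁ λ { (here refl) J∈ → ns J∈ ; (there I∈) J∈ → ns′ I∈ J∈ }

      empties? : ∀ T → AvoidsEmpty L T ⊎ (∃ λ I → I ∈ T × columnsOf I ≡ [])
      empties? []      = inj₁ []
      empties? (I ∷ T) with nonempty? (value I) | empties? T
      ... | no ¬ne | _                 = inj₂ (I , here refl , cols-empty (value I) ¬ne)
      ... | yes _  | inj₂ (J , J∈ , e) = inj₂ (J , there J∈ , e)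
      ... | yes ne | inj₁ nes          = inj₁ (ne ∷ nes)

    good? : ∀ T → Good T ⊎ HasEmpty T ⊎ HasCrossing T
    good? T with empties? T | allAgainst T T
    ... | inj₂ (I , I∈ , e) | _ with extract I∈
    ...   | P , p = inj₂ (inj₁ (I , P , p , e))
    good? T | inj₁ ne | inj₁ face = inj₁ ((λ I∈ J∈ → face I∈ J∈) , ne)
    good? T | inj₁ ne | inj₂ (I , J , I∈ , J∈ , u) with extract I∈
    ...   | P , p with ∈-resp-↭ p J∈
    -- The search also tests a vertex against itself, but equal columns do not cross.
    ...     | here refl = ⊥-elim (Uncross-irrefl (proj₂ (proj₂ (proj₂ u))))
    ...     | there J∈P with extract J∈P
    ...       | Q , q = inj₂ (inj₂ (I , J , Q , ↭-trans p (prep I q) , u))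

    []-≺ : ∀ I → [] ≺ I ∷ []
    []-≺ I with ≺-compare [] (I ∷ [])
    ... | inj₁ l        = l
    ... | inj₂ (inj₁ p) = ⊥-elim (¬x∷xs↭[] (↭-sym p))
    ... | inj₂ (inj₂ l) = ⊥-elim (TermOrder.[]-minimum order (I ∷ []) l)

    -- Both moves keep the product of diagonals: an empty column contributes nothing to it, and an
    -- exchange of tails moves entries only within their rows.
    reduce : ∀ T → HasEmpty T ⊎ HasCrossing T → ∃ λ T′ → T′ ≺ T × diagonals T′ ↭ diagonals T
    reduce T (inj₁ (I , P , p , e)) = P
      , ≺-respʳ (↭-trans (++-comm P (I ∷ [])) (↭-sym p))
          (≺-respˡ (↭-reflexive (List.++-identityʳ P)) (++-monoˡ-≺ P ([]-≺ I)))
      , ↭-trans (subst (λ xs → diagonals P ↭ mono id xs ++ diagonals P) (sym e)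
          (↭-reflexive (cong (_++ diagonals P) (sym (mono-[] {m} id))))) (↭-sym (diagonals-↭ p))
    reduce T (inj₂ (I , J , P , p , u)) with uncrossed I J u
    ... | I′ , J′ , _ , diag , l = I′ ∷ J′ ∷ P
      , ≺-respʳ (↭-trans (++-comm P (I ∷ J ∷ [])) (↭-sym p))
          (≺-respˡ (++-comm P (I′ ∷ J′ ∷ [])) (++-monoˡ-≺ P l))
      , ↭-trans (pull I′ J′) (↭-trans (++⁺ʳ (diagonals P) diag) (↭-trans (↭-sym (pull I J)) (↭-sym (diagonals-↭ p))))
      where
      pull : ∀ I J → diagonals (I ∷ J ∷ P) ↭ diagonals (I ∷ J ∷ []) ++ diagonals P
      pull I J = ↭-reflexive (List.concatMap-++ diagonalOf (I ∷ J ∷ []) P)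

    nonempties-columns : ∀ T → AvoidsEmpty L T → map cons (nonempties (map columnsOf T)) ≡ map columnsOf T
    nonempties-columns []      []         = refl
    nonempties-columns (I ∷ T) (ne ∷ nes) with columnsOf I in eq
    ... | []     = ⊥-elim (cols-nonempty (value I) ne eq)
    ... | x ∷ xs = cong ((x ∷ xs) ∷_) (nonempties-columns T nes)

    good-unique : ∀ {M N} → Good M → Good N → diagonals M ↭ diagonals N → M ↭ N
    good-unique {M} {N} (face , ne) (face′ , ne′) p with ↭-map-inv columnsOf {ys = map columnsOf N} columns-↭
      where
      origin : ∀ T {y} → y ∈ nonempties (map columnsOf T) → ∃ λ I → I ∈ T × cons y ≡ columnsOf I
      origin T y∈ = ∈-map⁻ columnsOf (∈-nonempties (map columnsOf T) y∈)
      increasing : ∀ T → Increasing (nonempties (map columnsOf T))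
      increasing T y∈ with origin T y∈
      ... | I , _ , e = subst (Inc 0) (sym e) (columnsOf-increasing I)
      short : ∀ T {y} → y ∈ nonempties (map columnsOf T) → length (cons y) ≤ m
      short T y∈ = subst (_≤ m) (ℕ.+-identityʳ _) (Inc-length (increasing T y∈) z≤n)
      nonCrossings : ∀ T → IsFace L (support T) → NonCrossings (nonempties (map columnsOf T))
      nonCrossings T face {e = i} {is′} {js′} y∈ z∈ u with origin T y∈ | origin T z∈
      ... | I , I∈ , e | J , J∈ , e′ = NonCrossing⇒¬Uncross (value I) (value J) (face I∈ J∈)
        (subst₂ (λ t t′ → Uncross i t t′ is′ js′) e e′ u)
      diag : ∀ T → concatMap (mono id ∘ cons) (nonempties (map columnsOf T)) ≡ diagonals T
      diag T = trans (sym (concatMap-nonempties id (map columnsOf T))) (List.concatMap-map (mono id) columnsOf T)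
      columns-↭ : map columnsOf M ↭ map columnsOf N
      columns-↭ = subst₂ _↭_ (nonempties-columns M ne) (nonempties-columns N ne′) (map⁺ cons
        (nonCrossing-unique id id (short M) (short N) (increasing M) (increasing N)
          (nonCrossings M face) (nonCrossings N face′) (subst₂ _↭_ (sym (diag M)) (sym (diag N)) p)))
    ... | N′ , e , q = ↭-trans q (↭-reflexive (sym (List.map-injective columnsOf-injective e)))

    -- By well-founded descent a bad monomial below M reduces to a good one with the same diagonals,
    -- still below M; by `good-unique` that one would be M itself.
    good-minimal : ∀ {M} → Good M → ∀ N → diagonals N ↭ diagonals M → ¬ N ≺ M
    good-minimal {M} good N = go N (Less-wellFounded vertexWeights N)
      where
      go : ∀ N → Acc _≺_ N → diagonals N ↭ diagonals M → ¬ N ≺ M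
      go N (acc rec) p l with good? N
      ... | inj₁ good′ = ≺-irrefl (good-unique good′ good p) l
      ... | inj₂ bad with reduce N bad
      ...   | N′ , l′ , p′ = go N′ (rec l′) (↭-trans p′ p) (≺-trans l′ l)

open Combinatorics

-- The ring is abstract: all that is used of ℂ here is the absence of 2- and 3-torsion, passed as
-- hypotheses, and Cauchy sequences stay out of the computations.
module OverRing (R : CommutativeRing 0ℓ 0ℓ) where

  open CommutativeRing R hiding (zero)
  open Algebra.Properties.Ring ring
    using (-‿distribˡ-*; -‿distribʳ-*; -0#≈0#; -‿involutive; -‿+-comm; -1*x≈-x)
  open Algebra.Properties.CommutativeSemigroup *-commutativeSemigroup
    using () renaming (interchange to *-interchange)
  open Relation.Binary.Reasoning.Setoid setoid
  module CM = Algebra.Solver.CommutativeMonoid +-commutativeMonoid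


  -- Straightening.

  private
    A : Set
    A = Carrier

  -- Formal sums, determinants and distributions over rows are all functionals of this kind, so that
  -- interchanging two of them is an instance of `determinant-homo` or `∑-homo`.
  record Linear {X : Set} (L : (X → A) → A) : Set where
    field
      cong   : ∀ {f g} → (∀ x → f x ≈ g x) → L f ≈ L g
      +-homo : ∀ f g → L (λ x → f x + g x) ≈ L f + L g
      *-homo : ∀ c f → L (λ x → c * f x) ≈ c * L f

    -‿homo : ∀ f → L (λ x → - f x) ≈ - L f
    -‿homo f = trans (cong (λ x → sym (-1*x≈-x (f x)))) (trans (*-homo (- 1#) f) (-1*x≈-x (L f)))

    0-homo : ∀ {f} → (∀ x → f x ≈ 0#) → L f ≈ 0#
    0-homo {f} z = trans (cong λ x → trans (z x) (sym (zeroˡ (f x)))) (trans (*-homo 0# f) (zeroˡ (L f)))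

  interchange : ∀ a b c d → (a + b) + (c + d) ≈ (a + c) + (b + d)
  interchange = CM.solve 4 (λ a b c d → ((a CM.⊕ b) CM.⊕ (c CM.⊕ d)) CM.⊜ ((a CM.⊕ c) CM.⊕ (b CM.⊕ d))) refl

  x+-x : ∀ {x y} → x ≈ - y → x + y ≈ 0#
  x+-x {x} {y} e = trans (+-congʳ e) (-‿inverseˡ y)

  +≈0⇒≈- : ∀ {x y} → x + y ≈ 0# → x ≈ - y
  +≈0⇒≈- {x} {y} e = begin
    x               ≈⟨ +-identityʳ x ⟨
    x + 0#          ≈⟨ +-congˡ (-‿inverseʳ y) ⟨
    x + (y + - y)   ≈⟨ +-assoc x y (- y) ⟨
    (x + y) + - y   ≈⟨ +-congʳ e ⟩
    0# + - y        ≈⟨ +-identityˡ (- y) ⟩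
    - y             ∎

  0≈-0 : 0# ≈ - 0#
  0≈-0 = sym -0#≈0#

  -- Laplace expansions, alternating functions and exchange identities.

  module _ {C : Set} where

    -- The signed sum Σⱼ (-1)ʲ X cⱼ (c₀ … ĉⱼ …) of a Laplace expansion.
    laplace : List C → (C → List C → A) → A
    laplace []       X = 0#
    laplace (c ∷ cs) X = X c cs + - laplace cs (λ d r → X d (c ∷ r))

    laplace-cong : ∀ cs {X Y} → (∀ d r → X d r ≈ Y d r) → laplace cs X ≈ laplace cs Y
    laplace-cong []       e = refl
    laplace-cong (c ∷ cs) e = +-cong (e c cs) (-‿cong (laplace-cong cs (λ d r → e d (c ∷ r))))

    laplace-homo : ∀ cs {X : Set} {L : (X → A) → A} → Linear L → (g : C → List C → X → A) →
                   laplace cs (λ d r → L (g d r)) ≈ L (λ x → laplace cs (λ d r → g d r x))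
    laplace-homo []       lin g = sym (Linear.0-homo lin λ _ → refl)
    laplace-homo (c ∷ cs) {L = L} lin g = begin
      L (g c cs) + - laplace cs (λ d r → L (g d (c ∷ r)))
        ≈⟨ +-congˡ (-‿cong (laplace-homo cs lin λ d r → g d (c ∷ r))) ⟩
      L (g c cs) + - L (λ x → laplace cs (λ d r → g d (c ∷ r) x))
        ≈⟨ +-congˡ (Linear.-‿homo lin _) ⟨
      L (g c cs) + L (λ x → - laplace cs (λ d r → g d (c ∷ r) x))
        ≈⟨ Linear.+-homo lin _ _ ⟨
      L (λ x → laplace (c ∷ cs) (λ d r → g d r x)) ∎

    laplace-+ : ∀ cs X Y → laplace cs (λ d r → X d r + Y d r) ≈ laplace cs X + laplace cs Y
    laplace-+ []       X Y = sym (+-identityˡ 0#)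
    laplace-+ (c ∷ cs) X Y = begin
      (X c cs + Y c cs) + - laplace cs (λ d r → X d (c ∷ r) + Y d (c ∷ r))
        ≈⟨ +-congˡ (-‿cong (laplace-+ cs _ _)) ⟩
      (X c cs + Y c cs) + - (x + y)
        ≈⟨ +-congˡ (-‿+-comm x y) ⟨
      (X c cs + Y c cs) + (- x + - y)
        ≈⟨ interchange _ _ _ _ ⟩
      (X c cs + - x) + (Y c cs + - y) ∎
      where
      x = laplace cs (λ d r → X d (c ∷ r))
      y = laplace cs (λ d r → Y d (c ∷ r))

    laplace-* : ∀ cs a X → laplace cs (λ d r → a * X d r) ≈ a * laplace cs X
    laplace-* []       a X = sym (zeroʳ a)
    laplace-* (c ∷ cs) a X = begin
      a * X c cs + - laplace cs (λ d r → a * X d (c ∷ r)) ≈⟨ +-congˡ (-‿cong (laplace-* cs a _)) ⟩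
      a * X c cs + - (a * x)                              ≈⟨ +-congˡ (-‿distribʳ-* a x) ⟩
      a * X c cs + a * - x                                ≈⟨ distribˡ a _ _ ⟨
      a * (X c cs + - x)                                  ∎
      where x = laplace cs (λ d r → X d (c ∷ r))

    laplace-zero : ∀ cs {X} → (∀ d r → X d r ≈ 0#) → laplace cs X ≈ 0#
    laplace-zero cs {X} z = trans (laplace-cong cs λ d r → trans (z d r) (sym (zeroˡ (X d r))))
      (trans (laplace-* cs 0# X) (zeroˡ _))

    laplace-neg : ∀ cs X → laplace cs (λ d r → - X d r) ≈ - laplace cs X
    laplace-neg cs X = trans (laplace-cong cs λ d r → sym (-1*x≈-x (X d r)))
      (trans (laplace-* cs (- 1#) X) (-1*x≈-x _))

    laplace² : List C → (C → C → List C → A) → A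
    laplace² cs Y = laplace cs (λ a r → laplace r (Y a))

    -- Two columns are picked in both orders, with opposite signs. In the induction the terms that
    -- pick c first cancel those of the flipped function that pick it second, and conversely; the
    -- terms without c are covered by the induction hypothesis.
    laplace²-alternates : ∀ cs Y → laplace² cs Y + laplace² cs (flip Y) ≈ 0#
    laplace²-alternates []       Y = +-identityˡ 0#
    laplace²-alternates (c ∷ cs) Y = begin
      (a + - laplace cs (λ d r → Y d c r + - laplace r (λ d′ r′ → Y d d′ (c ∷ r′)))) +
      (b + - laplace cs (λ d r → Y c d r + - laplace r (λ d′ r′ → Y d′ d (c ∷ r′))))
        ≈⟨ +-cong (+-congˡ (-‿cong (split _ _))) (+-congˡ (-‿cong (split _ _))) ⟩
      (a + - (b + - p)) + (b + - (a + - q))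
        ≈⟨ +-cong (+-congˡ (unfold b p)) (+-congˡ (unfold a q)) ⟩
      (a + (- b + p)) + (b + (- a + q))
        ≈⟨ CM.solve 6 (λ a b′ p b a′ q → ((a CM.⊕ (b′ CM.⊕ p)) CM.⊕ (b CM.⊕ (a′ CM.⊕ q)))
             CM.⊜ ((a CM.⊕ a′) CM.⊕ ((b CM.⊕ b′) CM.⊕ (p CM.⊕ q)))) refl a (- b) p b (- a) q ⟩
      (a + - a) + ((b + - b) + (p + q))
        ≈⟨ +-cong (-‿inverseʳ a) (+-cong (-‿inverseʳ b) (laplace²-alternates cs _)) ⟩
      0# + (0# + 0#)
        ≈⟨ trans (+-identityˡ _) (+-identityˡ _) ⟩
      0# ∎
      where
      a = laplace cs (λ d r → Y c d r)
      b = laplace cs (λ d r → Y d c r)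
      p = laplace² cs (λ d d′ r′ → Y d d′ (c ∷ r′))
      q = laplace² cs (λ d d′ r′ → Y d′ d (c ∷ r′))
      split : ∀ X Z → laplace cs (λ d r → X d r + - Z d r) ≈ laplace cs X + - laplace cs Z
      split X Z = trans (laplace-+ cs X _) (+-congˡ (laplace-neg cs Z))
      unfold : ∀ x y → - (x + - y) ≈ - x + y
      unfold x y = trans (sym (-‿+-comm x (- y))) (+-congˡ (-‿involutive y))

    -- The value of a linear functional at the n × n determinant with columns cs, a monomial being
    -- given by the columns of its entries in the successive rows.
    determinant : ℕ → List C → (List C → A) → A
    determinant zero    cs f = f []
    determinant (suc n) cs f = laplace cs (λ d r → determinant n r (λ w → f (d ∷ w)))

    determinant-linear : ∀ n cs → Linear (determinant n cs)
    determinant-linear zero cs = record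
      { cong = λ e → e [] ; +-homo = λ _ _ → refl ; *-homo = λ _ _ → refl }
    determinant-linear (suc n) cs = record
      { cong   = λ e → laplace-cong cs λ d r → Linear.cong (determinant-linear n r) (λ w → e (d ∷ w))
      ; +-homo = λ f g → trans (laplace-cong cs λ d r → Linear.+-homo (determinant-linear n r) _ _)
                           (laplace-+ cs _ _)
      ; *-homo = λ c f → trans (laplace-cong cs λ d r → Linear.*-homo (determinant-linear n r) c _)
                           (laplace-* cs c _)
      }

    determinant-homo : ∀ n cs {X : Set} {L : (X → A) → A} → Linear L → (g : List C → X → A) →
      determinant n cs (λ w → L (g w)) ≈ L (λ x → determinant n cs (λ w → g w x))
    determinant-homo zero    cs lin g = refl
    determinant-homo (suc n) cs lin g =
      trans (laplace-cong cs λ d r → determinant-homo n r lin (λ w → g (d ∷ w)))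
        (laplace-homo cs lin λ d r x → determinant n r (λ w → g (d ∷ w) x))

    Alternating : (List C → A) → Set
    Alternating G = ∀ us x y vs → G (us ++ x ∷ y ∷ vs) ≈ - G (us ++ y ∷ x ∷ vs)

    record Bialternating (F : List C → List C → A) : Set where
      field
        altˡ : ∀ v → Alternating (λ u → F u v)
        altʳ : ∀ u → Alternating (F u)

    -- The entries of a term in a product of two minors of sizes k and l, where l ≤ k: two in each
    -- of the first l rows, one in each of the others.
    data Rows : ℕ → ℕ → Set where
      []  : Rows 0 0
      one : ∀ {k} → C → Rows k 0 → Rows (suc k) 0
      two : ∀ {k l} → C → C → Rows k l → Rows (suc k) (suc l)

    -- The sum of F over all ways to distribute the entries of each row to the two columns.
    spread : ∀ {k l} → Rows k l → (List C → List C → A) → A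
    spread []          F = F [] []
    spread (one x t)   F = spread t (λ u v → F (x ∷ u) v)
    spread (two x y t) F = spread t (λ u v → F (x ∷ u) (y ∷ v)) + spread t (λ u v → F (y ∷ u) (x ∷ v))

    spread-cong : ∀ {k l} (t : Rows k l) {F G} → (∀ u v → F u v ≈ G u v) → spread t F ≈ spread t G
    spread-cong []          e = e [] []
    spread-cong (one x t)   e = spread-cong t λ u → e (x ∷ u)
    spread-cong (two x y t) e = +-cong (spread-cong t λ u v → e (x ∷ u) (y ∷ v))
                                       (spread-cong t λ u v → e (y ∷ u) (x ∷ v))

    spread-+ : ∀ {k l} (t : Rows k l) F G → spread t (λ u v → F u v + G u v) ≈ spread t F + spread t G
    spread-+ []          F G = refl
    spread-+ (one x t)   F G = spread-+ t _ _
    spread-+ (two x y t) F G = trans (+-cong (spread-+ t _ _) (spread-+ t _ _)) (interchange _ _ _ _)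

    spread-* : ∀ {k l} (t : Rows k l) c F → spread t (λ u v → c * F u v) ≈ c * spread t F
    spread-* []          c F = refl
    spread-* (one x t)   c F = spread-* t c _
    spread-* (two x y t) c F = trans (+-cong (spread-* t c _) (spread-* t c _)) (sym (distribˡ c _ _))

    spread-linear : ∀ {k l} (t : Rows k l) → Linear {List C × List C} (λ F → spread t (λ u v → F (u , v)))
    spread-linear t = record
      { cong   = λ e → spread-cong t λ u v → e (u , v)
      ; +-homo = λ f g → spread-+ t _ _
      ; *-homo = λ c f → spread-* t c _
      }

    spread-neg : ∀ {k l} (t : Rows k l) F → spread t (λ u v → - F u v) ≈ - spread t F
    spread-neg t F = Linear.-‿homo (spread-linear t) (λ (u , v) → F u v)

    private
      headˡ : ∀ {F k l} (t : Rows k l) x y vs → Bialternating F →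
              spread t (λ u v → F (x ∷ y ∷ u) (vs ++ v)) + spread t (λ u v → F (y ∷ x ∷ u) (vs ++ v)) ≈ 0#
      headˡ t x y vs b = x+-x (trans (spread-cong t λ u v → Bialternating.altˡ b (vs ++ v) [] x y u) (spread-neg t _))

      headʳ : ∀ {F k l} (t : Rows k l) x y us → Bialternating F →
              spread t (λ u v → F (us ++ u) (x ∷ y ∷ v)) + spread t (λ u v → F (us ++ u) (y ∷ x ∷ v)) ≈ 0#
      headʳ t x y us b = x+-x (trans (spread-cong t λ u v → Bialternating.altʳ b (us ++ u) [] x y v) (spread-neg t _))

      vanish₆ : ∀ {a b c d e f} → a ≈ 0# → b ≈ 0# → c ≈ 0# → d ≈ 0# → e ≈ 0# → f ≈ 0# →
                a + (b + (c + (d + (e + f)))) ≈ 0#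
      vanish₆ a b c d e f = zz a (zz b (zz c (zz d (zz e f))))
        where
        zz : ∀ {x y} → x ≈ 0# → y ≈ 0# → x + y ≈ 0#
        zz p q = trans (+-cong p q) (+-identityˡ 0#)

    -- The entry v stays in the second row and takes each of the other three as its partner. In
    -- every distribution the column without v holds two of these three, and they occur in both
    -- orders: twelve terms in six cancelling pairs.
    exchange-first : ∀ {F k l} (t : Rows k l) p q u v → Bialternating F →
      spread (two p q (two u v t)) F + spread (two u q (two p v t)) F + spread (two p u (two q v t)) F ≈ 0#
    exchange-first t p q u v b = trans
      (CM.solve 12 (λ a₁ a₂ a₃ a₄ b₁ b₂ b₃ b₄ c₁ c₂ c₃ c₄ →
          (((a₁ CM.⊕ a₂) CM.⊕ (a₃ CM.⊕ a₄)) CM.⊕ ((b₁ CM.⊕ b₂) CM.⊕ (b₃ CM.⊕ b₄)))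
            CM.⊕ ((c₁ CM.⊕ c₂) CM.⊕ (c₃ CM.⊕ c₄))
        CM.⊜ (a₁ CM.⊕ b₁) CM.⊕ ((a₂ CM.⊕ c₂) CM.⊕ ((a₃ CM.⊕ c₃) CM.⊕ ((a₄ CM.⊕ b₄)
            CM.⊕ ((b₂ CM.⊕ c₄) CM.⊕ (b₃ CM.⊕ c₁)))))) refl _ _ _ _ _ _ _ _ _ _ _ _)
      (vanish₆ (headˡ t p u (q ∷ v ∷ []) b) (headʳ t q u (p ∷ v ∷ []) b)
               (headˡ t q u (p ∷ v ∷ []) b) (headʳ t p u (q ∷ v ∷ []) b)
               (headʳ t q p (u ∷ v ∷ []) b) (headˡ t q p (u ∷ v ∷ []) b))

    -- The same with p fixed in the first row: the two entries of the column without p occur in both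
    -- orders.
    exchange-second : ∀ {F k l} (t : Rows k l) p q u v → Bialternating F →
      spread (two p q (two u v t)) F + spread (two p v (two u q t)) F + spread (two p u (two q v t)) F ≈ 0#
    exchange-second t p q u v b = trans
      (CM.solve 12 (λ a₁ a₂ a₃ a₄ b₁ b₂ b₃ b₄ c₁ c₂ c₃ c₄ →
          (((a₁ CM.⊕ a₂) CM.⊕ (a₃ CM.⊕ a₄)) CM.⊕ ((b₁ CM.⊕ b₂) CM.⊕ (b₃ CM.⊕ b₄)))
            CM.⊕ ((c₁ CM.⊕ c₂) CM.⊕ (c₃ CM.⊕ c₄))
        CM.⊜ (a₁ CM.⊕ b₁) CM.⊕ ((a₂ CM.⊕ c₂) CM.⊕ ((a₃ CM.⊕ c₃) CM.⊕ ((a₄ CM.⊕ b₄)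
            CM.⊕ ((b₂ CM.⊕ c₁) CM.⊕ (b₃ CM.⊕ c₄)))))) refl _ _ _ _ _ _ _ _ _ _ _ _)
      (vanish₆ (headʳ t q v (p ∷ u ∷ []) b) (headʳ t q u (p ∷ v ∷ []) b)
               (headˡ t q u (p ∷ v ∷ []) b) (headˡ t q v (p ∷ u ∷ []) b)
               (headʳ t v u (p ∷ q ∷ []) b) (headˡ t v u (p ∷ q ∷ []) b))

    -- Whichever entry forms the short column, the other two occur in both orders in the long one.
    exchange-three : ∀ {F k} (t : Rows k 0) p q u → Bialternating F →
      spread (two p q (one u t)) F + spread (two u q (one p t)) F + spread (two p u (one q t)) F ≈ 0#
    exchange-three t p q u b = trans
      (CM.solve 6 (λ a₁ a₂ b₁ b₂ c₁ c₂ →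
          ((a₁ CM.⊕ a₂) CM.⊕ (b₁ CM.⊕ b₂)) CM.⊕ (c₁ CM.⊕ c₂)
        CM.⊜ (a₁ CM.⊕ b₁) CM.⊕ ((a₂ CM.⊕ c₂) CM.⊕ (b₂ CM.⊕ c₁))) refl _ _ _ _ _ _)
      (trans (+-cong (headˡ t p u (q ∷ []) b)
          (trans (+-cong (headˡ t q u (p ∷ []) b) (headˡ t q p (u ∷ []) b)) (+-identityˡ 0#)))
        (+-identityˡ 0#))

    exchange-two : ∀ {F k} (t : Rows k 0) p u → Bialternating F →
      spread (one p (one u t)) F + spread (one u (one p t)) F ≈ 0#
    exchange-two t p u b = headˡ t p u [] b

    Bialternating-one : ∀ {F} x → Bialternating F → Bialternating (λ u v → F (x ∷ u) v)
    Bialternating-one x b = record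
      { altˡ = λ v us → Bialternating.altˡ b v (x ∷ us)
      ; altʳ = λ u → Bialternating.altʳ b (x ∷ u)
      }

    -- Summing out a first row leaves a bialternating function of the rest; this is how a violation
    -- further down is reached.
    Bialternating-two : ∀ {F} x y → Bialternating F →
                        Bialternating (λ u v → F (x ∷ u) (y ∷ v) + F (y ∷ u) (x ∷ v))
    Bialternating-two x y b = record
      { altˡ = λ v us a c vs → trans
          (+-cong (Bialternating.altˡ b (y ∷ v) (x ∷ us) a c vs) (Bialternating.altˡ b (x ∷ v) (y ∷ us) a c vs))
          (-‿+-comm _ _)
      ; altʳ = λ u us a c vs → trans
          (+-cong (Bialternating.altʳ b (x ∷ u) (y ∷ us) a c vs) (Bialternating.altʳ b (y ∷ u) (x ∷ us) a c vs))
          (-‿+-comm _ _)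
      }

  -- Semistandard arrays and the reduction to them.

  module _ {m : ℕ} where

    private
      Rowsₘ : ℕ → ℕ → Set
      Rowsₘ = Rows {Fin m}

    -- Decreases when larger entries move to later rows.
    ν : ∀ {k l} → Rowsₘ k l → ℕ
    ν             []          = 0
    ν {suc k}     (one x t)   = suc k ℕ.* toℕ x ℕ.+ ν t
    ν {suc k} {l} (two x y t) = suc k ℕ.* (toℕ x ℕ.+ toℕ y) ℕ.+ ν t

    Sorted : ∀ {k l} → Rowsₘ k l → Set
    Sorted []          = ⊤
    Sorted (one x t)   = Sorted t
    Sorted (two x y t) = x Fin.≤ y × Sorted t

    Fits₁ : ∀ {k} → Fin m → Rowsₘ k 0 → Set
    Fits₁ x []        = ⊤
    Fits₁ x (one z t) = x Fin.< z

    Fits₂ : ∀ {k l} → Fin m → Fin m → Rowsₘ k l → Set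
    Fits₂ x y []          = ⊤
    Fits₂ x y (one z t)   = x Fin.< z
    Fits₂ x y (two z w t) = x Fin.< z × y Fin.< w

    SemiStandard : ∀ {k l} → Rowsₘ k l → Set
    SemiStandard []          = ⊤
    SemiStandard (one x t)   = Fits₁ x t × SemiStandard t
    SemiStandard (two x y t) = Fits₂ x y t × SemiStandard t

    sort : ∀ {k l} → Rowsₘ k l → Rowsₘ k l
    sort []          = []
    sort (one x t)   = one x (sort t)
    sort (two x y t) with x Fin.≤? y
    ... | yes _ = two x y (sort t)
    ... | no  _ = two y x (sort t)

    sort-sorted : ∀ {k l} (t : Rowsₘ k l) → Sorted (sort t)
    sort-sorted []          = tt
    sort-sorted (one x t)   = sort-sorted t
    sort-sorted (two x y t) with x Fin.≤? y
    ... | yes x≤y = x≤y , sort-sorted t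
    ... | no  x≰y = ℕ.≰⇒≥ x≰y , sort-sorted t

    ν-sort : ∀ {k l} (t : Rowsₘ k l) → ν (sort t) ≡ ν t
    ν-sort []          = ≡.refl
    ν-sort {suc k} (one x t) = ≡.cong (suc k ℕ.* toℕ x ℕ.+_) (ν-sort t)
    ν-sort {suc k} (two x y t) with x Fin.≤? y
    ... | yes _ = ≡.cong (suc k ℕ.* (toℕ x ℕ.+ toℕ y) ℕ.+_) (ν-sort t)
    ... | no  _ = ≡.cong₂ (λ a b → suc k ℕ.* a ℕ.+ b) (ℕ.+-comm (toℕ y) (toℕ x)) (ν-sort t)

    spread-sort : ∀ {k l} (t : Rowsₘ k l) F → spread (sort t) F ≈ spread t F
    spread-sort []          F = refl
    spread-sort (one x t)   F = spread-sort t _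
    spread-sort (two x y t) F with x Fin.≤? y
    ... | yes _ = +-cong (spread-sort t _) (spread-sort t _)
    ... | no  _ = trans (+-cong (spread-sort t _) (spread-sort t _)) (+-comm _ _)

    module _ (torsion₂ : ∀ x → x + x ≈ 0# → x ≈ 0#) (torsion₃ : ∀ x → x + x + x ≈ 0# → x ≈ 0#) where

      -- A term of the identity either vanishes, being smaller in ν, or coincides with s because the
      -- exchanged entries are equal. So the identity reads n s = 0 with n at most 3.
      absorb : ∀ {s x y} → s + x + y ≈ 0# → x ≈ 0# ⊎ x ≈ s → y ≈ 0# ⊎ y ≈ s → s ≈ 0#
      absorb {s} e (inj₁ x) (inj₁ y) = trans (sym (trans (+-cong (trans (+-congˡ x) (+-identityʳ s)) y) (+-identityʳ s))) e
      absorb {s} e (inj₁ x) (inj₂ y) = torsion₂ s (trans (sym (+-cong (trans (+-congˡ x) (+-identityʳ s)) y)) e)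
      absorb {s} e (inj₂ x) (inj₁ y) = torsion₂ s (trans (sym (trans (+-cong (+-congˡ x) y) (+-identityʳ _))) e)
      absorb {s} e (inj₂ x) (inj₂ y) = torsion₃ s (trans (sym (+-cong (+-congˡ x) y)) e)

      -- Quantified over F, so that a reduction of the later rows applies to the function obtained
      -- by summing out the first row.
      Reducible : ∀ {k l} → Rowsₘ k l → Set
      Reducible {k} {l} t = ∀ {F} → Bialternating F →
        (∀ (t′ : Rowsₘ k l) → ν t′ ℕ.< ν t → spread t′ F ≈ 0#) → spread t F ≈ 0#

      Reducible-one : ∀ {k} x (t : Rowsₘ k 0) → Reducible t → Reducible (one x t)
      Reducible-one {k} x t red b h = red (Bialternating-one x b)
        (λ t′ l → h (one x t′) (ℕ.+-monoʳ-< (suc k ℕ.* toℕ x) l))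

      Reducible-two : ∀ {k l} x y (t : Rowsₘ k l) → Reducible t → Reducible (two x y t)
      Reducible-two {k} x y t red b h = trans (sym (spread-+ t _ _)) (red (Bialternating-two x y b)
        (λ t′ l → trans (spread-+ t′ _ _) (h (two x y t′) (ℕ.+-monoʳ-< (suc k ℕ.* (toℕ x ℕ.+ toℕ y)) l))))

      private
        -- Consecutive rows have weights k + 2 and k + 1 in ν, so exchanging q with a smaller u of
        -- the next row lowers ν by q - u.
        drop₂ : ∀ k q u {e f} r → u ℕ.< q →
          suc (suc k) ℕ.* (e ℕ.+ u) ℕ.+ (suc k ℕ.* (q ℕ.+ f) ℕ.+ r) ℕ.<
          suc (suc k) ℕ.* (e ℕ.+ q) ℕ.+ (suc k ℕ.* (u ℕ.+ f) ℕ.+ r)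
        drop₂ k q u {e} {f} r u<q with ℕ.m≤n⇒∃[o]m+o≡n u<q
        ... | d , ≡.refl = ℕ.<-≤-trans (ℕ.m<m+n _ (ℕ.s≤s ℕ.z≤n)) (ℕ.≤-reflexive (identity k u e f r d))
          where
          identity : ∀ k u e f r d →
            (suc (suc k) ℕ.* (e ℕ.+ u) ℕ.+ (suc k ℕ.* ((suc u ℕ.+ d) ℕ.+ f) ℕ.+ r)) ℕ.+ suc d ≡
            suc (suc k) ℕ.* (e ℕ.+ (suc u ℕ.+ d)) ℕ.+ (suc k ℕ.* (u ℕ.+ f) ℕ.+ r)
          identity = solve-∀

        drop₁ : ∀ k q u r → u ℕ.< q →
          suc (suc k) ℕ.* u ℕ.+ (suc k ℕ.* q ℕ.+ r) ℕ.< suc (suc k) ℕ.* q ℕ.+ (suc k ℕ.* u ℕ.+ r)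
        drop₁ k q u r u<q with ℕ.m≤n⇒∃[o]m+o≡n u<q
        ... | d , ≡.refl = ℕ.<-≤-trans (ℕ.m<m+n _ (ℕ.s≤s ℕ.z≤n)) (ℕ.≤-reflexive (identity k u r d))
          where
          identity : ∀ k u r d →
            (suc (suc k) ℕ.* u ℕ.+ (suc k ℕ.* (suc u ℕ.+ d) ℕ.+ r)) ℕ.+ suc d ≡
            suc (suc k) ℕ.* (suc u ℕ.+ d) ℕ.+ (suc k ℕ.* u ℕ.+ r)
          identity = solve-∀

        either : ∀ {k l} (t t′ : Rowsₘ k l) {F} {a b : Fin m} → a Fin.≤ b →
          (∀ (t′ : Rowsₘ k l) → ν t′ ℕ.< ν t → spread t′ F ≈ 0#) →
          (a Fin.< b → ν t′ ℕ.< ν t) → (a ≡ b → t′ ≡ t) →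
          spread t′ F ≈ 0# ⊎ spread t′ F ≈ spread t F
        either t t′ {F} {a} {b} a≤b h below same with Fin.<-cmp a b
        ... | tri< a<b _ _ = inj₁ (h t′ (below a<b))
        ... | tri≈ _ e _   = inj₂ (reflexive (≡.cong (λ t → spread t F) (same e)))
        ... | tri> _ _ b<a with () ← ℕ.<⇒≱ b<a a≤b

      -- With v kept in place, u changes places with p or with q. Both are at least u because the
      -- row is sorted, so neither exchange raises ν.
      first-violation : ∀ {k l} p q u v (t : Rowsₘ k l) → p Fin.≤ q → u Fin.≤ p →
                        Reducible (two p q (two u v t))
      first-violation {k} p q u v t p≤q u≤p b h = absorb (exchange-first t p q u v b)
        (either (two p q (two u v t)) (two u q (two p v t)) u≤p h
          (λ u<p → ≡.subst₂ ℕ._<_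
            (≡.cong (λ z → suc (suc k) ℕ.* z ℕ.+ (suc k ℕ.* (toℕ p ℕ.+ toℕ v) ℕ.+ ν t)) (ℕ.+-comm (toℕ q) (toℕ u)))
            (≡.cong (λ z → suc (suc k) ℕ.* z ℕ.+ (suc k ℕ.* (toℕ u ℕ.+ toℕ v) ℕ.+ ν t)) (ℕ.+-comm (toℕ q) (toℕ p)))
            (drop₂ k (toℕ p) (toℕ u) {toℕ q} {toℕ v} (ν t) u<p))
          (λ { ≡.refl → ≡.refl }))
        (either (two p q (two u v t)) (two p u (two q v t)) (ℕ.≤-trans u≤p p≤q) h
          (λ u<q → drop₂ k (toℕ q) (toℕ u) {toℕ p} {toℕ v} (ν t) u<q)
          (λ { ≡.refl → ≡.refl }))

      -- Here p is kept in place, and q changes places with v or with u, which are both at most q.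
      second-violation : ∀ {k l} p q u v (t : Rowsₘ k l) → u Fin.≤ v → v Fin.≤ q →
                         Reducible (two p q (two u v t))
      second-violation {k} p q u v t u≤v v≤q b h = absorb (exchange-second t p q u v b)
        (either (two p q (two u v t)) (two p v (two u q t)) v≤q h
          (λ v<q → ≡.subst₂ ℕ._<_
            (≡.cong (λ z → suc (suc k) ℕ.* (toℕ p ℕ.+ toℕ v) ℕ.+ (suc k ℕ.* z ℕ.+ ν t)) (ℕ.+-comm (toℕ q) (toℕ u)))
            (≡.cong (λ z → suc (suc k) ℕ.* (toℕ p ℕ.+ toℕ q) ℕ.+ (suc k ℕ.* z ℕ.+ ν t)) (ℕ.+-comm (toℕ v) (toℕ u)))
            (drop₂ k (toℕ q) (toℕ v) {toℕ p} {toℕ u} (ν t) v<q))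
          (λ { ≡.refl → ≡.refl }))
        (either (two p q (two u v t)) (two p u (two q v t)) (ℕ.≤-trans u≤v v≤q) h
          (λ u<q → drop₂ k (toℕ q) (toℕ u) {toℕ p} {toℕ v} (ν t) u<q)
          (λ { ≡.refl → ≡.refl }))

      three-violation : ∀ {k} p q u (t : Rowsₘ k 0) → p Fin.≤ q → u Fin.≤ p →
                        Reducible (two p q (one u t))
      three-violation {k} p q u t p≤q u≤p b h = absorb (exchange-three t p q u b)
        (either (two p q (one u t)) (two u q (one p t)) u≤p h
          (λ u<p → drop₃ (toℕ q) (toℕ p) u<p)
          (λ { ≡.refl → ≡.refl }))
        (either (two p q (one u t)) (two p u (one q t)) (ℕ.≤-trans u≤p p≤q) h
          (λ u<q → ≡.subst₂ ℕ._<_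
            (≡.cong (λ z → suc (suc k) ℕ.* z ℕ.+ (suc k ℕ.* toℕ q ℕ.+ ν t)) (ℕ.+-comm (toℕ u) (toℕ p)))
            (≡.cong (λ z → suc (suc k) ℕ.* z ℕ.+ (suc k ℕ.* toℕ u ℕ.+ ν t)) (ℕ.+-comm (toℕ q) (toℕ p)))
            (drop₃ (toℕ p) (toℕ q) u<q))
          (λ { ≡.refl → ≡.refl }))
        where
        drop₃ : ∀ e z → toℕ u ℕ.< z →
          suc (suc k) ℕ.* (toℕ u ℕ.+ e) ℕ.+ (suc k ℕ.* z ℕ.+ ν t) ℕ.<
          suc (suc k) ℕ.* (z ℕ.+ e) ℕ.+ (suc k ℕ.* toℕ u ℕ.+ ν t)
        drop₃ e z l = ≡.subst₂ ℕ._<_ (identity k (toℕ u) z e (ν t)) (identity k z (toℕ u) e (ν t))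
          (ℕ.+-monoʳ-< (suc (suc k) ℕ.* e) (drop₁ k z (toℕ u) (ν t) l))
          where
          identity : ∀ k a b e r → suc (suc k) ℕ.* e ℕ.+ (suc (suc k) ℕ.* a ℕ.+ (suc k ℕ.* b ℕ.+ r)) ≡
            suc (suc k) ℕ.* (a ℕ.+ e) ℕ.+ (suc k ℕ.* b ℕ.+ r)
          identity = solve-∀

      two-violation : ∀ {k} p u (t : Rowsₘ k 0) → u Fin.≤ p → Reducible (one p (one u t))
      two-violation {k} p u t u≤p b h = absorb
        (trans (+-identityʳ _) (exchange-two t p u b))
        (either (one p (one u t)) (one u (one p t)) u≤p h
          (λ u<p → drop₁ k (toℕ p) (toℕ u) (ν t) u<p)
          (λ { ≡.refl → ≡.refl }))
        (inj₁ refl)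

      semiStandard? : ∀ {k l} (t : Rowsₘ k l) → Sorted t → SemiStandard t ⊎ Reducible t
      semiStandard? []        s = inj₁ tt
      semiStandard? (one x t) s with semiStandard? t s
      ... | inj₂ red = inj₂ (Reducible-one x t red)
      ... | inj₁ std with t
      ...   | []      = inj₁ (tt , std)
      ...   | one z t′ with x Fin.<? z
      ...     | yes x<z = inj₁ (x<z , std)
      ...     | no  x≮z = inj₂ (two-violation x z t′ (ℕ.≮⇒≥ x≮z))
      semiStandard? (two x y t) (x≤y , s) with semiStandard? t s
      ... | inj₂ red = inj₂ (Reducible-two x y t red)
      ... | inj₁ std with t
      ...   | []      = inj₁ (tt , std)
      ...   | one z t′ with x Fin.<? z
      ...     | yes x<z = inj₁ (x<z , std)
      ...     | no  x≮z = inj₂ (three-violation x y z t′ x≤y (ℕ.≮⇒≥ x≮z))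
      semiStandard? (two x y t) (x≤y , s) | inj₁ std | two z w t′ with x Fin.<? z | y Fin.<? w
      ... | yes x<z | yes y<w = inj₁ ((x<z , y<w) , std)
      ... | no  x≮z | _       = inj₂ (first-violation x y z w t′ x≤y (ℕ.≮⇒≥ x≮z))
      ... | _       | no  y≮w = inj₂ (second-violation x y z w t′ (proj₁ s) (ℕ.≮⇒≥ y≮w))

      determined-by-semiStandard : ∀ {k l F} → Bialternating F →
        (∀ (t : Rowsₘ k l) → Sorted t → SemiStandard t → spread t F ≈ 0#) →
        ∀ (t : Rowsₘ k l) → spread t F ≈ 0#
      determined-by-semiStandard {k} {l} {F} b h t = go t (<-wellFounded (ν t))
        where
        go : ∀ (t : Rowsₘ k l) → Acc ℕ._<_ (ν t) → spread t F ≈ 0#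
        go t (acc rec) with semiStandard? (sort t) (sort-sorted t)
        ... | inj₁ std = trans (sym (spread-sort t F)) (h (sort t) (sort-sorted t) std)
        ... | inj₂ red = trans (sym (spread-sort t F)) (red b
          λ t′ l′ → go t′ (rec (≡.subst (ν t′ ℕ.<_) (ν-sort t) l′)))

  -- Products of minors.

  -- The pairing of a formal sum with a function. With `χ` it yields a coefficient; products and
  -- images are paired by transforming the function.
  ∑ : ∀ {X : Set} → List (A × X) → (X → A) → A
  ∑ []            f = 0#
  ∑ ((c , x) ∷ G) f = c * f x + ∑ G f

  ∑-cong : ∀ {X : Set} (G : List (A × X)) {f g} → (∀ x → f x ≈ g x) → ∑ G f ≈ ∑ G g
  ∑-cong []            e = refl
  ∑-cong ((c , x) ∷ G) e = +-cong (*-congˡ (e x)) (∑-cong G e)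

  ∑-cong-All : ∀ {X : Set} {P : X → Set} {G : List (A × X)} {f g} → All (P ∘ proj₂) G →
               (∀ {x} → P x → f x ≈ g x) → ∑ G f ≈ ∑ G g
  ∑-cong-All []       e = refl
  ∑-cong-All (p ∷ ps) e = +-cong (*-congˡ (e p)) (∑-cong-All ps e)

  x*yz≈y*xz : ∀ x y z → x * (y * z) ≈ y * (x * z)
  x*yz≈y*xz x y z = trans (sym (*-assoc x y z)) (trans (*-congʳ (*-comm x y)) (*-assoc y x z))

  ∑-linear : ∀ {X : Set} (G : List (A × X)) → Linear (∑ G)
  ∑-linear [] = record
    { cong = λ _ → refl ; +-homo = λ _ _ → sym (+-identityˡ 0#) ; *-homo = λ c _ → sym (zeroʳ c) }
  ∑-linear ((c , x) ∷ G) = record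
    { cong   = λ e → ∑-cong ((c , x) ∷ G) e
    ; +-homo = λ f g → trans (+-cong (distribˡ c (f x) (g x)) (Linear.+-homo (∑-linear G) f g))
                         (interchange _ _ _ _)
    ; *-homo = λ a f → trans (+-cong (x*yz≈y*xz c a (f x)) (Linear.*-homo (∑-linear G) a f))
                         (sym (distribˡ a _ _))
    }

  ∑-++ : ∀ {X : Set} (G H : List (A × X)) f → ∑ (G ++ H) f ≈ ∑ G f + ∑ H f
  ∑-++ []            H f = sym (+-identityˡ _)
  ∑-++ ((c , x) ∷ G) H f = trans (+-congˡ (∑-++ G H f)) (sym (+-assoc _ _ _))

  ∑-homo : ∀ {X Y : Set} (G : List (A × X)) {L : (Y → A) → A} → Linear L → (g : X → Y → A) →
           ∑ G (λ x → L (g x)) ≈ L (λ y → ∑ G (λ x → g x y))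
  ∑-homo []            lin g = sym (Linear.0-homo lin λ _ → refl)
  ∑-homo ((c , x) ∷ G) lin g = trans (+-cong (sym (Linear.*-homo lin c (g x))) (∑-homo G lin g))
    (sym (Linear.+-homo lin _ _))

  χ : ∀ {P : Set} → Dec P → A
  χ (yes _) = 1#
  χ (no  _) = 0#

  χ-yes : ∀ {P : Set} (P? : Dec P) → P → χ P? ≈ 1#
  χ-yes (yes _) p = refl
  χ-yes (no ¬p) p = ⊥-elim (¬p p)

  χ-no : ∀ {P : Set} (P? : Dec P) → ¬ P → χ P? ≈ 0#
  χ-no (yes p) ¬p = ⊥-elim (¬p p)
  χ-no (no _)  ¬p = refl

  χ-⇔ : ∀ {P Q : Set} (P? : Dec P) (Q? : Dec Q) → (P → Q) → (Q → P) → χ P? ≈ χ Q?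
  χ-⇔ (yes p) Q? f g = sym (χ-yes Q? (f p))
  χ-⇔ (no ¬p) Q? f g = sym (χ-no Q? (¬p ∘ g))

  χ-× : ∀ {P Q : Set} (P? : Dec P) (Q? : Dec Q) → χ P? * χ Q? ≈ χ (P? ×-dec Q?)
  χ-× P? Q? with P? | Q?
  ... | yes p | yes q = *-identityˡ 1#
  ... | yes p | no ¬q = zeroʳ 1#
  ... | no ¬p | yes _ = zeroˡ 1#
  ... | no ¬p | no _  = zeroˡ 0#

  module _ {C : Set} where

    determinant-cong-length : ∀ n cs {f g : List C → A} → (∀ w → length w ≡ n → f w ≈ g w) →
                              determinant n cs f ≈ determinant n cs g
    determinant-cong-length zero    cs e = e [] ≡.refl
    determinant-cong-length (suc n) cs e =
      laplace-cong cs λ d r → determinant-cong-length n r λ w l → e (d ∷ w) (≡.cong suc l)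

    data Pick : List C → C → List C → Set where
      here  : ∀ {c cs} → Pick (c ∷ cs) c cs
      there : ∀ {c cs d r} → Pick cs d r → Pick (c ∷ cs) d (c ∷ r)

    laplace-zero-Pick : ∀ {cs X} → (∀ {d r} → Pick cs d r → X d r ≈ 0#) → laplace cs X ≈ 0#
    laplace-zero-Pick {[]}     z = refl
    laplace-zero-Pick {c ∷ cs} z = trans (+-cong (z here) (trans (-‿cong (laplace-zero-Pick (z ∘ there))) (sym 0≈-0)))
      (+-identityˡ 0#)

    Pick-length : ∀ {cs d r} → Pick cs d r → length cs ≡ suc (length r)
    Pick-length here      = ≡.refl
    Pick-length (there p) = ≡.cong suc (Pick-length p)

  module _ {m : ℕ} where

    private
      F = Fin m

    δ : List F → List F → A
    δ []      []      = 1#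
    δ (x ∷ u) (d ∷ w) = χ (x Fin.≟ d) * δ u w
    δ _       _       = 0#

    -- A generalised Levi-Civita symbol: the coefficient of the word u in the determinant with
    -- columns cs.
    ε : ℕ → List F → List F → A
    ε n cs u = determinant n cs (δ u)

    private
      -- Exchanging the first two letters of the word amounts to exchanging the first two columns
      -- picked. With fewer than two rows the word is too long and both sides are 0.
      ε-head : ∀ n cs x y vs → ε n cs (x ∷ y ∷ vs) ≈ - ε n cs (y ∷ x ∷ vs)
      ε-head zero          cs x y vs = 0≈-0
      ε-head (suc zero)    cs x y vs = trans (laplace-zero cs λ d r → zeroʳ _)
        (trans 0≈-0 (-‿cong (sym (laplace-zero cs λ d r → zeroʳ _))))
      ε-head (suc (suc n)) cs x y vs = +≈0⇒≈-
        (trans (+-congˡ (laplace-cong cs λ a r → laplace-cong r λ b r′ →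
          Linear.cong (determinant-linear n r′) λ w → x*yz≈y*xz _ _ _))
          (laplace²-alternates cs λ a b r′ → determinant n r′ λ w → δ (x ∷ y ∷ vs) (a ∷ b ∷ w)))

    ε-alternating : ∀ n cs → Alternating (ε n cs)
    ε-alternating n       cs []       x y vs = ε-head n cs x y vs
    ε-alternating zero    cs (u ∷ us) x y vs = 0≈-0
    ε-alternating (suc n) cs (u ∷ us) x y vs = trans
      (laplace-cong cs λ d r → trans (Linear.*-homo (determinant-linear n r) _ _)
        (trans (*-congˡ (ε-alternating n r us x y vs)) (trans (sym (-‿distribʳ-* _ _))
          (-‿cong (sym (Linear.*-homo (determinant-linear n r) _ _))))))
      (laplace-neg cs _)

    monoRows : ∀ {K k l} → (Fin K → F) → Rows {F} k l → Monomial (Entry m)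
    monoRows {zero}  ρ t           = []
    monoRows {suc K} ρ []          = []
    monoRows {suc K} ρ (one x t)   = (ρ zero , x) ∷ monoRows (ρ ∘ suc) t
    monoRows {suc K} ρ (two x y t) = (ρ zero , x) ∷ (ρ zero , y) ∷ monoRows (ρ ∘ suc) t

    -- The order of the stabiliser of t under exchanges within rows.
    mult : ∀ {k l} → Rows {F} k l → A
    mult []          = 1#
    mult (one x t)   = mult t
    mult (two x y t) = (1# + χ (x Fin.≟ y)) * mult t

    monoRows-avoids : ∀ {K k l} (r : F) (ρ : Fin K → F) (t : Rows k l) → (∀ i → ρ i ≢ r) →
                      All (λ e → proj₁ e ≢ r) (monoRows ρ t)
    monoRows-avoids {zero}  r ρ t           a = []
    monoRows-avoids {suc K} r ρ []          a = []
    monoRows-avoids {suc K} r ρ (one x t)   a = a zero ∷ monoRows-avoids r (ρ ∘ suc) t (a ∘ suc)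
    monoRows-avoids {suc K} r ρ (two x y t) a = a zero ∷ a zero ∷ monoRows-avoids r (ρ ∘ suc) t (a ∘ suc)

    private
      _↭?_ : (M N : Monomial (Entry m)) → Dec (M ↭ N)
      _↭?_ = decide-↭ _≟ᴱ_

      Avoids : F → Monomial (Entry m) → Set
      Avoids r = All (λ e → proj₁ e ≢ r)

      keep : ∀ r a {M} → Avoids r M → filter (inRow? r) ((r , a) ∷ M) ≡ (r , a) ∷ []
      keep r a v = ≡.trans (List.filter-accept (inRow? r) ≡.refl) (≡.cong (_ ∷_) (List.filter-none (inRow? r) v))

      keep₂ : ∀ r a b {M} → Avoids r M → filter (inRow? r) ((r , a) ∷ (r , b) ∷ M) ≡ (r , a) ∷ (r , b) ∷ []
      keep₂ r a b v = ≡.trans (List.filter-accept (inRow? r) ≡.refl) (≡.cong (_ ∷_) (keep r b v))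

      skip : ∀ r a {M} → Avoids r M → filter (¬? ∘ inRow? r) ((r , a) ∷ M) ≡ M
      skip r a v = ≡.trans (List.filter-reject (¬? ∘ inRow? r) (λ n → n ≡.refl)) (List.filter-all (¬? ∘ inRow? r) v)

      skip₂ : ∀ r a b {M} → Avoids r M → filter (¬? ∘ inRow? r) ((r , a) ∷ (r , b) ∷ M) ≡ M
      skip₂ r a b v = ≡.trans (List.filter-reject (¬? ∘ inRow? r) (λ n → n ≡.refl)) (skip r b v)

      pair-inv : ∀ {r a b x y : F} → (r , a) ∷ (r , b) ∷ [] ↭ (r , x) ∷ (r , y) ∷ [] →
                 (x ≡ a × y ≡ b) ⊎ (y ≡ a × x ≡ b)
      pair-inv {r} {a} {b} {x} {y} p with ∈-resp-↭ p (here ≡.refl)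
      ... | here ≡.refl with ↭-singleton-inv (↭-sym (drop-∷ p))
      ...   | ≡.refl = inj₁ (≡.refl , ≡.refl)
      pair-inv {r} {a} {b} {x} {y} p | there (here ≡.refl)
        with ↭-singleton-inv (↭-sym (drop-∷ (↭-trans p (↭.swap _ _ ↭-refl))))
      ... | ≡.refl = inj₂ (≡.refl , ≡.refl)

      pair-⊎ : ∀ {a b x y : F} (P? : Dec (x ≡ a × y ≡ b)) (Q? : Dec (y ≡ a × x ≡ b)) (E? : Dec (x ≡ y)) →
               χ P? + χ Q? ≈ (1# + χ E?) * χ (P? ⊎-dec Q?)
      pair-⊎ (yes (≡.refl , ≡.refl)) (yes (≡.refl , _)) E? =
        trans (+-congˡ (sym (χ-yes E? ≡.refl))) (sym (*-identityʳ _))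
      pair-⊎ (yes (≡.refl , ≡.refl)) (no ¬q) E? =
        trans (+-congˡ (sym (χ-no E? λ { ≡.refl → ¬q (≡.refl , ≡.refl) }))) (sym (*-identityʳ _))
      pair-⊎ (no ¬p) (yes (≡.refl , ≡.refl)) E? = trans (+-comm 0# 1#)
        (trans (+-congˡ (sym (χ-no E? λ { ≡.refl → ¬p (≡.refl , ≡.refl) }))) (sym (*-identityʳ _)))
      pair-⊎ (no _) (no _) E? = trans (+-identityˡ 0#) (sym (zeroʳ _))

    -- Each monomial is produced by as many distributions as t has symmetries.
    spread-δ : ∀ {K k l} (ρ : Fin K → F) → Distinct ρ → k ℕ.≤ K → (t : Rows k l) → ∀ w w′ →
      length w ≡ k → length w′ ≡ l →
      spread t (λ u v → δ u w * δ v w′) ≈ mult t * χ ((mono ρ w ++ mono ρ w′) ↭? monoRows ρ t)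
    spread-δ {zero} ρ d k≤K [] [] [] ≡.refl ≡.refl = *-congˡ (sym (χ-yes ([] ↭? []) ↭-refl))
    spread-δ {suc K} ρ d k≤K [] [] [] ≡.refl ≡.refl = *-congˡ (sym (χ-yes ([] ↭? []) ↭-refl))
    spread-δ {suc K} ρ d (s≤s k≤K) (one x t) (a ∷ w) [] l l′ = begin
      spread t (λ u v → (χ (x Fin.≟ a) * δ u w) * δ v [])
        ≈⟨ trans (spread-cong t λ u v → *-assoc _ _ _) (spread-* t _ _) ⟩
      χ (x Fin.≟ a) * spread t (λ u v → δ u w * δ v [])
        ≈⟨ *-congˡ (spread-δ (ρ ∘ suc) (Fin.suc-injective ∘ d) k≤K t w [] (ℕ.suc-injective l) l′) ⟩
      χ (x Fin.≟ a) * (mult t * χ (M ↭? N))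
        ≈⟨ x*yz≈y*xz _ _ _ ⟩
      mult t * (χ (x Fin.≟ a) * χ (M ↭? N))
        ≈⟨ *-congˡ (trans (χ-× (x Fin.≟ a) (M ↭? N)) (χ-⇔ (x Fin.≟ a ×-dec M ↭? N)
             (((ρ zero , a) ∷ mono (ρ ∘ suc) w ++ []) ↭? ((ρ zero , x) ∷ N))
             (λ { (≡.refl , p) → prep _ (↭-trans (↭-reflexive padded) p) }) split)) ⟩
      mult t * χ (((ρ zero , a) ∷ mono (ρ ∘ suc) w ++ []) ↭? ((ρ zero , x) ∷ N)) ∎
      where
      padded : mono (ρ ∘ suc) w ++ [] ≡ mono (ρ ∘ suc) w ++ mono (ρ ∘ suc) []
      padded = ≡.cong (mono (ρ ∘ suc) w ++_) (≡.sym (mono-[] (ρ ∘ suc)))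
      M = mono (ρ ∘ suc) w ++ mono (ρ ∘ suc) []
      N = monoRows (ρ ∘ suc) t
      avoid : ∀ i → ρ (suc i) ≢ ρ zero
      avoid i e = Fin.0≢1+n (≡.sym (d e))
      avoidM : Avoids (ρ zero) M
      avoidM = All.++⁺ (mono-avoids _ _ w avoid) (mono-avoids _ _ [] avoid)
      avoidN : Avoids (ρ zero) N
      avoidN = monoRows-avoids _ _ t avoid
      -- Only the first row has the index `ρ zero`, so filtering by the row splits the permutation.
      split : (ρ zero , a) ∷ mono (ρ ∘ suc) w ++ [] ↭ (ρ zero , x) ∷ N → x ≡ a × M ↭ N
      split p′ with ↭-trans (↭-reflexive (≡.cong ((ρ zero , a) ∷_) (≡.sym padded))) p′
      ... | p with ↭-singleton-inv (≡.subst₂ _↭_ (keep _ x avoidN) (keep _ a avoidM)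
                     (filter-↭ (inRow? (ρ zero)) (↭-sym p)))
      ...   | ≡.refl = ≡.refl , ≡.subst₂ _↭_ (skip _ a avoidM) (skip _ x avoidN)
                         (filter-↭ (¬? ∘ inRow? (ρ zero)) p)
    spread-δ {suc K} ρ d (s≤s k≤K) (two x y t) (a ∷ w) (b ∷ w′) l l′ = begin
      spread t (λ u v → (χ (x Fin.≟ a) * δ u w) * (χ (y Fin.≟ b) * δ v w′)) +
      spread t (λ u v → (χ (y Fin.≟ a) * δ u w) * (χ (x Fin.≟ b) * δ v w′))
        ≈⟨ +-cong (factor _ _) (factor _ _) ⟩
      (χ (x Fin.≟ a) * χ (y Fin.≟ b)) * S + (χ (y Fin.≟ a) * χ (x Fin.≟ b)) * S
        ≈⟨ distribʳ S _ _ ⟨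
      (χ (x Fin.≟ a) * χ (y Fin.≟ b) + χ (y Fin.≟ a) * χ (x Fin.≟ b)) * S
        ≈⟨ *-cong (+-cong (χ-× (x Fin.≟ a) (y Fin.≟ b)) (χ-× (y Fin.≟ a) (x Fin.≟ b)))
             (spread-δ (ρ ∘ suc) (Fin.suc-injective ∘ d) k≤K t w w′ (ℕ.suc-injective l) (ℕ.suc-injective l′)) ⟩
      (χ P? + χ Q?) * (mult t * χ (M ↭? N))
        ≈⟨ *-congʳ (pair-⊎ P? Q? (x Fin.≟ y)) ⟩
      ((1# + χ (x Fin.≟ y)) * χ (P? ⊎-dec Q?)) * (mult t * χ (M ↭? N))
        ≈⟨ *-interchange _ _ _ _ ⟩
      ((1# + χ (x Fin.≟ y)) * mult t) * (χ (P? ⊎-dec Q?) * χ (M ↭? N))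
        ≈⟨ *-congˡ (trans (χ-× (P? ⊎-dec Q?) (M ↭? N)) (χ-⇔ ((P? ⊎-dec Q?) ×-dec M ↭? N)
             (((ρ zero , a) ∷ mono (ρ ∘ suc) w ++ (ρ zero , b) ∷ mono (ρ ∘ suc) w′) ↭? ((ρ zero , x) ∷ (ρ zero , y) ∷ N))
             join split)) ⟩
      ((1# + χ (x Fin.≟ y)) * mult t) *
        χ (((ρ zero , a) ∷ mono (ρ ∘ suc) w ++ (ρ zero , b) ∷ mono (ρ ∘ suc) w′) ↭? ((ρ zero , x) ∷ (ρ zero , y) ∷ N)) ∎
      where
      M = mono (ρ ∘ suc) w ++ mono (ρ ∘ suc) w′
      N = monoRows (ρ ∘ suc) t
      S = spread t (λ u v → δ u w * δ v w′)
      P? = (x Fin.≟ a) ×-dec (y Fin.≟ b)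
      Q? = (y Fin.≟ a) ×-dec (x Fin.≟ b)
      factor : ∀ p q → spread t (λ u v → (p * δ u w) * (q * δ v w′)) ≈ (p * q) * S
      factor p q = trans (spread-cong t λ u v → *-interchange p _ q _) (spread-* t (p * q) _)
      gather : (ρ zero , a) ∷ mono (ρ ∘ suc) w ++ (ρ zero , b) ∷ mono (ρ ∘ suc) w′ ↭
               (ρ zero , a) ∷ (ρ zero , b) ∷ M
      gather = prep _ (shift _ (mono (ρ ∘ suc) w) _)
      avoid : ∀ i → ρ (suc i) ≢ ρ zero
      avoid i e = Fin.0≢1+n (≡.sym (d e))
      avoidM : Avoids (ρ zero) M
      avoidM = All.++⁺ (mono-avoids _ _ w avoid) (mono-avoids _ _ w′ avoid)
      avoidN : Avoids (ρ zero) N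
      avoidN = monoRows-avoids _ _ t avoid
      join : ((x ≡ a × y ≡ b) ⊎ (y ≡ a × x ≡ b)) × M ↭ N →
             (ρ zero , a) ∷ mono (ρ ∘ suc) w ++ (ρ zero , b) ∷ mono (ρ ∘ suc) w′ ↭
             (ρ zero , x) ∷ (ρ zero , y) ∷ N
      join (inj₁ (≡.refl , ≡.refl) , p) = ↭-trans gather (prep _ (prep _ p))
      join (inj₂ (≡.refl , ≡.refl) , p) = ↭-trans gather (↭.swap _ _ p)
      split : (ρ zero , a) ∷ mono (ρ ∘ suc) w ++ (ρ zero , b) ∷ mono (ρ ∘ suc) w′ ↭
              (ρ zero , x) ∷ (ρ zero , y) ∷ N →
              ((x ≡ a × y ≡ b) ⊎ (y ≡ a × x ≡ b)) × M ↭ N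
      split p′ = pair-inv (≡.subst₂ _↭_ (keep₂ _ a b avoidM) (keep₂ _ x y avoidN) (filter-↭ (inRow? (ρ zero)) p))
               , ≡.subst₂ _↭_ (skip₂ _ a b avoidM) (skip₂ _ x y avoidN) (filter-↭ (¬? ∘ inRow? (ρ zero)) p)
        where p = ↭-trans (↭-sym gather) p′

    -- The value of a functional at the product of the minors with the given columns.
    evaluate : List (List F) → (Monomial (Entry m) → A) → A
    evaluate []       f = f []
    evaluate (cs ∷ T) f = determinant (length cs) cs λ w → evaluate T λ N → f (mono id w ++ N)

    evaluate-linear : ∀ T → Linear (evaluate T)
    evaluate-linear [] = record
      { cong = λ e → e [] ; +-homo = λ _ _ → refl ; *-homo = λ _ _ → refl }
    evaluate-linear (cs ∷ T) = record
      { cong   = λ e → Linear.cong D λ w → Linear.cong (evaluate-linear T) λ N → e (mono id w ++ N)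
      ; +-homo = λ f g → trans (Linear.cong D λ w → Linear.+-homo (evaluate-linear T) _ _) (Linear.+-homo D _ _)
      ; *-homo = λ c f → trans (Linear.cong D λ w → Linear.*-homo (evaluate-linear T) c _) (Linear.*-homo D c _)
      }
      where D = determinant-linear (length cs) cs

    Invariant : (Monomial (Entry m) → A) → Set
    Invariant f = ∀ {M N} → M ↭ N → f M ≈ f N

    evaluate-↭ : ∀ {T T′ f} → T ↭ T′ → Invariant f → evaluate T f ≈ evaluate T′ f
    evaluate-↭ ↭.refl inv = refl
    evaluate-↭ (↭.prep cs p) inv = Linear.cong (determinant-linear (length cs) cs)
      λ w → evaluate-↭ p λ q → inv (++⁺ˡ (mono id w) q)
    evaluate-↭ {T = _ ∷ _ ∷ T} {_ ∷ _ ∷ T′} {f} (↭.swap cs ds p) inv = trans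
      (determinant-homo (length cs) cs (determinant-linear (length ds) ds) _)
      (Linear.cong (determinant-linear (length ds) ds) λ v →
        Linear.cong (determinant-linear (length cs) cs) λ w →
          trans (evaluate-↭ p λ q → inv (++⁺ˡ (mono id w) (++⁺ˡ (mono id v) q)))
            (Linear.cong (evaluate-linear T′) λ N → inv (exchange (mono id w) (mono id v) N)))
      where
      exchange : ∀ (M M′ N : Monomial (Entry m)) → M ++ (M′ ++ N) ↭ M′ ++ (M ++ N)
      exchange M M′ N = ↭-trans (↭-reflexive (≡.sym (List.++-assoc M M′ N)))
        (↭-trans (++⁺ʳ N (++-comm M M′)) (↭-reflexive (List.++-assoc M′ M N)))
    evaluate-↭ (↭.trans p q) inv = trans (evaluate-↭ p inv) (evaluate-↭ q inv)

    -- Leading terms of minors and of their products.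

    Monotone : ∀ {k} → (Fin k → F) → Set
    Monotone ρ = ∀ {i j} → i Fin.< j → ρ i Fin.< ρ j

    Inc-Pick : ∀ {b d} {cs r : List F} → Inc b cs → Pick cs d r → b ℕ.≤ toℕ d × Inc b r
    Inc-Pick (l ∷ ls) here      = l , Inc-weaken (ℕ.≤-trans l (ℕ.n≤1+n _)) ls
    Inc-Pick (l ∷ ls) (there p) with Inc-Pick ls p
    ... | l′ , ls′ = ℕ.≤-trans l (ℕ.<⇒≤ l′) , l ∷ ls′

    ω-swap : ∀ {k c d} {r : List F} (ρ : Fin (suc (suc k)) → F) → Monotone ρ → c Fin.< d →
             weight ω (mono ρ (d ∷ c ∷ r)) ℕ.< weight ω (mono ρ (c ∷ d ∷ r))
    ω-swap {c = c} {d} {r} ρ mon c<d = ≡.subst₂ ℕ._<_ (ℕ.+-assoc (p ℕ.* toℕ d) _ _) (ℕ.+-assoc (p ℕ.* toℕ c) _ _)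
      (ℕ.+-monoˡ-< (weight ω (mono (λ i → ρ (suc (suc i))) r)) rearranged)
      where
      p = toℕ (ρ zero)
      q = toℕ (ρ (suc zero))
      rearranged : p ℕ.* toℕ d ℕ.+ q ℕ.* toℕ c ℕ.< p ℕ.* toℕ c ℕ.+ q ℕ.* toℕ d
      rearranged with ℕ.m≤n⇒∃[o]m+o≡n (mon {zero} {suc zero} (s≤s z≤n)) | ℕ.m≤n⇒∃[o]m+o≡n c<d
      ... | e , p+e | f , c+f = ≡.subst₂ (λ q d → p ℕ.* d ℕ.+ q ℕ.* toℕ c ℕ.< p ℕ.* toℕ c ℕ.+ q ℕ.* d) p+e c+f
        (ℕ.<-≤-trans (ℕ.m<m+n _ (s≤s z≤n)) (ℕ.≤-reflexive (identity p (toℕ c) e f)))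
        where
        identity : ∀ p c e f → (p ℕ.* (suc c ℕ.+ f) ℕ.+ (suc p ℕ.+ e) ℕ.* c) ℕ.+ suc (e ℕ.+ f ℕ.+ e ℕ.* f) ≡
                   p ℕ.* c ℕ.+ (suc p ℕ.+ e) ℕ.* (suc c ℕ.+ f)
        identity = solve-∀

    -- Moving d to the front is a series of exchanges with the smaller columns before it, and each
    -- lowers the weight by `ω-swap`.
    ω-Pick : ∀ {k b d} {cs r : List F} (ρ : Fin k → F) → Monotone ρ → length cs ℕ.≤ k → Inc b cs → Pick cs d r →
             weight ω (mono ρ (d ∷ r)) ℕ.≤ weight ω (mono ρ cs)
    ω-Pick ρ mon l inc here = ℕ.≤-refl
    ω-Pick {suc zero} ρ mon (s≤s l) inc (there {cs = []} ())
    ω-Pick {suc (suc k)} ρ mon (s≤s l) (_ ∷ inc) (there {c} p) = ℕ.≤-trans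
      (ℕ.<⇒≤ (ω-swap ρ mon (proj₁ (Inc-Pick inc p))))
      (ℕ.+-monoʳ-≤ (toℕ (ρ zero) ℕ.* toℕ c) (ω-Pick (ρ ∘ suc) (mon ∘ s≤s) l inc p))

    -- Picking c leaves the diagonal of the smaller minor. For any other d the heaviest term is d
    -- followed by the rest in increasing order; it is already lighter than the diagonal, so the
    -- whole summand is 0.
    determinant-lead : ∀ {k b} n cs (ρ : Fin k → F) {f} → Monotone ρ → n ℕ.≤ k → length cs ≡ n → Inc b cs →
      (∀ w → weight ω (mono ρ w) ℕ.< weight ω (mono ρ cs) → f w ≈ 0#) → determinant n cs f ≈ f cs
    determinant-lead zero    []       ρ mon n≤k l inc z = refl
    determinant-lead {suc k} (suc n) (c ∷ cs) ρ {f} mon (s≤s n≤k) l (b≤c ∷ inc) z = begin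
      determinant n cs (λ w → f (c ∷ w)) + - laplace cs (λ d r → determinant n (c ∷ r) (λ w → f (d ∷ w)))
        ≈⟨ +-cong
             (determinant-lead n cs (ρ ∘ suc) (mon ∘ s≤s) n≤k (ℕ.suc-injective l) inc
               λ w l′ → z (c ∷ w) (ℕ.+-monoʳ-< (toℕ (ρ zero) ℕ.* toℕ c) l′))
             (trans (-‿cong (laplace-zero-Pick rest)) (sym 0≈-0)) ⟩
      f (c ∷ cs) + 0#  ≈⟨ +-identityʳ _ ⟩
      f (c ∷ cs)       ∎
      where
      rest : ∀ {d r} → Pick cs d r → determinant n (c ∷ r) (λ w → f (d ∷ w)) ≈ 0#
      rest {d} {r} p = trans
        (determinant-lead n (c ∷ r) (ρ ∘ suc) (mon ∘ s≤s) n≤k len (ℕ.≤-refl ∷ proj₂ (Inc-Pick inc p))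
          λ w l′ → z (d ∷ w) (ℕ.<-trans (ℕ.+-monoʳ-< (toℕ (ρ zero) ℕ.* toℕ d) l′) smaller))
        (z (d ∷ c ∷ r) smaller)
        where
        len : suc (length r) ≡ n
        len = ≡.trans (≡.sym (Pick-length p)) (ℕ.suc-injective l)
        bound : 2 ℕ.≤ suc k
        bound = s≤s (ℕ.≤-trans (≡.subst (1 ℕ.≤_) len (s≤s z≤n)) n≤k)
        go : ∀ {k} (ρ : Fin (suc k) → F) → Monotone ρ → n ℕ.≤ k → 2 ℕ.≤ suc k →
             weight ω (mono ρ (d ∷ c ∷ r)) ℕ.< weight ω (mono ρ (c ∷ cs))
        go {suc k} ρ mon n≤k _ = ℕ.<-≤-trans (ω-swap ρ mon (proj₁ (Inc-Pick inc p)))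
          (ℕ.+-monoʳ-≤ (toℕ (ρ zero) ℕ.* toℕ c)
            (ω-Pick (ρ ∘ suc) (mon ∘ s≤s) (ℕ.≤-trans (ℕ.≤-reflexive (ℕ.suc-injective l)) n≤k) inc p))
        go {zero} ρ mon n≤k (s≤s ())
        smaller : weight ω (mono ρ (d ∷ c ∷ r)) ℕ.< weight ω (mono ρ (c ∷ cs))
        smaller = go ρ mon n≤k bound

    Less-ω : ∀ {ws} {M N : Monomial (Entry m)} → Less (ω ∷ ws) M N → weight ω M ℕ.≤ weight ω N
    Less-ω (now l)     = ℕ.<⇒≤ l
    Less-ω (later e _) = ℕ.≤-reflexive e

    -- Leaving the diagonal in one factor lowers ω strictly, while the other factors contribute at
    -- most the ω of their diagonals; so f is 0 at all other terms.
    evaluate-lead : ∀ {T f} ws → All (Inc 0) T → (∀ M → Less (ω ∷ ws) M (diagonal T) → f M ≈ 0#) →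
                    evaluate T f ≈ f (diagonal T)
    evaluate-lead {[]}     ws []           z = refl
    evaluate-lead {cs ∷ T} {f} ws (inc ∷ incs) z = trans
      (determinant-lead (length cs) cs id (λ l → l) (≡.subst (ℕ._≤ m) (ℕ.+-identityʳ _) (Inc-length inc z≤n)) ≡.refl inc
        λ w l → trans
          (evaluate-lead ws incs λ N l′ → z (mono id w ++ N) (now (≡.subst₂ ℕ._<_
            (≡.sym (weight-++ ω (mono id w) N)) (≡.sym (weight-++ ω (mono id cs) (diagonal T)))
            (ℕ.+-mono-<-≤ l (Less-ω l′)))))
          (z (mono id w ++ diagonal T) (now (≡.subst₂ ℕ._<_
            (≡.sym (weight-++ ω (mono id w) (diagonal T))) (≡.sym (weight-++ ω (mono id cs) (diagonal T)))
            (ℕ.+-monoˡ-< (weight ω (diagonal T)) l)))))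
      (evaluate-lead ws incs λ N l → z (mono id cs ++ N) (Less-++ˡ (ω ∷ ws) (mono id cs) l))

    coefficient : Monomial (Entry m) → Monomial (Entry m) → A
    coefficient N M = χ (M ↭? N)

    coefficient-invariant : ∀ N → Invariant (coefficient N)
    coefficient-invariant N {M} {M′} p = χ-⇔ (M ↭? N) (M′ ↭? N) (↭-trans (↭-sym p)) (↭-trans p)

    coefficient-cong : ∀ {N N′} → N ↭ N′ → ∀ M → coefficient N M ≈ coefficient N′ M
    coefficient-cong {N} {N′} p M = χ-⇔ (M ↭? N) (M ↭? N′) (λ q → ↭-trans q p) (λ q → ↭-trans q (↭-sym p))

    -- Connects alternating functions of words with coefficients: once the sums are interchanged,
    -- `spread-δ` counts how often two words arise by distributing the rows of t.
    spread-ε : ∀ {k l} (t : Rows k l) → k ℕ.≤ m → ∀ cs ds → length cs ≡ k → length ds ≡ l →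
      spread t (λ u v → ε k cs u * ε l ds v) ≈ mult t * evaluate (cs ∷ ds ∷ []) (coefficient (monoRows id t))
    spread-ε {k} {l} t k≤m cs ds ≡.refl ≡.refl = begin
      spread t (λ u v → ε k cs u * ε l ds v)
        ≈⟨ spread-cong t (λ u v → trans (*-comm _ _) (trans (sym (Linear.*-homo Dc _ (δ u))) (Linear.cong Dc λ w →
             trans (*-comm _ _) (sym (Linear.*-homo Dd (δ u w) (δ v)))))) ⟩
      spread t (λ u v → determinant k cs (λ w → determinant l ds (λ w′ → δ u w * δ v w′)))
        ≈⟨ determinant-homo k cs (spread-linear t) (λ w (u , v) → determinant l ds (λ w′ → δ u w * δ v w′)) ⟨
      determinant k cs (λ w → spread t (λ u v → determinant l ds (λ w′ → δ u w * δ v w′)))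
        ≈⟨ Linear.cong Dc (λ w → sym (determinant-homo l ds (spread-linear t) (λ w′ (u , v) → δ u w * δ v w′))) ⟩
      determinant k cs (λ w → determinant l ds (λ w′ → spread t (λ u v → δ u w * δ v w′)))
        ≈⟨ determinant-cong-length k cs (λ w p → determinant-cong-length l ds λ w′ q → trans
             (spread-δ id (λ e → e) k≤m t w w′ p q)
             (*-congˡ (coefficient-invariant (monoRows id t)
               (↭-reflexive (≡.cong (mono id w ++_) (≡.sym (List.++-identityʳ (mono id w′)))))))) ⟩
      determinant k cs (λ w → determinant l ds (λ w′ → mult t * f (mono id w ++ (mono id w′ ++ []))))
        ≈⟨ Linear.cong Dc (λ w → Linear.*-homo Dd (mult t) _) ⟩
      determinant k cs (λ w → mult t * determinant l ds (λ w′ → f (mono id w ++ (mono id w′ ++ []))))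
        ≈⟨ Linear.*-homo Dc (mult t) _ ⟩
      mult t * evaluate (cs ∷ ds ∷ []) f ∎
      where
      Dc = determinant-linear k cs
      Dd = determinant-linear l ds
      f = coefficient (monoRows id t)

    evaluate-zero : ∀ cs ds N →
      (∀ w w′ → length w ≡ length cs → length w′ ≡ length ds → ¬ (mono id w ++ mono id w′ ↭ N)) →
      evaluate (cs ∷ ds ∷ []) (coefficient N) ≈ 0#
    evaluate-zero cs ds N none = trans
      (determinant-cong-length (length cs) cs λ w p → trans
        (determinant-cong-length (length ds) ds λ w′ q → χ-no (_ ↭? N)
          λ r → none w w′ p q (↭-trans (↭-reflexive (≡.cong (mono id w ++_) (≡.sym (List.++-identityʳ (mono id w′))))) r))
        (Linear.0-homo (determinant-linear (length ds) ds) λ _ → refl))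
      (Linear.0-homo (determinant-linear (length cs) cs) λ _ → refl)

    rowsOf : ∀ {K k l} (ρ : Fin K → F) → l ℕ.≤ k → ∀ w w′ → length w ≡ k → length w′ ≡ l →
             ∃ λ (t : Rows {F} k l) → mono ρ w ++ mono ρ w′ ↭ monoRows ρ t
    rowsOf {zero}  ρ l≤k []      []       ≡.refl ≡.refl = [] , ↭-refl
    rowsOf {suc K} ρ l≤k []      []       ≡.refl ≡.refl = [] , ↭-refl
    rowsOf {zero}  ρ l≤k (a ∷ w) []       ≡.refl ≡.refl =
      one a (proj₁ (rowsOf {zero} (λ ()) z≤n w [] ≡.refl ≡.refl)) , ↭-refl
    rowsOf {suc K} ρ l≤k (a ∷ w) []       ≡.refl ≡.refl with rowsOf (ρ ∘ suc) z≤n w [] ≡.refl ≡.refl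
    ... | t , p = one a t , prep _ (↭-trans
            (↭-reflexive (≡.cong (mono (ρ ∘ suc) w ++_) (≡.sym (mono-[] (ρ ∘ suc))))) p)
    rowsOf {zero}  ρ (s≤s l≤k) (a ∷ w) (b ∷ w′) ≡.refl ≡.refl =
      two a b (proj₁ (rowsOf {zero} (λ ()) l≤k w w′ ≡.refl ≡.refl)) , ↭-refl
    rowsOf {suc K} ρ (s≤s l≤k) (a ∷ w) (b ∷ w′) ≡.refl ≡.refl with rowsOf (ρ ∘ suc) l≤k w w′ ≡.refl ≡.refl
    ... | t , p = two a b t , prep _ (↭-trans (shift _ (mono (ρ ∘ suc) w) _) (prep _ p))

    left right : ∀ {k l} → Rows {F} k l → List F
    left []          = []
    left (one x t)   = x ∷ left t
    left (two x y t) = x ∷ left t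
    right []          = []
    right (one x t)   = []
    right (two x y t) = y ∷ right t

    length-left : ∀ {k l} (t : Rows {F} k l) → length (left t) ≡ k
    length-left []          = ≡.refl
    length-left (one x t)   = ≡.cong suc (length-left t)
    length-left (two x y t) = ≡.cong suc (length-left t)

    length-right : ∀ {k l} (t : Rows {F} k l) → length (right t) ≡ l
    length-right []          = ≡.refl
    length-right (one x t)   = ≡.refl
    length-right (two x y t) = ≡.cong suc (length-right t)

    columns-↭ : ∀ {K k l} (ρ : Fin K → F) (t : Rows k l) → monoRows ρ t ↭ mono ρ (left t) ++ mono ρ (right t)
    columns-↭ {zero}  ρ t           = ↭-refl
    columns-↭ {suc K} ρ []          = ↭-refl
    columns-↭ {suc K} ρ (one x t)   = prep _ (↭-trans (columns-↭ (ρ ∘ suc) t)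
      (↭-reflexive (≡.cong (mono (ρ ∘ suc) (left t) ++_)
        (≡.trans (≡.cong (mono (ρ ∘ suc)) (right-[] t)) (mono-[] (ρ ∘ suc))))))
      where
      right-[] : ∀ {k} (t : Rows k 0) → right t ≡ []
      right-[] []        = ≡.refl
      right-[] (one x t) = ≡.refl
    columns-↭ {suc K} ρ (two x y t) = prep _ (↭-trans (prep _ (columns-↭ (ρ ∘ suc) t))
      (↭-sym (shift _ (mono (ρ ∘ suc) (left t)) (mono (ρ ∘ suc) (right t)))))

    left-increasing : ∀ {k l} (t : Rows k l) → SemiStandard t → Inc 0 (left t)
    left-increasing []          _           = []
    left-increasing (one x t)   (fit , std) with t | left-increasing t std
    ... | []      | _      = z≤n ∷ []
    ... | one _ _ | _ ∷ ls = z≤n ∷ (fit ∷ ls)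
    left-increasing (two x y t) (fit , std) with t | left-increasing t std
    ... | []        | _      = z≤n ∷ []
    ... | one _ _   | _ ∷ ls = z≤n ∷ (fit ∷ ls)
    ... | two _ _ _ | _ ∷ ls = z≤n ∷ (proj₁ fit ∷ ls)

    right-increasing : ∀ {k l} (t : Rows k l) → SemiStandard t → Inc 0 (right t)
    right-increasing []          _           = []
    right-increasing (one x t)   _           = []
    right-increasing (two x y t) (fit , std) with t | right-increasing t std
    ... | []        | _      = z≤n ∷ []
    ... | one _ _   | _      = z≤n ∷ []
    ... | two _ _ _ | _ ∷ ls = z≤n ∷ (proj₂ fit ∷ ls)

    -- Each factor of `mult t` is 1 or 2.
    mult-cancel : (∀ x → x + x ≈ 0# → x ≈ 0#) → ∀ {k l} (t : Rows {F} k l) z → mult t * z ≈ 0# → z ≈ 0#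
    mult-cancel torsion []          z e = trans (sym (*-identityˡ z)) e
    mult-cancel torsion (one x t)   z e = mult-cancel torsion t z e
    mult-cancel torsion (two x y t) z e with x Fin.≟ y
    ... | yes _ = mult-cancel torsion t z (torsion _ (begin
      mult t * z + mult t * z                ≈⟨ +-cong (*-congʳ (*-identityˡ _)) (*-congʳ (*-identityˡ _)) ⟨
      (1# * mult t) * z + (1# * mult t) * z  ≈⟨ distribʳ z _ _ ⟨
      (1# * mult t + 1# * mult t) * z        ≈⟨ *-congʳ (distribʳ (mult t) 1# 1#) ⟨
      ((1# + 1#) * mult t) * z               ≈⟨ e ⟩
      0#                                     ∎))
    ... | no _  = mult-cancel torsion t z (trans (*-congʳ (sym (trans (*-congʳ (+-identityʳ 1#)) (*-identityˡ _)))) e)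

  -- Subduction.

  module _ {m : ℕ} where

    word? : ∀ k {P : List (Fin m) → Set} → (∀ w → Dec (P w)) → Dec (∃ λ w → length w ≡ k × P w)
    word? zero    P? = map′ (λ p → [] , ≡.refl , p) (λ { ([] , _ , p) → p }) (P? [])
    word? (suc k) P? = map′ (λ { (x , w , l , p) → x ∷ w , ≡.cong suc l , p })
      (λ { (x ∷ w , l , p) → x , w , ℕ.suc-injective l , p })
      (Fin.any? λ x → word? k λ w → P? (x ∷ w))

    module _ {Y : Set} (columns : Y → List (List (Fin m))) where

      total : List (A × Y) → Monomial (Entry m) → A
      total G N = ∑ G λ y → evaluate (columns y) (coefficient N)

      total-↭ : ∀ G {M N} → M ↭ N → total G M ≈ total G N
      total-↭ G p = ∑-cong G λ y → Linear.cong (evaluate-linear (columns y)) (coefficient-cong p)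

    module _ {Y : Set} (columns : Y → List (List (Fin m))) (columns-inc : ∀ y → All (Inc 0) (columns y))
             (ws : List (Entry m → ℕ)) where

      private
        lead : Y → Monomial (Entry m)
        lead y = diagonal (columns y)

        _≺_ : Monomial (Entry m) → Monomial (Entry m) → Set
        _≺_ = Less (ω ∷ ws)

      -- All terms of the product other than its lead lie below the lead, and N does not.
      evaluate-at : ∀ {y N} → ¬ N ≺ lead y → evaluate (columns y) (coefficient N) ≈ coefficient N (lead y)
      evaluate-at {y} {N} N⊀ = evaluate-lead ws (columns-inc y) λ M M≺ → χ-no (decide-↭ _≟ᴱ_ M N)
        λ p → N⊀ (Less-respˡ (ω ∷ ws) (↭⇒Equal (ω ∷ ws) p) M≺)

      Descending : List Y → Set
      Descending = AllPairs (λ y z → ¬ lead y ≺ lead z)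

      insert : Y → List Y → List Y
      insert y []       = y ∷ []
      insert y (z ∷ zs) with compareBy (ω ∷ ws) (lead y) (lead z)
      ... | inj₁ _ = z ∷ insert y zs
      ... | inj₂ _ = y ∷ z ∷ zs

      insert-All : ∀ {P : Y → Set} y zs → P y → All P zs → All P (insert y zs)
      insert-All y []       p []       = p ∷ []
      insert-All y (z ∷ zs) p (q ∷ qs) with compareBy (ω ∷ ws) (lead y) (lead z)
      ... | inj₁ _ = q ∷ insert-All y zs p qs
      ... | inj₂ _ = p ∷ q ∷ qs

      insert-descending : ∀ y zs → Descending zs → Descending (insert y zs)
      insert-descending y []       []       = [] ∷ []
      insert-descending y (z ∷ zs) (d ∷ ds) with compareBy (ω ∷ ws) (lead y) (lead z)
      ... | inj₁ l = insert-All y zs (Less-asym (ω ∷ ws) l) d ∷ insert-descending y zs ds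
      ... | inj₂ ¬l = (not ¬l ∷ All.map (λ {x} z⊀x y≺x → z⊀x (above ¬l y≺x)) d) ∷ d ∷ ds
        where
        not : Equal (ω ∷ ws) (lead y) (lead z) ⊎ lead z ≺ lead y → ¬ lead y ≺ lead z
        not (inj₁ e) = Less-irrefl (ω ∷ ws) e
        not (inj₂ l) = Less-asym (ω ∷ ws) l
        above : ∀ {x} → Equal (ω ∷ ws) (lead y) (lead z) ⊎ lead z ≺ lead y → lead y ≺ lead x → lead z ≺ lead x
        above (inj₁ e) = Less-respˡ (ω ∷ ws) e
        above (inj₂ l) = Less-trans (ω ∷ ws) l

      descend : List Y → List Y
      descend []       = []
      descend (y ∷ ys) = insert y (descend ys)

      descend-descending : ∀ ys → Descending (descend ys)
      descend-descending []       = []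
      descend-descending (y ∷ ys) = insert-descending y (descend ys) (descend-descending ys)

      ∈-insert-here : ∀ y zs → y ∈ insert y zs
      ∈-insert-here y []       = here ≡.refl
      ∈-insert-here y (z ∷ zs) with compareBy (ω ∷ ws) (lead y) (lead z)
      ... | inj₁ _ = there (∈-insert-here y zs)
      ... | inj₂ _ = here ≡.refl

      ∈-insert-there : ∀ {x} y zs → x ∈ zs → x ∈ insert y zs
      ∈-insert-there y (z ∷ zs) i with compareBy (ω ∷ ws) (lead y) (lead z)
      ∈-insert-there y (z ∷ zs) (here e)  | inj₁ _ = here e
      ∈-insert-there y (z ∷ zs) (there i) | inj₁ _ = there (∈-insert-there y zs i)
      ∈-insert-there y (z ∷ zs) i         | inj₂ _ = there i

      ∈-descend : ∀ {x} ys → x ∈ ys → x ∈ descend ys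
      ∈-descend (y ∷ ys) (here ≡.refl) = ∈-insert-here y (descend ys)
      ∈-descend (y ∷ ys) (there i)     = ∈-insert-there y (descend ys) (∈-descend ys i)

      descend-All : ∀ {P : Y → Set} ys → All P ys → All P (descend ys)
      descend-All []       []       = []
      descend-All (y ∷ ys) (p ∷ ps) = insert-All y (descend ys) p (descend-All ys ps)

      Preserves : List Y → List (A × Y) → List (A × Y) → Set
      Preserves ys G H = ∀ N → All (λ y → ¬ N ≺ lead y) ys → total columns G N ≈ 0# → total columns H N ≈ 0#

      -- Elimination from the largest lead downwards. Adding a multiple of y changes, among the
      -- monomials not below its lead, only the coefficient at the lead, so the zeros obtained
      -- before survive.
      subtract : ∀ ys → Descending ys → ∀ G → ∃ λ E →
        All (λ e → proj₂ e ∈ ys) E × (∀ {y} → y ∈ ys → total columns (G ++ E) (lead y) ≈ 0#) × Preserves ys G (G ++ E)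
      subtract []       []       G = [] , [] , (λ ()) , λ N _ e →
        trans (∑-++ G [] _) (trans (+-identityʳ _) e)
      subtract (y ∷ ys) (d ∷ ds) G with subtract ys ds (G ++ (- total columns G (lead y) , y) ∷ [])
      ... | E , E∈ , zeros , preserves =
        (c , y) ∷ E , here ≡.refl ∷ All.map there E∈ , zeros′ , preserves′
        where
        c = - total columns G (lead y)
        G₁ = G ++ (c , y) ∷ []
        assoc : ∀ N → total columns (G₁ ++ E) N ≈ total columns (G ++ (c , y) ∷ E) N
        assoc N = reflexive (≡.cong (λ H → total columns H N) (List.++-assoc G ((c , y) ∷ []) E))
        step : ∀ N → ¬ N ≺ lead y → total columns G₁ N ≈ total columns G N + c * coefficient N (lead y)
        step N N⊀ = trans (∑-++ G _ _) (+-congˡ (trans (+-identityʳ _) (*-congˡ (evaluate-at N⊀))))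
        first : total columns G₁ (lead y) ≈ 0#
        first = begin
          total columns G₁ (lead y)
            ≈⟨ step (lead y) (Less-irrefl (ω ∷ ws) (↭⇒Equal (ω ∷ ws) (↭-refl {x = lead y}))) ⟩
          total columns G (lead y) + c * coefficient (lead y) (lead y)
            ≈⟨ +-congˡ (trans (*-congˡ (χ-yes (decide-↭ _≟ᴱ_ (lead y) (lead y)) ↭-refl)) (*-identityʳ c)) ⟩
          total columns G (lead y) + c
            ≈⟨ -‿inverseʳ _ ⟩
          0# ∎
        zeros′ : ∀ {z} → z ∈ y ∷ ys → total columns (G ++ (c , y) ∷ E) (lead z) ≈ 0#
        zeros′ (here ≡.refl) = trans (sym (assoc (lead y))) (preserves (lead y) d first)
        zeros′ (there z∈)    = trans (sym (assoc _)) (zeros z∈)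
        preserves′ : Preserves (y ∷ ys) G (G ++ (c , y) ∷ E)
        preserves′ N (N⊀ ∷ N⊀s) e = trans (sym (assoc N)) (preserves N N⊀s
          (trans (step N N⊀) (still (decide-↭ _≟ᴱ_ (lead y) N))))
          where
          still : Dec (lead y ↭ N) → total columns G N + c * coefficient N (lead y) ≈ 0#
          -- Here N is the lead of y, as happens when an earlier product has the same lead. The
          -- coefficient there is 0 already, hence c is 0.
          still (yes p) = trans (+-cong e (*-congʳ (trans (-‿cong (trans (total-↭ columns G p) e)) -0#≈0#)))
            (trans (+-identityˡ _) (zeroˡ _))
          still (no ¬p) = trans (+-cong e (*-congˡ (χ-no (decide-↭ _≟ᴱ_ (lead y) N) ¬p)))
            (trans (+-identityˡ _) (zeroʳ c))

    module _ (torsion₂ : ∀ x → x + x ≈ 0# → x ≈ 0#) (torsion₃ : ∀ x → x + x + x ≈ 0# → x ≈ 0#)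
             {Y : Set} (long short : Y → List (Fin m)) where

      private
        both : Y → List (List (Fin m))
        both y = long y ∷ short y ∷ []

      Shape : ℕ → ℕ → Y → Set
      Shape k l y = length (long y) ≡ k × length (short y) ≡ l

      -- The combination becomes a bialternating function F of two words, whose `spread` over an
      -- array t is `mult t` times the coefficient at the monomial of t. For a semistandard t this
      -- monomial is the product of the diagonals of its two increasing columns, where the
      -- hypothesis applies.
      vanishing : ∀ {k l} → l ℕ.≤ k → k ℕ.≤ m → ∀ {G} → All (Shape k l ∘ proj₂) G →
        (∀ cs ds → Inc 0 cs → Inc 0 ds → length cs ≡ k → length ds ≡ l →
          total both G (diagonal (cs ∷ ds ∷ [])) ≈ 0#) →
        ∀ N → total both G N ≈ 0#
      vanishing {k} {l} l≤k k≤m {G} shape semi N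
        with word? k (λ w → word? l (λ w′ → decide-↭ _≟ᴱ_ (mono id w ++ mono id w′) N))
      -- No two words of lengths k and l multiply to N, so N occurs in none of the products.
      ... | no none = trans (∑-cong-All {P = Shape k l} shape λ {y} → λ { (p , q) →
              evaluate-zero (long y) (short y) N λ w w′ r s t → none (w , ≡.trans r p , w′ , ≡.trans s q , t) })
              (Linear.0-homo (∑-linear G) λ _ → refl)
      ... | yes (w , p , w′ , q , r) with rowsOf id l≤k w w′ p q
      ...   | t , s = trans (total-↭ both G (↭-trans (↭-sym r) s))
                (mult-cancel torsion₂ t _ (trans (sym (spread-total t))
                  (determined-by-semiStandard torsion₂ torsion₃ bialternating semi′ t)))
        where
        F : List (Fin m) → List (Fin m) → A
        F u v = ∑ G λ y → ε k (long y) u * ε l (short y) v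
        bialternating : Bialternating F
        bialternating = record
          { altˡ = λ v us x y vs → trans
              (∑-cong G λ z → trans (*-congʳ (ε-alternating k (long z) us x y vs)) (sym (-‿distribˡ-* _ _)))
              (Linear.-‿homo (∑-linear G) _)
          ; altʳ = λ u us x y vs → trans
              (∑-cong G λ z → trans (*-comm _ _) (trans (*-congʳ (ε-alternating l (short z) us x y vs))
                (trans (sym (-‿distribˡ-* _ _)) (-‿cong (*-comm _ _)))))
              (Linear.-‿homo (∑-linear G) _)
          }
        spread-total : ∀ (t : Rows k l) → spread t F ≈ mult t * total both G (monoRows id t)
        spread-total t = begin
          spread t F
            ≈⟨ ∑-homo G (spread-linear t) (λ y (u , v) → ε k (long y) u * ε l (short y) v) ⟨
          ∑ G (λ y → spread t (λ u v → ε k (long y) u * ε l (short y) v))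
            ≈⟨ ∑-cong-All {P = Shape k l} shape (λ {y} → λ { (p , q) → spread-ε t k≤m (long y) (short y) p q }) ⟩
          ∑ G (λ y → mult t * evaluate (long y ∷ short y ∷ []) (coefficient (monoRows id t)))
            ≈⟨ Linear.*-homo (∑-linear G) (mult t) _ ⟩
          mult t * total both G (monoRows id t) ∎
        semi′ : ∀ (t : Rows k l) → Sorted t → SemiStandard t → spread t F ≈ 0#
        semi′ t _ std = trans (spread-total t) (trans (*-congˡ (trans
          (total-↭ both G (↭-trans (columns-↭ id t)
            (↭-reflexive (≡.cong (mono id (left t) ++_) (≡.sym (List.++-identityʳ _))))))
          (semi (left t) (right t) (left-increasing t std) (right-increasing t std) (length-left t) (length-right t))))
          (zeroʳ _))

  -- Relations between minors.

  module _ {V : Set} (_≟_ : DecidableEquality V) where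

    coeffOf : List (A × Monomial V) → Monomial V → A
    coeffOf f N = ∑ f λ M → χ (decide-↭ _≟_ M N)

    -- A formal sum may repeat a monomial, so a coefficient can be split off only together with all
    -- terms of that monomial.
    remove : Monomial V → List (A × Monomial V) → List (A × Monomial V)
    remove N []            = []
    remove N ((c , M) ∷ f) with decide-↭ _≟_ M N
    ... | yes _ = remove N f
    ... | no  _ = (c , M) ∷ remove N f

    length-remove : ∀ N f → length (remove N f) ℕ.≤ length f
    length-remove N []            = z≤n
    length-remove N ((c , M) ∷ f) with decide-↭ _≟_ M N
    ... | yes _ = ℕ.≤-trans (length-remove N f) (ℕ.n≤1+n _)
    ... | no  _ = s≤s (length-remove N f)

    ∑-remove : ∀ N f {φ} → (∀ {M} → M ↭ N → φ M ≈ φ N) → ∑ f φ ≈ coeffOf f N * φ N + ∑ (remove N f) φ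
    ∑-remove N []            {φ} inv = sym (trans (+-identityʳ _) (zeroˡ (φ N)))
    ∑-remove N ((c , M) ∷ f) {φ} inv with decide-↭ _≟_ M N
    ... | yes p = begin
      c * φ M + ∑ f φ
        ≈⟨ +-cong (trans (*-congˡ (inv p)) (*-congʳ (sym (*-identityʳ c)))) (∑-remove N f inv) ⟩
      (c * 1#) * φ N + (coeffOf f N * φ N + ∑ (remove N f) φ)
        ≈⟨ trans (sym (+-assoc _ _ _)) (+-congʳ (sym (distribʳ (φ N) _ _))) ⟩
      (c * 1# + coeffOf f N) * φ N + ∑ (remove N f) φ ∎
    ... | no _ = begin
      c * φ M + ∑ f φ
        ≈⟨ +-congˡ (∑-remove N f inv) ⟩
      c * φ M + (coeffOf f N * φ N + ∑ (remove N f) φ)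
        ≈⟨ trans (sym (+-assoc _ _ _)) (trans (+-congʳ (+-comm _ _)) (+-assoc _ _ _)) ⟩
      coeffOf f N * φ N + (c * φ M + ∑ (remove N f) φ)
        ≈⟨ +-congʳ (*-congʳ (trans (+-congʳ (zeroʳ c)) (+-identityˡ _))) ⟨
      (c * 0# + coeffOf f N) * φ N + (c * φ M + ∑ (remove N f) φ) ∎

    coeff-remove-≢ : ∀ {N K} f → ¬ (K ↭ N) → coeffOf (remove N f) K ≈ coeffOf f K
    coeff-remove-≢ []            n = refl
    coeff-remove-≢ {N} {K} ((c , M) ∷ f) n with decide-↭ _≟_ M N
    ... | yes p = trans (coeff-remove-≢ f n) (sym (trans (+-congʳ (trans (*-congˡ (χ-no (decide-↭ _≟_ M K)
                    λ q → n (↭-trans (↭-sym q) p))) (zeroʳ c))) (+-identityˡ _)))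
    ... | no _  = +-congˡ (coeff-remove-≢ f n)

    coeff-remove-≡ : ∀ {N K} f → K ↭ N → coeffOf (remove N f) K ≈ 0#
    coeff-remove-≡ []            p = refl
    coeff-remove-≡ {N} {K} ((c , M) ∷ f) p with decide-↭ _≟_ M N
    ... | yes _ = coeff-remove-≡ f p
    ... | no ¬q = trans (+-cong (trans (*-congˡ (χ-no (decide-↭ _≟_ M K) λ q → ¬q (↭-trans q p))) (zeroʳ c))
                    (coeff-remove-≡ f p)) (+-identityˡ 0#)

    -- The vanishing factor is supplied for each monomial, so that coefficients are never tested for
    -- 0.
    Vanishes : List (A × Monomial V) → (Monomial V → A) → Set
    Vanishes f φ = ∀ N → coeffOf f N ≈ 0# ⊎ φ N ≈ 0#

    -- Induction on a bound for the length, since collecting one monomial may delete several terms.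
    ∑-vanishes : ∀ n f {φ} → length f ℕ.≤ n → (∀ {M N} → M ↭ N → φ M ≈ φ N) → Vanishes f φ → ∑ f φ ≈ 0#
    ∑-vanishes n       []            l       inv v = refl
    ∑-vanishes (suc n) ((c , M) ∷ f) {φ} (s≤s l) inv v = begin
      ∑ ((c , M) ∷ f) φ
        ≈⟨ ∑-remove M ((c , M) ∷ f) inv ⟩
      coeffOf ((c , M) ∷ f) M * φ M + ∑ (remove M ((c , M) ∷ f)) φ
        ≈⟨ +-cong (product (v M)) (∑-vanishes n (remove M ((c , M) ∷ f)) (shorter (decide-↭ _≟_ M M)) inv vanishes) ⟩
      0# + 0#
        ≈⟨ +-identityˡ 0# ⟩
      0# ∎
      where
      product : coeffOf ((c , M) ∷ f) M ≈ 0# ⊎ φ M ≈ 0# → coeffOf ((c , M) ∷ f) M * φ M ≈ 0#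
      product (inj₁ e) = trans (*-congʳ e) (zeroˡ _)
      product (inj₂ e) = trans (*-congˡ e) (zeroʳ _)
      shorter : Dec (M ↭ M) → length (remove M ((c , M) ∷ f)) ℕ.≤ n
      shorter _ with decide-↭ _≟_ M M
      ... | yes _ = ℕ.≤-trans (length-remove M f) l
      ... | no ¬p = ⊥-elim (¬p ↭-refl)
      vanishes : Vanishes (remove M ((c , M) ∷ f)) φ
      vanishes N with decide-↭ _≟_ N M | v N
      ... | yes p | _      = inj₁ (coeff-remove-≡ ((c , M) ∷ f) p)
      ... | no ¬p | inj₁ e = inj₁ (trans (coeff-remove-≢ ((c , M) ∷ f) ¬p) e)
      ... | no ¬p | inj₂ e = inj₂ e

    ∑-single : ∀ N f {φ} → (∀ {M N} → M ↭ N → φ M ≈ φ N) →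
               (∀ M → ¬ (M ↭ N) → coeffOf f M ≈ 0# ⊎ φ M ≈ 0#) → ∑ f φ ≈ coeffOf f N * φ N
    ∑-single N f {φ} inv v = trans (∑-remove N f inv)
      (trans (+-congˡ (∑-vanishes _ (remove N f) ℕ.≤-refl inv vanishes)) (+-identityʳ _))
      where
      vanishes : Vanishes (remove N f) φ
      vanishes M with decide-↭ _≟_ M N
      ... | yes p = inj₁ (coeff-remove-≡ f p)
      ... | no ¬p with v M ¬p
      ...   | inj₁ e = inj₁ (trans (coeff-remove-≢ f ¬p) e)
      ...   | inj₂ e = inj₂ e

  ∑-map : ∀ {X Y : Set} (h : X → Y) (G : List (A × X)) φ → ∑ (map (λ (c , x) → c , h x) G) φ ≈ ∑ G (φ ∘ h)
  ∑-map h []            φ = refl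
  ∑-map h ((c , x) ∷ G) φ = +-congˡ (∑-map h G φ)

  module _ {m : ℕ} (L : PartialStaircase m) where

    private
      V = 2^[ L ]
      _≟_ = ≟-2^[ L ]
      cs = columnsOf L
      O = order L
      infix 4 _≺_
      _≺_ = TermOrder._≺_ O

    imageCoefficient : List (A × Monomial V) → Monomial (Entry m) → A
    imageCoefficient f N = ∑ f λ M → evaluate (map cs M) (coefficient N)

    increasing : ∀ M → All (Inc 0) (map cs M)
    increasing []      = []
    increasing (I ∷ M) = columnsOf-increasing L I ∷ increasing M

    diagonal-map : ∀ M → diagonal (map cs M) ≡ diagonals L M
    diagonal-map M = List.concatMap-map (mono id) cs M

    private
      _≺ₓ_ : Monomial (Entry m) → Monomial (Entry m) → Set
      _≺ₓ_ = _≺ₑ_ L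

      ↭⇒¬≺ : ∀ {M N} → M ↭ N → ¬ M ≺ₓ N
      ↭⇒¬≺ p = Less-irrefl (entryWeights L) (↭⇒Equal (entryWeights L) p)

    evaluate-diagonal : ∀ M N → ¬ N ≺ₓ diagonals L M →
                        evaluate (map cs M) (coefficient N) ≈ coefficient N (diagonals L M)
    evaluate-diagonal M N N⊀ = trans
      (evaluate-lead (entryIndicators L) (increasing M) λ K K≺ → χ-no (decide-↭ _≟ᴱ_ K N)
        λ p → N⊀ (≡.subst (N ≺ₓ_) (diagonal-map M) (Less-respˡ (entryWeights L) (↭⇒Equal (entryWeights L) p) K≺)))
      (reflexive (≡.cong (coefficient N) (diagonal-map M)))

    -- Consider the coefficient of the image of f at the product D of the diagonals of M. Monomials
    -- above M are absent from f. Those below M have smaller leads, as `good-minimal` excludes the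
    -- lead D, and do not reach D. What remains is the coefficient of f at M.
    good-not-initial : ∀ {M f} → Good L M → (∀ N → imageCoefficient f N ≈ 0#) →
                       (∀ N → M ≺ N → coeffOf _≟_ f N ≈ 0#) → coeffOf _≟_ f M ≈ 0#
    good-not-initial {M} {f} good zeros above = begin
      coeffOf _≟_ f M            ≈⟨ *-identityʳ _ ⟨
      coeffOf _≟_ f M * 1#       ≈⟨ *-congˡ φM ⟨
      coeffOf _≟_ f M * φ M      ≈⟨ ∑-single _≟_ M f invariant others ⟨
      imageCoefficient f D       ≈⟨ zeros D ⟩
      0#                         ∎
      where
      D = diagonals L M
      φ : Monomial V → A
      φ N = evaluate (map cs N) (coefficient D)
      invariant : ∀ {N K} → N ↭ K → φ N ≈ φ K
      invariant p = evaluate-↭ (map⁺ cs p) (coefficient-invariant D)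
      φM : φ M ≈ 1#
      φM = trans (evaluate-diagonal M D (↭⇒¬≺ ↭-refl)) (χ-yes (decide-↭ _≟ᴱ_ D D) ↭-refl)
      others : ∀ N → ¬ (N ↭ M) → coeffOf _≟_ f N ≈ 0# ⊎ φ N ≈ 0#
      others N N≢M with ≺-compare L N M
      ... | inj₂ (inj₁ p) = ⊥-elim (N≢M p)
      ... | inj₂ (inj₂ l) = inj₁ (above N l)
      ... | inj₁ l with ≺-diagonals L {N} {M} l
      ...   | inj₂ p  = ⊥-elim (good-minimal L good N p l)
      ...   | inj₁ l′ = inj₂ (trans (evaluate-diagonal N D (Less-asym (entryWeights L) l′))
                          (χ-no (decide-↭ _≟ᴱ_ (diagonals L N) D) λ p → ↭⇒¬≺ p l′))

    -- By `resize` every subset of the size of I is a vertex.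
    ofSize : V → List (Subset m) → List V
    ofSize I []       = []
    ofSize I (S ∷ Ss) with ∣ S ∣ ℕ.≟ ∣ value I ∣
    ... | yes e = resize L I S e ∷ ofSize I Ss
    ... | no  _ = ofSize I Ss

    ∈-ofSize⁺ : ∀ I Ss (J : V) → value J ∈ Ss → ∣ value J ∣ ≡ ∣ value I ∣ → J ∈ ofSize I Ss
    ∈-ofSize⁺ I (S ∷ Ss) J J∈ e with ∣ S ∣ ℕ.≟ ∣ value I ∣
    ∈-ofSize⁺ I (S ∷ Ss) J (here v)   e | yes _ = here (value-injective v)
    ∈-ofSize⁺ I (S ∷ Ss) J (there J∈) e | yes _ = there (∈-ofSize⁺ I Ss J J∈ e)
    ∈-ofSize⁺ I (S ∷ Ss) J (here ≡.refl) e | no ¬e = ⊥-elim (¬e e)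
    ∈-ofSize⁺ I (S ∷ Ss) J (there J∈) e | no _ = ∈-ofSize⁺ I Ss J J∈ e

    ∈-ofSize⁻ : ∀ I Ss {J} → J ∈ ofSize I Ss → ∣ value J ∣ ≡ ∣ value I ∣
    ∈-ofSize⁻ I (S ∷ Ss) J∈ with ∣ S ∣ ℕ.≟ ∣ value I ∣
    ∈-ofSize⁻ I (S ∷ Ss) (here ≡.refl) | yes e = e
    ∈-ofSize⁻ I (S ∷ Ss) (there J∈)    | yes _ = ∈-ofSize⁻ I Ss J∈
    ∈-ofSize⁻ I (S ∷ Ss) J∈            | no _  = ∈-ofSize⁻ I Ss J∈

    size⇒length : ∀ (B I : V) → ∣ value B ∣ ≡ ∣ value I ∣ → length (cs B) ≡ length (cs I)
    size⇒length B I e = ≡.trans (length-cols (value B)) (≡.trans e (≡.sym (length-cols (value I))))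

    length⇒size : ∀ (B I : V) → length (cs B) ≡ length (cs I) → ∣ value B ∣ ≡ ∣ value I ∣
    length⇒size B I e = ≡.trans (≡.sym (length-cols (value B))) (≡.trans e (length-cols (value I)))

    -- A witness that T is an initial monomial, with leading coefficient normalised to 1 and
    -- membership in the kernel expressed by the coefficients of the image.
    record Relation (T : Monomial V) : Set where
      field
        terms        : List (A × Monomial V)
        inKernel     : ∀ N → imageCoefficient terms N ≈ 0#
        leading      : coeffOf _≟_ terms T ≈ 1#
        nothingAbove : ∀ N → T ≺ N → coeffOf _≟_ terms N ≈ 0#

    empty-relation : ∀ I → cs I ≡ [] → Relation (I ∷ [])
    empty-relation I e = record
      { terms        = (1# , I ∷ []) ∷ (- 1# , []) ∷ []
      ; inKernel     = λ N → trans (+-cong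
          (trans (*-identityˡ _) (reflexive (≡.cong (λ xs → evaluate (xs ∷ []) (coefficient N)) e)))
          (trans (+-identityʳ _) (trans (-1*x≈-x _) (-‿cong (reflexive
            (≡.cong (λ M → coefficient N (M ++ [])) (≡.sym (mono-[] {m} id))))))))
          (-‿inverseʳ _)
      ; leading      = trans (+-cong (trans (*-identityˡ _) (χ-yes (decide-↭ _≟_ (I ∷ []) (I ∷ [])) ↭-refl))
          (trans (+-identityʳ _) (trans (*-congˡ (χ-no (decide-↭ _≟_ [] (I ∷ [])) λ p → ¬x∷xs↭[] (↭-sym p))) (zeroʳ _))))
          (+-identityʳ 1#)
      ; nothingAbove = λ N l → trans (+-cong
          (trans (*-congˡ (χ-no (decide-↭ _≟_ (I ∷ []) N) λ p → ≺-irrefl L p l)) (zeroʳ _))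
          (trans (+-identityʳ _) (trans (*-congˡ (χ-no (decide-↭ _≟_ [] N) λ p →
            ≺-irrefl L ↭-refl (≺-trans L ([]-≺ L I) (≺-respʳ L (↭-sym p) l)))) (zeroʳ _))))
          (+-identityʳ 0#)
      }

    module _ (torsion₂ : ∀ x → x + x ≈ 0# → x ≈ 0#) (torsion₃ : ∀ x → x + x + x ≈ 0# → x ≈ 0#) where

      -- The longer column comes first to suit `Rows k l`. Only products of the shape of x_I x_J are
      -- subtracted, as `vanishing` asks about products of diagonals of that one shape.
      relation : ∀ I J → length (cs J) ℕ.≤ length (cs I) → Uncrossing L I J → Relation (I ∷ J ∷ [])
      relation I J l≤k u with uncrossed L I J u
      ... | I′ , J′ , (sizeI , sizeJ) , diag , smaller = record
        { terms        = map (λ (c , y) → c , pair y) G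
        ; inKernel     = λ N → trans (∑-map pair G _)
            (vanishing torsion₂ torsion₃ long short l≤k short-enough shape semi N)
        ; leading      = trans (∑-map pair G _) (trans (+-cong
            (trans (*-identityˡ _) (χ-yes (decide-↭ _≟_ T T) ↭-refl)) (rest-vanishes T λ l → ≺-irrefl L ↭-refl l))
            (+-identityʳ 1#))
        ; nothingAbove = λ N T≺N → trans (∑-map pair G _) (trans (+-cong
            (trans (*-congˡ (χ-no (decide-↭ _≟_ T N) λ p → ≺-irrefl L p T≺N)) (zeroʳ 1#))
            (rest-vanishes N λ N≺T → ≺-irrefl L ↭-refl (≺-trans L T≺N N≺T)))
            (+-identityʳ 0#))
        }
        where
        T = I ∷ J ∷ []
        Y = V × V
        pair : Y → Monomial V
        pair (B , C) = B ∷ C ∷ []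
        long short : Y → List (Fin m)
        long  (B , C) = cs B
        short (B , C) = cs C
        columns : Y → List (List (Fin m))
        columns y = long y ∷ short y ∷ []
        columns-inc : ∀ y → All (Inc 0) (columns y)
        columns-inc y = increasing (pair y)
        lead : Y → Monomial (Entry m)
        lead y = diagonal (columns y)
        lead-diagonals : ∀ y → lead y ≡ diagonals L (pair y)
        lead-diagonals y = diagonal-map (pair y)
        short-enough : length (cs I) ℕ.≤ m
        short-enough = ≡.subst (ℕ._≤ m) (ℕ.+-identityʳ _) (Inc-length (columnsOf-increasing L I) z≤n)
        below? : ∀ y → Dec (lead y ≺ₓ lead (I , J))
        below? y with compareBy (entryWeights L) (lead y) (lead (I , J))
        ... | inj₁ l        = yes l
        ... | inj₂ (inj₁ e) = no (Less-irrefl (entryWeights L) e)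
        ... | inj₂ (inj₂ l) = no (Less-asym (entryWeights L) l)
        candidates = cartesianProduct (ofSize I (subsets m)) (ofSize J (subsets m))
        pool = filter below? candidates
        ws = entryIndicators L
        pool↓ = descend columns columns-inc ws pool
        OK : Y → Set
        OK y = Shape torsion₂ torsion₃ long short (length (cs I)) (length (cs J)) y × lead y ≺ₓ lead (I , J)
        pool-OK : All OK pool
        pool-OK = All.tabulate λ {y} y∈ →
          let (y∈′ , l) = ∈-filter⁻ below? {xs = candidates} y∈
              (B∈ , C∈) = ∈-cartesianProduct⁻ (ofSize I (subsets m)) (ofSize J (subsets m)) y∈′
          in ( size⇒length (proj₁ y) I (∈-ofSize⁻ I (subsets m) B∈)
             , size⇒length (proj₂ y) J (∈-ofSize⁻ J (subsets m) C∈)) , l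
        pool↓-OK : All OK pool↓
        pool↓-OK = descend-All columns columns-inc ws pool pool-OK
        -- Uncrossing keeps the product of diagonals, so the two leads cancel.
        G₀ = (1# , (I , J)) ∷ (- 1# , (I′ , J′)) ∷ []
        subtraction = subtract columns columns-inc ws pool↓ (descend-descending columns columns-inc ws pool) G₀
        E = proj₁ subtraction
        E∈ = proj₁ (proj₂ subtraction)
        zeros = proj₁ (proj₂ (proj₂ subtraction))
        preserves = proj₂ (proj₂ (proj₂ subtraction))
        rest = (- 1# , (I′ , J′)) ∷ E
        G = (1# , (I , J)) ∷ rest
        E-OK : All (OK ∘ proj₂) E
        E-OK = All.map (All.lookup pool↓-OK) E∈
        shape : All (Shape torsion₂ torsion₃ long short (length (cs I)) (length (cs J)) ∘ proj₂) G
        shape = (≡.refl , ≡.refl) ∷ (sizeI , sizeJ) ∷ All.map proj₁ E-OK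
        rest-below : All (λ e → pair (proj₂ e) ≺ T) rest
        rest-below = smaller ∷ All.map (λ {e} ok → ≺-from-diagonals L {pair (proj₂ e)} {T}
          (≡.subst₂ _≺ₓ_ (lead-diagonals (proj₂ e)) (lead-diagonals (I , J)) (proj₂ ok))) E-OK
        rest-vanishes : ∀ N → ¬ N ≺ T → ∑ rest (λ y → χ (decide-↭ _≟_ (pair y) N)) ≈ 0#
        rest-vanishes N N⊀T = trans
          (∑-cong-All {P = λ y → pair y ≺ T} {G = rest} rest-below λ {y} y≺T →
            χ-no (decide-↭ _≟_ (pair y) N) λ p → N⊀T (≺-respˡ L p y≺T))
          (Linear.0-homo (∑-linear rest) λ _ → refl)
        lead′ : lead (I′ , J′) ↭ lead (I , J)
        lead′ = ≡.subst₂ _↭_ (≡.sym (lead-diagonals (I′ , J′))) (≡.sym (lead-diagonals (I , J))) diag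
        start-vanishes : ∀ N → ¬ N ≺ₓ lead (I , J) → total columns G₀ N ≈ 0#
        start-vanishes N N⊀ = begin
          1# * evaluate (columns (I , J)) (coefficient N) + (- 1# * evaluate (columns (I′ , J′)) (coefficient N) + 0#)
            ≈⟨ +-cong (trans (*-identityˡ _) (evaluate-at columns columns-inc ws {I , J} N⊀))
                 (trans (+-identityʳ _) (trans (-1*x≈-x _) (-‿cong (trans
                   (evaluate-at columns columns-inc ws {I′ , J′} λ l →
                     N⊀ (Less-respʳ (entryWeights L) (↭⇒Equal (entryWeights L) lead′) l))
                   (coefficient-invariant N lead′))))) ⟩
          coefficient N (lead (I , J)) + - coefficient N (lead (I , J))
            ≈⟨ -‿inverseʳ _ ⟩
          0# ∎
        -- The two columns are vertices B and C. If their lead is below that of I and J, the pair is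
        -- in the pool and its coefficient was made 0; otherwise the coefficient was 0 from the
        -- start and is preserved.
        semi : ∀ xs ys → Inc 0 xs → Inc 0 ys → length xs ≡ length (cs I) → length ys ≡ length (cs J) →
               total columns G (diagonal (xs ∷ ys ∷ [])) ≈ 0#
        semi xs ys incx incy lx ly with fromColumns L I xs incx lx | fromColumns L J ys incy ly
        ... | B , ≡.refl | C , ≡.refl with below? (B , C)
        ...   | yes l = zeros (∈-descend columns columns-inc ws pool (∈-filter⁺ below?
                  (∈-cartesianProduct⁺ (∈-ofSize⁺ I (subsets m) B (∈-subsets (value B)) (length⇒size B I lx))
                                       (∈-ofSize⁺ J (subsets m) C (∈-subsets (value C)) (length⇒size C J ly))) l))
        ...   | no ¬l = preserves (lead (B , C))
                  (All.map (λ ok l → ¬l (Less-trans (entryWeights L) l (proj₂ ok))) pool↓-OK)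
                  (start-vanishes (lead (B , C)) ¬l)

  -- Formal sums.

  inverse⇒torsion : ∀ {n h} → h * n ≈ 1# → ∀ {x} → n * x ≈ 0# → x ≈ 0#
  inverse⇒torsion {n} {h} inv {x} e = begin
    x            ≈⟨ *-identityˡ x ⟨
    1# * x       ≈⟨ *-congʳ inv ⟨
    (h * n) * x  ≈⟨ *-assoc h n x ⟩
    h * (n * x)  ≈⟨ trans (*-congˡ e) (zeroʳ h) ⟩
    0#           ∎

  2*x : ∀ x → (1# + 1#) * x ≈ x + x
  2*x x = trans (distribʳ x 1# 1#) (+-cong (*-identityˡ x) (*-identityˡ x))

  3*x : ∀ x → (1# + 1# + 1#) * x ≈ x + x + x
  3*x x = trans (distribʳ x _ 1#) (+-cong (2*x x) (*-identityˡ x))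

  sumFin : ∀ {n} → (Fin n → A) → A
  sumFin {zero}  h = 0#
  sumFin {suc n} h = h zero + sumFin (h ∘ suc)

  sumFin-cong : ∀ {n} {h h′ : Fin n → A} → (∀ j → h j ≈ h′ j) → sumFin h ≈ sumFin h′
  sumFin-cong {zero}  e = refl
  sumFin-cong {suc n} e = +-cong (e zero) (sumFin-cong (e ∘ suc))

  sumFin-neg : ∀ {n} (h : Fin n → A) → sumFin (λ j → - h j) ≈ - sumFin h
  sumFin-neg {zero}  h = sym -0#≈0#
  sumFin-neg {suc n} h = trans (+-congˡ (sumFin-neg (h ∘ suc))) (-‿+-comm _ _)

  signum : ℕ → A
  signum zero    = 1#
  signum (suc n) = - signum n

  -- `laplace` recurses on the list of columns, whereas `det` sums over indices with explicit signs;
  -- this matches the two.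
  laplace-sumFin : ∀ {C : Set} {n} (cs : Vec C (suc n)) X → laplace (toList cs) X ≈
    sumFin (λ j → signum (toℕ j) * X (lookup cs j) (toList (removeAt cs j)))
  laplace-sumFin (c ∷ [])          X = +-cong (sym (*-identityˡ _)) -0#≈0#
  laplace-sumFin {n = suc n} (c ∷ cs@(_ ∷ _)) X = +-cong (sym (*-identityˡ _)) (begin
    - laplace (toList cs) (λ d r → X d (c ∷ r))  ≈⟨ -‿cong (laplace-sumFin cs (λ d r → X d (c ∷ r))) ⟩
    - sumFin (λ j → signum (toℕ j) * h j)        ≈⟨ sumFin-neg (λ j → signum (toℕ j) * h j) ⟨
    sumFin (λ j → - (signum (toℕ j) * h j))      ≈⟨ sumFin-cong (λ j → -‿distribˡ-* (signum (toℕ j)) (h j)) ⟩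
    sumFin (λ j → - signum (toℕ j) * h j)        ∎)
    where
    h : Fin (suc n) → A
    h j = X (lookup cs j) (c ∷ toList (removeAt cs j))

  module _ {V : Set} where

    multiply : List (A × Monomial V) → List (A × Monomial V) → List (A × Monomial V)
    multiply f g = concatMap (λ (c , M) → map (λ (d , N) → c * d , M ++ N) g) f

    ∑-multiply : ∀ f g φ → ∑ (multiply f g) φ ≈ ∑ f (λ M → ∑ g (λ N → φ (M ++ N)))
    ∑-multiply []            g φ = refl
    ∑-multiply ((c , M) ∷ f) g φ = trans (∑-++ (map (λ (d , N) → c * d , M ++ N) g) _ φ)
      (+-cong (scaled g) (∑-multiply f g φ))
      where
      scaled : ∀ g → ∑ (map (λ (d , N) → c * d , M ++ N) g) φ ≈ c * ∑ g (λ N → φ (M ++ N))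
      scaled []            = sym (zeroʳ c)
      scaled ((d , N) ∷ g) = trans (+-cong (*-assoc c d _) (scaled g)) (sym (distribˡ c _ _))

    ∑-negate : ∀ (f : List (A × Monomial V)) φ → ∑ (map (λ (c , M) → - c , M) f) φ ≈ - ∑ f φ
    ∑-negate []            φ = sym -0#≈0#
    ∑-negate ((c , M) ∷ f) φ = trans (+-cong (sym (-‿distribˡ-* c _)) (∑-negate f φ)) (-‿+-comm _ _)

    ∑-term : ∀ c (M : Monomial V) φ → ∑ ((c , M) ∷ []) φ ≈ c * φ M
    ∑-term c M φ = +-identityʳ _

    ∑-tabulate : ∀ {n} (g : Fin n → List (A × Monomial V)) φ →
      ∑ (foldr _++_ [] (tabulate g)) φ ≈ sumFin (λ j → ∑ (g j) φ)
    ∑-tabulate {zero}  g φ = refl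
    ∑-tabulate {suc n} g φ = trans (∑-++ (g zero) _ φ) (+-congˡ (∑-tabulate (g ∘ suc) φ))

    -- One summand of `det`, associated as there: s is the sign, p the matrix entry and g the
    -- smaller determinant, which acts as the functional h.
    signed-product : ∀ s σ p v g (h : (Monomial V → A) → A) →
      (∀ φ → ∑ s φ ≈ σ * φ []) → p ≡ (1# , v ∷ []) ∷ [] → (∀ φ → ∑ g φ ≈ h φ) →
      ∀ φ → ∑ (multiply (multiply s p) g) φ ≈ σ * h (λ N → φ (v ∷ N))
    signed-product s σ p v g h es ≡.refl eg φ = begin
      ∑ (multiply (multiply s ((1# , v ∷ []) ∷ [])) g) φ
        ≈⟨ ∑-multiply (multiply s _) g φ ⟩
      ∑ (multiply s ((1# , v ∷ []) ∷ [])) (λ M → ∑ g (λ N → φ (M ++ N)))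
        ≈⟨ ∑-multiply s _ _ ⟩
      ∑ s (λ M → ∑ ((1# , v ∷ []) ∷ []) (λ M′ → ∑ g (λ N → φ ((M ++ M′) ++ N))))
        ≈⟨ es _ ⟩
      σ * ∑ ((1# , v ∷ []) ∷ []) (λ M′ → ∑ g (λ N → φ (M′ ++ N)))
        ≈⟨ *-congˡ (trans (+-identityʳ _) (trans (*-identityˡ _) (eg _))) ⟩
      σ * h (λ N → φ (v ∷ N)) ∎

    ++-cancelˡ : ∀ (P : Monomial V) {M N} → P ++ M ↭ P ++ N → M ↭ N
    ++-cancelˡ []      p = p
    ++-cancelˡ (x ∷ P) p = ++-cancelˡ P (drop-∷ p)

    module _ (_≟_ : DecidableEquality V) where

      private
        χ↭ : Monomial V → Monomial V → A
        χ↭ N M = χ (decide-↭ _≟_ M N)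

      -- For a monomial M of h, all terms K′ of f with M K′ = N are permutations of a single K, by
      -- cancellation; so they add up to the coefficient of f at K.
      multiply-vanishes : ∀ h f N → (∀ {M K} → N ↭ M ++ K → coeffOf _≟_ f K ≈ 0#) →
                          coeffOf _≟_ (multiply h f) N ≈ 0#
      multiply-vanishes h f N zeros = trans (∑-multiply h f (χ↭ N)) (Linear.0-homo (∑-linear h) inner)
        where
        none : ∀ M (g : List (A × Monomial V)) → ¬ Any (λ (_ , K) → M ++ K ↭ N) g → ∑ g (λ K → χ↭ N (M ++ K)) ≈ 0#
        none M []            ¬any = refl
        none M ((c , K) ∷ g) ¬any = trans (+-cong
          (trans (*-congˡ (χ-no (decide-↭ _≟_ (M ++ K) N) (¬any ∘ here))) (zeroʳ c)) (none M g (¬any ∘ there)))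
          (+-identityˡ 0#)
        witness : ∀ {M} {g : List (A × Monomial V)} → Any (λ (_ , K) → M ++ K ↭ N) g → ∃ λ K → N ↭ M ++ K
        witness (here {c , K} p) = K , ↭-sym p
        witness (there a)        = witness a
        inner : ∀ M → ∑ f (λ K → χ↭ N (M ++ K)) ≈ 0#
        inner M with any? (λ (_ , K) → decide-↭ _≟_ (M ++ K) N) f
        ... | no ¬any = none M f ¬any
        ... | yes any with witness any
        ...   | K , p = trans (∑-cong f λ K′ → χ-⇔ (decide-↭ _≟_ (M ++ K′) N) (decide-↭ _≟_ K′ K)
                  (λ q → ++-cancelˡ M (↭-trans q p)) (λ q → ↭-trans (++⁺ˡ M q) (↭-sym p))) (zeros {M} p)

open OverRing ℂ-commutativeRing
open CommutativeRing ℂ-commutativeRing hiding (zero)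
open Algebra.Properties.Ring ring using (-‿distribˡ-*)
open Relation.Binary.Reasoning.Setoid setoid


-- Complex coefficients.

ratio : ℚ.ℚ → ℂ
ratio q = fromℚ q +i fromℚ ℚ.0ℚ

½*2≈1 : ratio ℚ.½ * (1# + 1#) ≈ 1#
-- All sequences are constant and the difference evaluates to 0, so the index 0 serves for every ε.
½*2≈1 = (λ ε 0<ε → 0 , λ n _ → 0<ε) , (λ ε 0<ε → 0 , λ n _ → 0<ε)

⅓*3≈1 : ratio ((ℤ.+ 1) ℚ./ 3) * (1# + 1# + 1#) ≈ 1#
⅓*3≈1 = (λ ε 0<ε → 0 , λ n _ → 0<ε) , (λ ε 0<ε → 0 , λ n _ → 0<ε)

torsion₂ : ∀ x → x + x ≈ 0# → x ≈ 0#
torsion₂ x e = inverse⇒torsion {1# + 1#} {ratio ℚ.½} ½*2≈1 {x} (begin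
  (1# + 1#) * x ≈⟨ 2*x x ⟩ x + x ≈⟨ e ⟩ 0# ∎)

torsion₃ : ∀ x → x + x + x ≈ 0# → x ≈ 0#
torsion₃ x e = inverse⇒torsion {1# + 1# + 1#} {ratio ((ℤ.+ 1) ℚ./ 3)} ⅓*3≈1 {x} (begin
  (1# + 1# + 1#) * x ≈⟨ 3*x x ⟩ x + x + x ≈⟨ e ⟩ 0# ∎)

1≉0 : ¬ 1# ≈ 0#
-- At ε = 1 the distance between 1 and 0 would have to be less than 1.
1≉0 (e , _) with e ℚ.1ℚ (ℚ.positive⁻¹ ℚ.1ℚ)
... | N , h = ℚ.<-irrefl ≡.refl (h N ℕ.≤-refl)

-- Coefficients of polynomials as values of functionals.

module _ {V : Set} (_≟_ : DecidableEquality V) where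
  open Polynomial _≟_ hiding (_+ₚ_)

  coeff-∑ : ∀ f N → coeff f N ≈ coeffOf _≟_ f N
  coeff-∑ []            N = refl {0#}
  coeff-∑ ((c , M) ∷ f) N with decide-↭ _≟_ M N
  ... | yes _ = +-cong {c} {c * 1#} {coeff f N} {coeffOf _≟_ f N} (sym {c * 1#} {c} (*-identityʳ c)) (coeff-∑ f N)
  ... | no  _ = begin
    coeff f N                  ≈⟨ coeff-∑ f N ⟩
    coeffOf _≟_ f N            ≈⟨ +-identityˡ (coeffOf _≟_ f N) ⟨
    0# + coeffOf _≟_ f N       ≈⟨ +-congʳ {coeffOf _≟_ f N} {c * 0#} {0#} (zeroʳ c) ⟨
    c * 0# + coeffOf _≟_ f N   ∎

  sign-∑ : ∀ n φ → ∑ (sign n) φ ≈ signum n * φ []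
  sign-∑ zero    φ = ∑-term 1# [] φ
  sign-∑ (suc n) φ = begin
    ∑ (-ₚ sign n) φ      ≈⟨ ∑-negate (sign n) φ ⟩
    - ∑ (sign n) φ       ≈⟨ -‿cong {∑ (sign n) φ} {signum n * φ []} (sign-∑ n φ) ⟩
    - (signum n * φ [])  ≈⟨ -‿distribˡ-* (signum n) (φ []) ⟩
    - signum n * φ []    ∎

lookup-removeAt : ∀ {A : Set} {n} (xs : Vec A (suc n)) j b → lookup xs (punchIn j b) ≡ lookup (removeAt xs j) b
lookup-removeAt (x ∷ xs)         zero    b       = ≡.refl
lookup-removeAt (x ∷ xs@(_ ∷ _)) (suc j) zero    = ≡.refl
lookup-removeAt (x ∷ xs@(_ ∷ _)) (suc j) (suc b) = lookup-removeAt xs j b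

-- Minors as determinants of their columns.

module _ {m : ℕ} where
  open Polynomial (_≟ᴱ_ {m})

  -- ρ lists the rows still available: expanding along the first row leaves a matrix on the later
  -- ones.
  det-∑ : ∀ {n k} (B : Fin n → Fin n → Poly) (ρ : Fin k → Fin m) (n≤k : n ℕ.≤ k) (cs : Vec (Fin m) n) →
    (∀ a b → B a b ≡ var (ρ (inject≤ a n≤k) , lookup cs b)) →
    ∀ φ → ∑ (det B) φ ≈ determinant n (toList cs) (λ w → φ (mono ρ w))
  det-∑ {zero}  B ρ n≤k []  e φ = begin
    1# * φ [] + 0#   ≈⟨ ∑-term 1# [] φ ⟩
    1# * φ []        ≈⟨ *-identityˡ (φ []) ⟩
    φ []             ≡⟨ ≡.cong φ (mono-[] ρ) ⟨
    φ (mono ρ [])    ∎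
  det-∑ {suc n} {suc k} B ρ (s≤s n≤k) cs e φ = begin
    ∑ (det B) φ
      ≈⟨ ∑-tabulate (λ j → sign (toℕ j) *ₚ B zero j *ₚ D j) φ ⟩
    sumFin (λ j → ∑ (sign (toℕ j) *ₚ B zero j *ₚ D j) φ)
      ≈⟨ sumFin-cong {h = λ j → ∑ (sign (toℕ j) *ₚ B zero j *ₚ D j) φ}
           {h′ = λ j → signum (toℕ j) * X (lookup cs j) (toList (removeAt cs j))} column ⟩
    sumFin (λ j → signum (toℕ j) * X (lookup cs j) (toList (removeAt cs j)))
      ≈⟨ laplace-sumFin cs X ⟨
    determinant (suc n) (toList cs) (λ w → φ (mono ρ w)) ∎
    where
    D : Fin (suc n) → Poly
    D j = det (λ a b → B (suc a) (punchIn j b))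
    X : Fin m → List (Fin m) → ℂ
    X d r = determinant n r (λ w → φ ((ρ zero , d) ∷ mono (ρ ∘ suc) w))
    column : ∀ j → ∑ (sign (toℕ j) *ₚ B zero j *ₚ D j) φ ≈ signum (toℕ j) * X (lookup cs j) (toList (removeAt cs j))
    column j = signed-product (sign (toℕ j)) (signum (toℕ j)) (B zero j) (ρ zero , lookup cs j) (D j)
      (λ ψ → determinant n (toList (removeAt cs j)) (λ w → ψ (mono (ρ ∘ suc) w)))
      (sign-∑ _≟ᴱ_ (toℕ j)) (e zero j)
      (det-∑ (λ a b → B (suc a) (punchIn j b)) (ρ ∘ suc) n≤k (removeAt cs j)
        (λ a b → ≡.trans (e (suc a) (punchIn j b))
          (≡.cong (λ c → var (ρ (suc (inject≤ a n≤k)) , c)) (lookup-removeAt cs j b))))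
      φ

  minor-∑ : ∀ I φ → ∑ (minor I) φ ≈ determinant (length (cols I)) (cols I) (λ w → φ (mono id w))
  minor-∑ I φ = begin
    ∑ (minor I) φ
      ≈⟨ det-∑ (λ a b → var (inject≤ a (∣p∣≤n I) , lookup (elements I) b)) id (∣p∣≤n I) (elements I) (λ _ _ → ≡.refl) φ ⟩
    determinant ∣ I ∣ (cols I) (λ w → φ (mono id w))
      ≡⟨ ≡.cong (λ n → determinant n (cols I) (λ w → φ (mono id w))) (length-cols I) ⟨
    determinant (length (cols I)) (cols I) (λ w → φ (mono id w)) ∎

-- The kernel and its initial ideal.

module _ {m : ℕ} (L : PartialStaircase m) where

  private
    V = 2^[ L ]
    _≟_ = ≟-2^[ L ]
    O = order L
    image : V → Polynomial.Poly (_≟ᴱ_ {m})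
    image I = minor (value I)

  open Polynomial _≟_
  private module T = Polynomial (_≟ᴱ_ {m})

  product-∑ : ∀ T φ → ∑ (T.productₚ (map image T)) φ ≈ evaluate (map (columnsOf L) T) φ
  product-∑ []      φ = begin
    1# * φ [] + 0#  ≈⟨ ∑-term 1# [] φ ⟩
    1# * φ []       ≈⟨ *-identityˡ (φ []) ⟩
    φ []            ∎
  product-∑ (I ∷ T) φ = begin
    ∑ (image I T.*ₚ P) φ
      ≈⟨ ∑-multiply (image I) P φ ⟩
    ∑ (image I) (λ M → ∑ P (λ N → φ (M ++ N)))
      ≈⟨ minor-∑ (value I) (λ M → ∑ P (λ N → φ (M ++ N))) ⟩
    determinant (length cs) cs (λ w → ∑ P (λ N → φ (mono id w ++ N)))
      ≈⟨ Linear.cong (determinant-linear (length cs) cs)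
           {λ w → ∑ P (λ N → φ (mono id w ++ N))} {λ w → evaluate (map (columnsOf L) T) (λ N → φ (mono id w ++ N))}
           (λ w → product-∑ T (λ N → φ (mono id w ++ N))) ⟩
    evaluate (map (columnsOf L) (I ∷ T)) φ ∎
    where
    P = T.productₚ (map image T)
    cs = columnsOf L I

  hom-∑ : ∀ f φ → ∑ (Hom.hom _≟_ _≟ᴱ_ image f) φ ≈ ∑ f (λ M → evaluate (map (columnsOf L) M) φ)
  hom-∑ []            φ = refl {0#}
  hom-∑ ((c , M) ∷ f) φ = begin
    ∑ ((T.const c T.*ₚ P) ++ rest) φ
      ≈⟨ ∑-++ (T.const c T.*ₚ P) rest φ ⟩
    ∑ (T.const c T.*ₚ P) φ + ∑ rest φ
      ≈⟨ +-cong {∑ (T.const c T.*ₚ P) φ} {c * evaluate (map (columnsOf L) M) φ} {∑ rest φ}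
           {∑ f (λ M → evaluate (map (columnsOf L) M) φ)} scaled (hom-∑ f φ) ⟩
    c * evaluate (map (columnsOf L) M) φ + ∑ f (λ M → evaluate (map (columnsOf L) M) φ) ∎
    where
    P = T.productₚ (map image M)
    rest = Hom.hom _≟_ _≟ᴱ_ image f
    scaled : ∑ (T.const c T.*ₚ P) φ ≈ c * evaluate (map (columnsOf L) M) φ
    scaled = begin
      ∑ (T.const c T.*ₚ P) φ                ≈⟨ ∑-multiply (T.const c) P φ ⟩
      ∑ (T.const c) (λ M → ∑ P (λ N → φ (M ++ N))) ≈⟨ ∑-term c [] (λ M → ∑ P (λ N → φ (M ++ N))) ⟩
      c * ∑ P φ                             ≈⟨ *-congˡ {c} {∑ P φ} {evaluate (map (columnsOf L) M) φ} (product-∑ M φ) ⟩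
      c * evaluate (map (columnsOf L) M) φ  ∎

  image-∑ : ∀ f N → T.coeff (Hom.hom _≟_ _≟ᴱ_ image f) N ≈ imageCoefficient L f N
  image-∑ f N = begin
    T.coeff (Hom.hom _≟_ _≟ᴱ_ image f) N      ≈⟨ coeff-∑ _≟ᴱ_ (Hom.hom _≟_ _≟ᴱ_ image f) N ⟩
    ∑ (Hom.hom _≟_ _≟ᴱ_ image f) (coefficient N) ≈⟨ hom-∑ f (coefficient N) ⟩
    imageCoefficient L f N                    ∎

  Initial : Monomial V → Set
  Initial M = ∃ λ f → K[ L ] f × IsInitialMonomial O f M

  -- Induction on the generation of the ideal. For a multiple, an initial monomial that divides a
  -- cofactor K of N also divides N.
  ideal-coefficient : ∀ {g} → initialIdeal O K[ L ] g →
    ∀ N → (∀ {M P} → Initial M → ¬ (N ↭ P ++ M)) → coeff g N ≈ 0#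
  ideal-coefficient (gen {g} (f , f∈ , M , M-init , ≡.refl)) N nondiv = begin
    coeff (monomial M) N                      ≈⟨ coeff-∑ _≟_ (monomial M) N ⟩
    coeffOf _≟_ (monomial M) N                ≈⟨ ∑-term 1# M (λ M → χ (decide-↭ _≟_ M N)) ⟩
    1# * χ (decide-↭ _≟_ M N)                 ≈⟨ *-identityˡ (χ (decide-↭ _≟_ M N)) ⟩
    χ (decide-↭ _≟_ M N)                      ≈⟨ χ-no (decide-↭ _≟_ M N)
        (λ p → nondiv {M} {[]} (f , f∈ , M-init) (↭-sym p)) ⟩
    0#                                        ∎
  ideal-coefficient null N nondiv = refl {0#}
  ideal-coefficient (add {f} {g} i j) N nondiv = begin
    coeff (f +ₚ g) N                    ≈⟨ coeff-∑ _≟_ (f +ₚ g) N ⟩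
    coeffOf _≟_ (f +ₚ g) N              ≈⟨ ∑-++ f g (λ M → χ (decide-↭ _≟_ M N)) ⟩
    coeffOf _≟_ f N + coeffOf _≟_ g N   ≈⟨ +-cong
        {coeffOf _≟_ f N} {0#} {coeffOf _≟_ g N} {0#} (zero-∑ f i) (zero-∑ g j) ⟩
    0# + 0#                             ≈⟨ +-identityˡ 0# ⟩
    0#                                  ∎
    where
    zero-∑ : ∀ f → initialIdeal O K[ L ] f → coeffOf _≟_ f N ≈ 0#
    zero-∑ f i = begin
      coeffOf _≟_ f N  ≈⟨ coeff-∑ _≟_ f N ⟨
      coeff f N        ≈⟨ ideal-coefficient i N nondiv ⟩
      0#               ∎
  ideal-coefficient (mul h {f} i) N nondiv = begin
    coeff (h *ₚ f) N        ≈⟨ coeff-∑ _≟_ (h *ₚ f) N ⟩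
    coeffOf _≟_ (h *ₚ f) N  ≈⟨ multiply-vanishes _≟_ h f N (λ {M} {K} p → begin
        coeffOf _≟_ f K       ≈⟨ coeff-∑ _≟_ f K ⟨
        coeff f K             ≈⟨ ideal-coefficient i K (λ {M₀} {P} init q → nondiv {M₀} {M ++ P} init
          (↭-trans p (↭-trans (++⁺ˡ M q) (↭-reflexive (≡.sym (List.++-assoc M P M₀)))))) ⟩
        0#                    ∎) ⟩
    0#                      ∎
  ideal-coefficient (resp {f} {g} e i) N nondiv = begin
    coeff g N  ≈⟨ e N ⟨
    coeff f N  ≈⟨ ideal-coefficient i N nondiv ⟩
    0#         ∎

  Good-divisor : ∀ {T M} P → T ↭ P ++ M → Good L T → Good L M
  Good-divisor P p (face , avoids) =
    (λ I∈ J∈ → face (∈-resp-↭ (↭-sym p) (∈-++⁺ʳ P I∈)) (∈-resp-↭ (↭-sym p) (∈-++⁺ʳ P J∈)))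
    , All.++⁻ʳ P (All-resp-↭ p avoids)

  -- Divisors of a good monomial are good, hence not initial by `good-not-initial`. So
  -- `ideal-coefficient` would make the coefficient 1 of T vanish.
  good⇒standard : ∀ T → Good L T → IsStandardMonomial L O T
  good⇒standard T good i = 1≉0 (begin
    1#                          ≈⟨ χ-yes (decide-↭ _≟_ T T) ↭-refl ⟨
    χ (decide-↭ _≟_ T T)        ≈⟨ *-identityˡ (χ (decide-↭ _≟_ T T)) ⟨
    1# * χ (decide-↭ _≟_ T T)   ≈⟨ ∑-term 1# T (λ M → χ (decide-↭ _≟_ M T)) ⟨
    coeffOf _≟_ (monomial T) T  ≈⟨ coeff-∑ _≟_ (monomial T) T ⟨
    coeff (monomial T) T        ≈⟨ ideal-coefficient i T nondiv ⟩
    0#                          ∎)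
    where
    nondiv : ∀ {M P} → Initial M → ¬ (T ↭ P ++ M)
    nondiv {M} {P} (f , f∈ , nonzero , above) p = nonzero (begin
      coeff f M        ≈⟨ coeff-∑ _≟_ f M ⟩
      coeffOf _≟_ f M  ≈⟨ good-not-initial L {M} {f} (Good-divisor P p good)
        (λ N → begin
          imageCoefficient L f N                ≈⟨ image-∑ f N ⟨
          T.coeff (Hom.hom _≟_ _≟ᴱ_ image f) N  ≈⟨ f∈ N ⟩
          0#                                    ∎)
        (λ N l → begin
          coeffOf _≟_ f N  ≈⟨ coeff-∑ _≟_ f N ⟨
          coeff f N        ≈⟨ above N l ⟩
          0#               ∎) ⟩
      0#               ∎)

  relation⇒initial : ∀ {M} → Relation L M → Initial M
  relation⇒initial {M} r = terms
    , (λ N → begin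
        T.coeff (Hom.hom _≟_ _≟ᴱ_ image terms) N  ≈⟨ image-∑ terms N ⟩
        imageCoefficient L terms N                ≈⟨ inKernel N ⟩
        0#                                        ∎)
    , (λ e → 1≉0 (begin
        1#                   ≈⟨ leading ⟨
        coeffOf _≟_ terms M  ≈⟨ coeff-∑ _≟_ terms M ⟨
        coeff terms M        ≈⟨ e ⟩
        0#                   ∎))
    , λ N l → begin
        coeff terms N        ≈⟨ coeff-∑ _≟_ terms N ⟩
        coeffOf _≟_ terms N  ≈⟨ nothingAbove N l ⟩
        0#                   ∎
    where open Relation r

  multiple∈ideal : ∀ {T M} P → T ↭ P ++ M → Initial M → initialIdeal O K[ L ] (monomial T)
  multiple∈ideal {T} {M} P p (f , f∈ , M-init) =
    resp same (mul (monomial P) (gen (f , f∈ , M , M-init , ≡.refl)))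
    where
    same : monomial P *ₚ monomial M ≋ monomial T
    same N = begin
      coeff (monomial P *ₚ monomial M) N       ≈⟨ coeff-∑ _≟_ (monomial P *ₚ monomial M) N ⟩
      coeffOf _≟_ (monomial P *ₚ monomial M) N ≈⟨ ∑-term (1# * 1#) (P ++ M) (λ M → χ (decide-↭ _≟_ M N)) ⟩
      (1# * 1#) * χ (decide-↭ _≟_ (P ++ M) N)  ≈⟨ *-congʳ {χ (decide-↭ _≟_ (P ++ M) N)} {1# * 1#} {1#} (*-identityˡ 1#) ⟩
      1# * χ (decide-↭ _≟_ (P ++ M) N)         ≈⟨ *-congˡ {1#} {χ (decide-↭ _≟_ (P ++ M) N)} {χ (decide-↭ _≟_ T N)}
        (χ-⇔ (decide-↭ _≟_ (P ++ M) N) (decide-↭ _≟_ T N) (↭-trans p) (↭-trans (↭-sym p))) ⟩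
      1# * χ (decide-↭ _≟_ T N)                ≈⟨ ∑-term 1# T (λ M → χ (decide-↭ _≟_ M N)) ⟨
      coeffOf _≟_ (monomial T) N               ≈⟨ coeff-∑ _≟_ (monomial T) N ⟨
      coeff (monomial T) N                     ∎

  empty-initial : ∀ {T} → HasEmpty L T → initialIdeal O K[ L ] (monomial T)
  empty-initial {T} (I , P , p , e) = multiple∈ideal {T} {I ∷ []} P
    (↭-trans p (++-comm (I ∷ []) P)) (relation⇒initial {I ∷ []} (empty-relation L I e))

  -- `relation` takes the longer column first; a crossing can be read in either order.
  crossing-initial : ∀ {T} → HasCrossing L T → initialIdeal O K[ L ] (monomial T)
  crossing-initial {T} (I , J , P , p , e , is′ , js′ , u) =
    split (ℕ.≤-total (length (columnsOf L J)) (length (columnsOf L I)))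
    where
    split : length (columnsOf L J) ℕ.≤ length (columnsOf L I) ⊎ length (columnsOf L I) ℕ.≤ length (columnsOf L J) →
            initialIdeal O K[ L ] (monomial T)
    split (inj₁ l) = multiple∈ideal {T} {I ∷ J ∷ []} P (↭-trans p (++-comm (I ∷ J ∷ []) P))
      (relation⇒initial {I ∷ J ∷ []} (relation L torsion₂ torsion₃ I J l (e , is′ , js′ , u)))
    split (inj₂ l) = multiple∈ideal {T} {J ∷ I ∷ []} P
      (↭-trans p (↭-trans (swap I J ↭-refl) (++-comm (J ∷ I ∷ []) P)))
      (relation⇒initial {J ∷ I ∷ []} (relation L torsion₂ torsion₃ J I l (e , js′ , is′ , Uncross-sym u)))

  -- Being standard is a negation; the decision `good?` turns it into a positive conclusion.
  standard⇒good : ∀ T → IsStandardMonomial L O T → Good L T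
  standard⇒good T standard = decide (good? L T)
    where
    decide : Good L T ⊎ HasEmpty L T ⊎ HasCrossing L T → Good L T
    decide (inj₁ good)     = good
    decide (inj₂ (inj₁ h)) = ⊥-elim (standard (empty-initial {T} h))
    decide (inj₂ (inj₂ h)) = ⊥-elim (standard (crossing-initial {T} h))

corollary8p2 : (m : ℕ) .{{_ : NonZero m}} (L : PartialStaircase m) →
    Σ (TermOrder 2^[ L ]) λ O → (T : Monomial 2^[ L ]) →
    IsStandardMonomial L O T ⇔ (IsFace L (support T) × AvoidsEmpty L T)
corollary8p2 m L = order L , λ T → mk⇔ (standard⇒good L T) (good⇒standard L T)
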